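{- For every composition $\eta\in\mathbb{N}^n$ with $\eta\ne0$, $$x^{\underline\eta}=w_\eta\,x^{\underline{\eta^*}}+r\sum_{\gamma\in P[\eta]}x^{\underline\gamma}.$$
   Context: Fix $n\ge1$; $r$ is an indeterminate, $\alpha=1/r$, $\mathbb{F}=\mathbb{Q}(r)$, polynomials lie in $\mathbb{F}[x_1,\dots,x_n]$. Compositions are $\eta\in\mathbb{N}^n$, $|\eta|=\sum\eta_i$, $x^\eta=\prod x_i^{\eta_i}$; partitions are weakly decreasing compositions; $\delta=(n-1,\dots,0)$; permutations act on vectors by $(wv)_{w(i)}=v_i$; $w_\gamma$ is the minimal-length permutation with $w_\gamma^{ -1}(\gamma)$ a partition, and $\overline\gamma=\gamma+w_\gamma(r\delta)$. Let $E_\eta^{r\delta}$ be the unique polynomial of degree $|\eta|$ vanishing at all $\overline\gamma$ with $\gamma\ne\eta$, $|\gamma|\le|\eta|$, with coefficient $1$ on $x^\eta$, and $E_\eta^{(\alpha)}$ its top homogeneous component. With $a_\eta(i,j)=\eta_i-j$, $l_\eta(i,j)=\#\{k>i:j\le\eta_k\le\eta_i\}+\#\{k<i:j\le\eta_k+1\le\eta_i\}$, $d_\eta(\alpha)=\prod_{1\le j\le\eta_i}(\alpha(a_\eta(i,j)+1)+l_\eta(i,j)+1)$, put $F_\eta^{(\alpha)}=d_\eta E_\eta^{(\alpha)}$, $F_\eta^{r\delta}(x)=(-1)^{|\eta|}d_\eta E_\eta^{r\delta}(-x)$; $\Xi$ is the unique $\mathbb{F}$-linear operator with $\Xi(F_\eta^{(\alpha)})=F_\eta^{r\delta}$,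 and $x^{\underline\eta}=\Xi(x^\eta)$. For $\eta\ne0$: $m=\max_i\eta_i$, $k=\min\{i:\eta_i=m\}$, $l[\eta]=\#\{i>k:\eta_i=m\}+\#\{i<k:\eta_i=m-1\}$, $w_\eta=x_k+(m-1)+r(n-1-l[\eta])$, and $\eta^*$ is $\eta$ with $\eta_k$ replaced by $m-1$. $P[\eta]$ is the set of compositions $\gamma$ for which there exist $j\ne k$ and an integer $l>0$ with $\gamma_j=\eta_j+l$, $\gamma_k=m-1-l$, $\gamma_i=\eta_i$ for $i\ne j,k$, where $\varepsilon=m-1-\eta_j-l$ satisfies $\varepsilon>0$ if $j<k$ and $\varepsilon\ge0$ if $j>k$, and $\gamma\neq\eta^*$. -}

module Defs where

open import Data.Nat as ℕ using (ℕ; zero; suc; _∸_; _⊔_; _≟_)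
import Data.Nat.Properties as ℕP
open import Data.Integer as ℤ using (ℤ; +_; NonZero)
import Data.Integer.Properties as ℤP
open import Data.Fin as Fin using (Fin; toℕ)
import Data.Fin.Properties as FinP
open import Data.List as L using (List; []; _∷_; _++_)
open import Data.Vec as V using (Vec)
import Data.Vec.Properties as VP
open import Data.Product using (Σ; Σ-syntax; _×_; _,_; proj₁; proj₂)
open import Data.Bool using (Bool; true; false; if_then_else_; _∧_)
open import Relation.Nullary using (¬_; Dec; yes; no; does)
open import Relation.Nullary.Decidable using (¬?; _×-dec_; _→-dec_)
open import Relation.Binary.PropositionalEquality using (_≡_; _≢_)

-- ℤ[r] : univariate integer polynomials, little-endian coefficient lists

PZ : Set
PZ = List ℤ

addZ : PZ → PZ → PZ
addZ [] q = q
addZ (a ∷ p) [] = a ∷ p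
addZ (a ∷ p) (b ∷ q) = (a ℤ.+ b) ∷ addZ p q

scaleZ : ℤ → PZ → PZ
scaleZ c = L.map (c ℤ.*_)

mulZ : PZ → PZ → PZ
mulZ [] q = []
mulZ (a ∷ p) q = addZ (scaleZ a q) (ℤ.0ℤ ∷ mulZ p q)

coefZ : PZ → ℕ → ℤ
coefZ [] i = ℤ.0ℤ
coefZ (a ∷ p) zero = a
coefZ (a ∷ p) (suc i) = coefZ p i

-- nonzero elements of ℤ[r]: lows ++ [lead] with lead ≠ 0
record NZ : Set where
  field
    lead   : ℤ
    lows   : PZ
    leadNZ : NonZero lead
open NZ public

toPZ : NZ → PZ
toPZ d = lows d ++ (lead d ∷ [])

nzOne : NZ
nzOne = record { lead = ℤ.1ℤ ; lows = [] ; leadNZ = _ }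

nzR : NZ
nzR = record { lead = ℤ.1ℤ ; lows = ℤ.0ℤ ∷ [] ; leadNZ = _ }

nzMul : NZ → NZ → NZ
nzMul a b = record
  { lead   = lead a ℤ.* lead b
  ; lows   = L.take (L.length (lows a) ℕ.+ L.length (lows b)) (mulZ (toPZ a) (toPZ b))
  ; leadNZ = ℤP.i*j≢0 (lead a) (lead b) {{leadNZ a}} {{leadNZ b}}
  }

-- 𝔽 = ℚ(r) = Frac(ℤ[r]) as fractions num/den with den ≠ 0

record 𝔽 : Set where
  constructor _/_
  field
    num : PZ
    den : NZ
open 𝔽 public

infix 4 _≈F_
_≈F_ : 𝔽 → 𝔽 → Set
x ≈F y = ∀ i → coefZ (mulZ (num x) (toPZ (den y))) i ≡ coefZ (mulZ (num y) (toPZ (den x))) i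

infixl 6 _+F_
infixl 7 _*F_
_+F_ : 𝔽 → 𝔽 → 𝔽
x +F y = addZ (mulZ (num x) (toPZ (den y))) (mulZ (num y) (toPZ (den x))) / nzMul (den x) (den y)

_*F_ : 𝔽 → 𝔽 → 𝔽
x *F y = mulZ (num x) (num y) / nzMul (den x) (den y)

ℤF : ℤ → 𝔽
ℤF k = (k ∷ []) / nzOne

ℕF : ℕ → 𝔽
ℕF k = ℤF (+ k)

0F 1F : 𝔽
0F = ℕF 0
1F = ℕF 1

rF αF : 𝔽
rF = (ℤ.0ℤ ∷ ℤ.1ℤ ∷ []) / nzOne
αF = (ℤ.1ℤ ∷ []) / nzR

_^F_ : 𝔽 → ℕ → 𝔽
x ^F zero = 1F
x ^F suc k = x *F (x ^F k)

sgnF : ℕ → 𝔽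
sgnF k = ℤF ℤ.-1ℤ ^F k

prodF : List 𝔽 → 𝔽
prodF = L.foldr _*F_ 1F

sumF : List 𝔽 → 𝔽
sumF = L.foldr _+F_ 0F

Poly : ℕ → Set
Poly n = List (𝔽 × Vec ℕ n)

∣_∣ : ∀ {n} → Vec ℕ n → ℕ
∣ η ∣ = V.sum η

coeff : ∀ {n} → Poly n → Vec ℕ n → 𝔽
coeff [] η = 0F
coeff ((c , e) ∷ p) η = if does (VP.≡-dec _≟_ e η) then c +F coeff p η else coeff p η

infix 4 _≈P_
_≈P_ : ∀ {n} → Poly n → Poly n → Set
p ≈P q = ∀ η → coeff p η ≈F coeff q η

infixl 6 _+P_
infixl 7 _*P_
infixr 7 _•_
_+P_ : ∀ {n} → Poly n → Poly n → Poly n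
p +P q = p ++ q

_•_ : ∀ {n} → 𝔽 → Poly n → Poly n
c • p = L.map (λ ce → (c *F proj₁ ce , proj₂ ce)) p

_*P_ : ∀ {n} → Poly n → Poly n → Poly n
p *P q = L.concatMap (λ ce → L.map (λ df → (proj₁ ce *F proj₁ df , V.zipWith ℕ._+_ (proj₂ ce) (proj₂ df))) q) p

sumP : ∀ {n} → List (Poly n) → Poly n
sumP = L.foldr _+P_ []

mono : ∀ {n} → Vec ℕ n → Poly n
mono η = (1F , η) ∷ []

constP : ∀ {n} → 𝔽 → Poly n
constP {n} c = (c , V.replicate n 0) ∷ []

varP : ∀ {n} → Fin n → Poly n
varP k = (1F , V.tabulate (λ i → if does (i Fin.≟ k) then 1 else 0)) ∷ []

eval : ∀ {n} → Poly n → Vec 𝔽 n → 𝔽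
eval p v = sumF (L.map (λ ce → proj₁ ce *F prodF (V.toList (V.zipWith _^F_ v (proj₂ ce)))) p)

top : ∀ {n} → ℕ → Poly n → Poly n
top d = L.filter (λ ce → ∣ proj₂ ce ∣ ≟ d)

negx : ∀ {n} → Poly n → Poly n
negx = L.map (λ ce → (sgnF ∣ proj₂ ce ∣ *F proj₁ ce , proj₂ ce))

countF : ∀ {n} → (Fin n → Bool) → ℕ
countF {n} b = L.length (L.filter (λ i → b i Data.Bool.≟ true) (L.allFin n))
  where import Data.Bool

-- 0-based position of i after stably sorting γ decreasingly
-- (so that γ̄ = γ + w_γ(rδ) has γ̄_i = γ_i + r(n-1-rank γ i))
rank : ∀ {n} → Vec ℕ n → Fin n → ℕ
rank γ i = countF (λ k → does (V.lookup γ i ℕ.<? V.lookup γ k))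
         ℕ.+ countF (λ k → does (k Fin.<? i) ∧ does (V.lookup γ k ≟ V.lookup γ i))

-- γ̄ = γ + w_γ(rδ),  δ = (n-1,…,0)
bar : ∀ {n} → Vec ℕ n → Vec 𝔽 n
bar {n} γ = V.tabulate (λ i → ℕF (V.lookup γ i) +F rF *F ℕF (n ∸ 1 ∸ rank γ i))

IsInterp : ∀ {n} → Vec ℕ n → Poly n → Set
IsInterp {n} η E =
    (∀ (γ : Vec ℕ n) → ∣ η ∣ ℕ.< ∣ γ ∣ → coeff E γ ≈F 0F)
  × (coeff E η ≈F 1F)
  × (∀ (γ : Vec ℕ n) → γ ≢ η → ∣ γ ∣ ℕ.≤ ∣ η ∣ → eval E (bar γ) ≈F 0F)

legη : ∀ {n} → Vec ℕ n → Fin n → ℕ → ℕ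
legη η i j =
    countF (λ k → does (i Fin.<? k) ∧ does (j ℕ.≤? V.lookup η k) ∧ does (V.lookup η k ℕ.≤? V.lookup η i))
  ℕ.+ countF (λ k → does (k Fin.<? i) ∧ does (j ℕ.≤? suc (V.lookup η k)) ∧ does (suc (V.lookup η k) ℕ.≤? V.lookup η i))

dη : ∀ {n} → Vec ℕ n → 𝔽
dη {n} η = prodF (L.concatMap
  (λ i → L.map (λ j → αF *F ℕF (V.lookup η i ∸ j ℕ.+ 1) +F ℕF (legη η i j ℕ.+ 1))
               (L.map suc (L.upTo (V.lookup η i))))
  (L.allFin n))

Fα : ∀ {n} → (Vec ℕ n → Poly n) → Vec ℕ n → Poly n
Fα E η = dη η • top ∣ η ∣ (E η)

Frδ : ∀ {n} → (Vec ℕ n → Poly n) → Vec ℕ n → Poly n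
Frδ E η = (sgnF ∣ η ∣ *F dη η) • negx (E η)

IsXi : ∀ {n} → (Poly n → Poly n) → (Vec ℕ n → Poly n) → Set
IsXi {n} Ξ E =
    (∀ (p q : Poly n) → p ≈P q → Ξ p ≈P Ξ q)
  × (∀ (p q : Poly n) → Ξ (p +P q) ≈P Ξ p +P Ξ q)
  × (∀ (c : 𝔽) (p : Poly n) → Ξ (c • p) ≈P c • Ξ p)
  × (∀ (η : Vec ℕ n) → Ξ (Fα E η) ≈P Frδ E η)

maxη : ∀ {n} → Vec ℕ n → ℕ
maxη = V.foldr _ _⊔_ 0

firstWhere : ∀ {N} → (Fin N → Bool) → List (Fin N) → Fin N → Fin N
firstWhere b [] d = d
firstWhere b (i ∷ is) d = if b i then i else firstWhere b is d

kη : ∀ {n} → Vec ℕ (suc n) → Fin (suc n)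
kη {n} η = firstWhere (λ i → does (V.lookup η i ≟ maxη η)) (L.allFin (suc n)) Fin.zero

lη : ∀ {n} → Vec ℕ (suc n) → ℕ
lη η = countF (λ i → does (kη η Fin.<? i) ∧ does (V.lookup η i ≟ maxη η))
   ℕ.+ countF (λ i → does (i Fin.<? kη η) ∧ does (V.lookup η i ≟ maxη η ∸ 1))

wη : ∀ {n} → Vec ℕ (suc n) → Poly (suc n)
wη {n} η = varP (kη η) +P constP (ℕF (maxη η ∸ 1) +F rF *F ℕF (suc n ∸ 1 ∸ lη η))

ηstar : ∀ {n} → Vec ℕ (suc n) → Vec ℕ (suc n)
ηstar η = η V.[ kη η ]≔ (maxη η ∸ 1)

-- γ ∈ P[η]  (l > 0 is forced to be ≤ m-1 by γ_k = m-1-l, so l ranges over Fin m;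
-- ε = m-1-η_j-l, so ε > 0 ⇔ η_j+l < m-1 and ε ≥ 0 ⇔ η_j+l ≤ m-1 given m ≥ 1)
InP : ∀ {n} → Vec ℕ (suc n) → Vec ℕ (suc n) → Set
InP {n} η γ =
  Σ[ j ∈ Fin (suc n) ] Σ[ l ∈ Fin (maxη η) ]
      (j ≢ kη η)
    × (0 ℕ.< toℕ l)
    × (V.lookup γ j ≡ V.lookup η j ℕ.+ toℕ l)
    × (V.lookup γ (kη η) ℕ.+ toℕ l ≡ maxη η ∸ 1)
    × (∀ i → i ≢ j → i ≢ kη η → V.lookup γ i ≡ V.lookup η i)
    × (j Fin.< kη η → V.lookup η j ℕ.+ toℕ l ℕ.< maxη η ∸ 1)
    × (kη η Fin.< j → V.lookup η j ℕ.+ toℕ l ℕ.≤ maxη η ∸ 1)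
    × (γ ≢ ηstar η)

InP? : ∀ {n} (η γ : Vec ℕ (suc n)) → Dec (InP η γ)
InP? {n} η γ = FinP.any? λ j → FinP.any? λ l →
      ¬? (j Fin.≟ kη η)
  ×-dec (0 ℕ.<? toℕ l)
  ×-dec (V.lookup γ j ≟ V.lookup η j ℕ.+ toℕ l)
  ×-dec (V.lookup γ (kη η) ℕ.+ toℕ l ≟ maxη η ∸ 1)
  ×-dec FinP.all? (λ i → ¬? (i Fin.≟ j) →-dec ¬? (i Fin.≟ kη η) →-dec (V.lookup γ i ≟ V.lookup η i))
  ×-dec ((j Fin.<? kη η) →-dec (V.lookup η j ℕ.+ toℕ l ℕ.<? maxη η ∸ 1))
  ×-dec ((kη η Fin.<? j) →-dec (V.lookup η j ℕ.+ toℕ l ℕ.≤? maxη η ∸ 1))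
  ×-dec ¬? (VP.≡-dec _≟_ γ (ηstar η))

box : ℕ → (n : ℕ) → List (Vec ℕ n)
box m zero = V.[] ∷ []
box m (suc n) = L.concatMap (λ a → L.map (a V.∷_) (box m n)) (L.upTo (suc m))

-- P[η], listed without repetition (every element has entries ≤ max η)
Pη : ∀ {n} → Vec ℕ (suc n) → List (Vec ℕ (suc n))
Pη {n} η = L.filter (InP? η) (box (maxη η) (suc n))

{-# OPTIONS --safe #-}

-- Write e_ζ for the unique polynomial with top monomial x^ζ that vanishes at γ̄ for all |γ| < |ζ|.
-- Expanding e_ζ in the E_γ with |γ| = |ζ| gives Ξ(x^ζ)(x) = (-1)^|ζ| e_ζ(-x), so the claim becomes
--   x_k e_ζ = e_{ζ+ε_k} + (e applied to the Cherednik operator ξ_k x^ζ)      for k and ζ = η*,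
-- and ξ_k x^ζ is read off from its explicit form as divided differences. This identity holds for all
-- k and ζ: the interpolation conditions give
--   (x_i - x_{i+1}) e_{s_i ζ} = (x_i - x_{i+1} - r) s_i e_ζ + r e_ζ    and
--   e_{Φζ}(x) = x_n e_ζ(x_n - 1, x_1, …, x_{n-1}),   Φζ = (ζ_2, …, ζ_n, ζ_1 + 1),
-- and since ξ_k and multiplication by x_k commute with s_i and Φ in the same way, it propagates from
-- ζ = 0 to all ζ. Uniqueness of e_ζ comes from dividing a polynomial that vanishes at the nodes
-- successively by linear factors x_q - c, where q runs cyclically through n, n-1, …, 1.
module Submission where

open import Defs
open import Algebra.Bundles using (CommutativeRing; RawRing)
open import Algebra.Morphism.Structures using (IsRingMonomorphism)
import Algebra.Morphism.RingMonomorphism as RingMono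
open import Data.Bool as Bool using (Bool; true; false; if_then_else_; _∧_)
open import Data.Fin as Fin using (Fin; zero; suc; toℕ; fromℕ; inject₁; fromℕ<)
open import Data.Fin.Induction using (>-weakInduction)
open import Data.Fin.Permutation as Perm using (Permutation; _⟨$⟩ʳ_; _⟨$⟩ˡ_)
import Data.Fin.Properties as FinP
open import Data.Fin.Relation.Unary.Top using (view; View; ‵fromℕ; ‵inject₁; ‵inj₁; view-fromℕ; view-inject₁)
open import Data.Integer as ℤ using (ℤ; 0ℤ; 1ℤ)
import Data.Integer.Properties as ℤP
open import Data.List as L using (List; []; _∷_; _++_; length; map; concat; concatMap; filter; upTo; downFrom)
import Data.List.Properties as LP
open import Data.List.Membership.Propositional using (_∈_; _∉_)
open import Data.List.Membership.Propositional.Properties using (∈-++⁺ˡ; ∈-++⁺ʳ; ∈-++⁻; ∈-tabulate⁺; ∈-tabulate⁻; ∈-concat⁺′; ∈-concat⁻′; ∈-filter⁺; ∈-filter⁻; ∈-map∘filter⁺; ∈-map∘filter⁻; ∈-downFrom⁺; ∈-downFrom⁻; ∈-upTo⁺; ∈-cartesianProductWith⁺)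
open import Data.List.Membership.Propositional.Properties.WithK using (unique∧set⇒bag)
open import Data.List.Relation.Binary.BagAndSetEquality using (∼bag⇒↭)
open import Data.List.Relation.Binary.Permutation.Propositional as ↭ using (_↭_)
open import Data.List.Relation.Unary.All as All using (All; []; _∷_)
import Data.List.Relation.Unary.All.Properties as AllP
open import Data.List.Relation.Unary.AllPairs as AllPairs using (AllPairs; []; _∷_)
import Data.List.Relation.Unary.AllPairs.Properties as AllPairsP
open import Data.List.Relation.Unary.Any using (here; there)
open import Data.List.Relation.Unary.Unique.Propositional using (Unique)
import Data.List.Relation.Unary.Unique.Propositional.Properties as UniqueP
open import Data.Maybe using (Maybe; just; nothing)
open import Data.Nat as ℕ using (ℕ; zero; suc; z≤n; s≤s; s≤s⁻¹)
import Data.Nat.Properties as ℕP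
open import Data.Product using (Σ-syntax; _×_; _,_; proj₁; proj₂)
open import Data.Sum using (_⊎_; inj₁; inj₂)
open import Data.Vec as V using (Vec; []; _∷_; lookup; tabulate; replicate)
import Data.Vec.Properties as VP
open import Function using (_∘_; mk⇔)
open import Level using (0ℓ)
open import Relation.Binary using (tri<; tri≈; tri>)
open import Relation.Binary.PropositionalEquality as ≡ using (_≡_; _≢_; subst)
open import Relation.Nullary using (¬_; Dec; yes; no; does; contradiction)
open import Relation.Nullary.Decidable using (dec-true; dec-false; does-⇔; _⊎-dec_; _×-dec_)
import Algebra.Properties.CommutativeMonoid.Sum ℕP.+-0-commutativeMonoid as ℕSum

-- Why Ξ is known on monomials: if Σ c_γ E_γ matches e_ζ at the nodes of degree |ζ|, the two are
-- equal, as both vanish at all lower nodes. Top components give x^ζ = Σ c_γ top(E_γ), and since d_γ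
-- is invertible, Ξ sends top(E_γ) to (-1)^|γ| E_γ(-x).
--
-- Why η* and the first maximum: for this k and ζ = η*, each divided difference in ξ_k x^ζ is an
-- interval of monomials with coefficient +1, possibly empty. The possible upper end is x^ζ itself;
-- it occurs n-1-l[η] times and yields the r-term of w_η. The other monomials are those of P[η].
--
-- The obstacle to uniqueness is that a coordinate of a node depends on the whole composition
-- through the rank. A factor x_q - c helps only on a set of nodes where the least value of
-- coordinate q is the same for all; this dictates the order of the divisions.
--
-- Quotients by x_i - x_j enter through their defining products, and the factor is cancelled at the
-- nodes, whose coordinates are distinct because r is transcendental.

-- A ring solver with integer constants

module IntegerSolver (R : CommutativeRing 0ℓ 0ℓ) where
  open import Data.Integer using (+_; -[1+_])
  open CommutativeRing R hiding (zero)
  open import Algebra.Properties.Ring ring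
  open import Algebra.Properties.AbelianGroup +-abelianGroup using (⁻¹-∙-comm)
  open import Algebra.Properties.Semiring.Mult.TCOptimised semiring renaming (_×_ to _×ᴺ_)
  open import Algebra.Solver.Ring.AlmostCommutativeRing using (_-Raw-AlmostCommutative⟶_; fromCommutativeRing)
  open import Relation.Binary.Reasoning.Setoid setoid

  -- With the optimised multiple, `1 ×ᴺ 1#` is `1#` by computation, so the constants 0 and 1 of
  -- solver goals reduce to `0#` and `1#`.
  ⟦_⟧ : ℤ → Carrier
  ⟦ + n ⟧ = n ×ᴺ 1#
  ⟦ -[1+ n ] ⟧ = - (suc n ×ᴺ 1#)

  ⟦neg⟧ : ∀ i → ⟦ ℤ.- i ⟧ ≈ - ⟦ i ⟧
  ⟦neg⟧ (+ zero)  = sym -0#≈0#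
  ⟦neg⟧ (+ suc n) = refl
  ⟦neg⟧ -[1+ n ]  = sym (-‿involutive _)

  suc× : ∀ n → suc n ×ᴺ 1# ≈ 1# + n ×ᴺ 1#
  suc× n = ×-homo-+ 1# 1 n

  ⟦⊖⟧ : ∀ m n → ⟦ m ℤ.⊖ n ⟧ ≈ m ×ᴺ 1# - n ×ᴺ 1#
  ⟦⊖⟧ zero zero = sym (-‿inverseʳ 0#)
  ⟦⊖⟧ zero (suc n) = sym (+-identityˡ _)
  ⟦⊖⟧ (suc m) zero = sym (trans (+-congˡ -0#≈0#) (+-identityʳ _))
  ⟦⊖⟧ (suc m) (suc n) = begin
    ⟦ suc m ℤ.⊖ suc n ⟧  ≡⟨ ≡.cong ⟦_⟧ (ℤP.[1+m]⊖[1+n]≡m⊖n m n) ⟩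
    ⟦ m ℤ.⊖ n ⟧  ≈⟨ ⟦⊖⟧ m n ⟩
    m ×ᴺ 1# - n ×ᴺ 1#  ≈⟨ +-congʳ (sym (trans (+-congʳ (-‿inverseʳ 1#)) (+-identityˡ _))) ⟩
    ((1# - 1#) + m ×ᴺ 1#) - n ×ᴺ 1#  ≈⟨ +-congʳ (trans (+-assoc _ _ _) (trans (+-congˡ (+-comm _ _)) (sym (+-assoc _ _ _)))) ⟩
    ((1# + m ×ᴺ 1#) - 1#) - n ×ᴺ 1#  ≈⟨ +-assoc _ _ _ ⟩
    (1# + m ×ᴺ 1#) + (- 1# - n ×ᴺ 1#)  ≈⟨ +-congˡ (⁻¹-∙-comm _ _) ⟩
    (1# + m ×ᴺ 1#) - (1# + n ×ᴺ 1#)  ≈⟨ +-cong (sym (suc× m)) (-‿cong (sym (suc× n))) ⟩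
    suc m ×ᴺ 1# - suc n ×ᴺ 1#                    ∎

  ⟦+⟧ : ∀ i j → ⟦ i ℤ.+ j ⟧ ≈ ⟦ i ⟧ + ⟦ j ⟧
  ⟦+⟧ (+ m) (+ n) = ×-homo-+ 1# m n
  ⟦+⟧ (+ m) -[1+ n ] = ⟦⊖⟧ m (suc n)
  ⟦+⟧ -[1+ m ] (+ n) = trans (⟦⊖⟧ n (suc m)) (+-comm _ _)
  ⟦+⟧ -[1+ m ] -[1+ n ] = begin
    - (suc (suc (m ℕ.+ n)) ×ᴺ 1#)  ≡⟨ ≡.cong (λ k → - (suc k ×ᴺ 1#)) (≡.sym (ℕP.+-suc m n)) ⟩
    - ((suc m ℕ.+ suc n) ×ᴺ 1#)  ≈⟨ -‿cong (×-homo-+ 1# (suc m) (suc n)) ⟩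
    - (suc m ×ᴺ 1# + suc n ×ᴺ 1#)  ≈⟨ sym (⁻¹-∙-comm _ _) ⟩
    - (suc m ×ᴺ 1#) - suc n ×ᴺ 1#        ∎

  ⟦+*⟧ : ∀ m j → ⟦ + m ℤ.* j ⟧ ≈ ⟦ + m ⟧ * ⟦ j ⟧
  ⟦+*⟧ m (+ n) = trans (reflexive (≡.cong ⟦_⟧ (≡.sym (ℤP.pos-* m n)))) (×1-homo-* m n)
  ⟦+*⟧ m -[1+ n ] = begin
    ⟦ + m ℤ.* ℤ.- (+ suc n) ⟧  ≡⟨ ≡.cong ⟦_⟧ (≡.sym (ℤP.neg-distribʳ-* (+ m) (+ suc n))) ⟩
    ⟦ ℤ.- (+ m ℤ.* + suc n) ⟧  ≈⟨ ⟦neg⟧ (+ m ℤ.* + suc n) ⟩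
    - ⟦ + m ℤ.* + suc n ⟧  ≈⟨ -‿cong (⟦+*⟧ m (+ suc n)) ⟩
    - (⟦ + m ⟧ * ⟦ + suc n ⟧)  ≈⟨ -‿distribʳ-* _ _ ⟩
    ⟦ + m ⟧ * - ⟦ + suc n ⟧      ∎

  ⟦*⟧ : ∀ i j → ⟦ i ℤ.* j ⟧ ≈ ⟦ i ⟧ * ⟦ j ⟧
  ⟦*⟧ (+ m) j = ⟦+*⟧ m j
  ⟦*⟧ -[1+ m ] j = begin
    ⟦ ℤ.- (+ suc m) ℤ.* j ⟧  ≡⟨ ≡.cong ⟦_⟧ (≡.sym (ℤP.neg-distribˡ-* (+ suc m) j)) ⟩
    ⟦ ℤ.- (+ suc m ℤ.* j) ⟧  ≈⟨ ⟦neg⟧ (+ suc m ℤ.* j) ⟩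
    - ⟦ + suc m ℤ.* j ⟧  ≈⟨ -‿cong (⟦+*⟧ (suc m) j) ⟩
    - (⟦ + suc m ⟧ * ⟦ j ⟧)  ≈⟨ -‿distribˡ-* _ _ ⟩
    - ⟦ + suc m ⟧ * ⟦ j ⟧        ∎

  morphism : ℤ.+-*-rawRing -Raw-AlmostCommutative⟶ fromCommutativeRing R
  morphism = record
    { ⟦_⟧ = ⟦_⟧ ; +-homo = ⟦+⟧ ; *-homo = ⟦*⟧ ; -‿homo = ⟦neg⟧ ; 0-homo = refl ; 1-homo = refl }

  -- `nothing` is no refutation: distinct integers may have equal images, and the solver asks only
  -- for sound positive answers.
  ⟦⟧≟ : ∀ i j → Maybe (⟦ i ⟧ ≈ ⟦ j ⟧)
  ⟦⟧≟ i j with i ℤP.≟ j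
  ... | yes i≡j = just (reflexive (≡.cong ⟦_⟧ i≡j))
  ... | no _    = nothing

  open import Algebra.Solver.Ring ℤ.+-*-rawRing (fromCommutativeRing R) morphism ⟦⟧≟ public
    using (solve; _:+_; _:*_; _:-_; :-_; _:=_; con; Polynomial)

-- Formal power series over a commutative ring

module PowerSeries (A : CommutativeRing 0ℓ 0ℓ) where
  open CommutativeRing A hiding (zero)
  open IntegerSolver A
  open import Relation.Binary.Reasoning.Setoid setoid

  Seq : Set
  Seq = ℕ → Carrier

  infix 4 _≈ˢ_ _≐_
  _≐_ : Seq → Seq → Set
  f ≐ g = ∀ i → f i ≈ g i

  -- A record around pointwise equality, because unification cannot recover `f` and `g` from the
  -- bare function type.
  record _≈ˢ_ (f g : Seq) : Set where
    constructor mk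
    field at : f ≐ g
  open _≈ˢ_ public

  infixl 7 _⊛_
  -- The Cauchy product by recursion on the index, from f = f 0 + X (f ∘ suc).
  _⊛_ : Seq → Seq → Seq
  (f ⊛ g) zero    = f 0 * g 0
  (f ⊛ g) (suc i) = f 0 * g (suc i) + ((f ∘ suc) ⊛ g) i

  infixl 6 _⊕_
  _⊕_ : Seq → Seq → Seq
  (f ⊕ g) i = f i + g i

  ⊖_ : Seq → Seq
  (⊖ f) i = - f i

  infixr 7 _·_
  _·_ : Carrier → Seq → Seq
  (c · f) i = c * f i

  𝟘 𝟙 : Seq
  𝟘 _ = 0#
  𝟙 zero    = 1#
  𝟙 (suc _) = 0#

  ⊛-cong : ∀ {f f′ g g′} → f ≐ f′ → g ≐ g′ → f ⊛ g ≐ f′ ⊛ g′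
  ⊛-cong p q zero    = *-cong (p 0) (q 0)
  ⊛-cong p q (suc i) = +-cong (*-cong (p 0) (q (suc i))) (⊛-cong (p ∘ suc) q i)

  ⊛-distribʳ : ∀ h f g → (f ⊕ g) ⊛ h ≐ (f ⊛ h) ⊕ (g ⊛ h)
  ⊛-distribʳ h f g zero    = distribʳ (h 0) (f 0) (g 0)
  ⊛-distribʳ h f g (suc i) = begin
    (f 0 + g 0) * h (suc i) + (((f ∘ suc) ⊕ (g ∘ suc)) ⊛ h) i
      ≈⟨ +-congˡ (⊛-distribʳ h (f ∘ suc) (g ∘ suc) i) ⟩
    (f 0 + g 0) * h (suc i) + (((f ∘ suc) ⊛ h) i + ((g ∘ suc) ⊛ h) i)
      ≈⟨ solve 5 (λ a b c x y → (a :+ b) :* c :+ (x :+ y) := (a :* c :+ x) :+ (b :* c :+ y)) refl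
           (f 0) (g 0) (h (suc i)) (((f ∘ suc) ⊛ h) i) (((g ∘ suc) ⊛ h) i) ⟩
    (f ⊛ h) (suc i) + (g ⊛ h) (suc i) ∎

  ⊛-scale : ∀ c f g → (c · f) ⊛ g ≐ c · (f ⊛ g)
  ⊛-scale c f g zero    = *-assoc c (f 0) (g 0)
  ⊛-scale c f g (suc i) = begin
    c * f 0 * g (suc i) + ((c · (f ∘ suc)) ⊛ g) i ≈⟨ +-congˡ (⊛-scale c (f ∘ suc) g i) ⟩
    c * f 0 * g (suc i) + c * ((f ∘ suc) ⊛ g) i
      ≈⟨ solve 4 (λ c a b x → c :* a :* b :+ c :* x := c :* (a :* b :+ x)) refl c (f 0) (g (suc i)) (((f ∘ suc) ⊛ g) i) ⟩
    c * (f ⊛ g) (suc i) ∎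

  -- The recursion of `_⊛_` consumes the left factor; this mirror image consumes the right one, and
  -- commutativity comes from comparing the two.
  ⊛-sucʳ : ∀ f g i → (f ⊛ g) (suc i) ≈ f (suc i) * g 0 + (f ⊛ (g ∘ suc)) i
  ⊛-sucʳ f g zero    = +-comm (f 0 * g 1) (f 1 * g 0)
  ⊛-sucʳ f g (suc i) = begin
    f 0 * g (suc (suc i)) + ((f ∘ suc) ⊛ g) (suc i)
      ≈⟨ +-congˡ (⊛-sucʳ (f ∘ suc) g i) ⟩
    f 0 * g (suc (suc i)) + (f (suc (suc i)) * g 0 + ((f ∘ suc) ⊛ (g ∘ suc)) i)
      ≈⟨ solve 3 (λ a b c → a :+ (b :+ c) := b :+ (a :+ c)) refl _ (f (suc (suc i)) * g 0) _ ⟩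
    f (suc (suc i)) * g 0 + (f ⊛ (g ∘ suc)) (suc i) ∎

  ⊛-comm : ∀ f g → f ⊛ g ≐ g ⊛ f
  ⊛-comm f g zero    = *-comm (f 0) (g 0)
  ⊛-comm f g (suc i) = begin
    f 0 * g (suc i) + ((f ∘ suc) ⊛ g) i ≈⟨ +-cong (*-comm (f 0) (g (suc i))) (⊛-comm (f ∘ suc) g i) ⟩
    g (suc i) * f 0 + (g ⊛ (f ∘ suc)) i ≈⟨ sym (⊛-sucʳ g f i) ⟩
    (g ⊛ f) (suc i) ∎

  ⊛-assoc : ∀ f g h → (f ⊛ g) ⊛ h ≐ f ⊛ (g ⊛ h)
  ⊛-assoc f g h zero    = *-assoc (f 0) (g 0) (h 0)
  ⊛-assoc f g h (suc i) = begin
    -- The tail of `f ⊛ g` is `(f 0 · (g ∘ suc)) ⊕ ((f ∘ suc) ⊛ g)` by definition, which lets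
    -- distributivity and induction act on it.
    f 0 * g 0 * h (suc i) + (((f 0 · (g ∘ suc)) ⊕ ((f ∘ suc) ⊛ g)) ⊛ h) i
      ≈⟨ +-congˡ (trans (⊛-distribʳ h (f 0 · (g ∘ suc)) ((f ∘ suc) ⊛ g) i)
                            (+-cong (⊛-scale (f 0) (g ∘ suc) h i) (⊛-assoc (f ∘ suc) g h i))) ⟩
    f 0 * g 0 * h (suc i) + (f 0 * ((g ∘ suc) ⊛ h) i + ((f ∘ suc) ⊛ (g ⊛ h)) i)
      ≈⟨ solve 5 (λ a b c x y → a :* b :* c :+ (a :* x :+ y) := a :* (b :* c :+ x) :+ y) refl
           (f 0) (g 0) (h (suc i)) (((g ∘ suc) ⊛ h) i) (((f ∘ suc) ⊛ (g ⊛ h)) i) ⟩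
    f 0 * (g ⊛ h) (suc i) + ((f ∘ suc) ⊛ (g ⊛ h)) i ∎

  ⊛-zeroˡ : ∀ {f} → f ≐ 𝟘 → ∀ g → f ⊛ g ≐ 𝟘
  ⊛-zeroˡ z g zero    = trans (*-congʳ (z 0)) (zeroˡ (g 0))
  ⊛-zeroˡ z g (suc i) = trans (+-cong (trans (*-congʳ (z 0)) (zeroˡ (g (suc i)))) (⊛-zeroˡ (z ∘ suc) g i)) (+-identityˡ 0#)

  ⊛-identityˡ : ∀ g → 𝟙 ⊛ g ≐ g
  ⊛-identityˡ g zero    = *-identityˡ (g 0)
  ⊛-identityˡ g (suc i) = trans (+-cong (*-identityˡ (g (suc i))) (⊛-zeroˡ (λ _ → refl) g i)) (+-identityʳ (g (suc i)))

  ⊛-distribˡ : ∀ h f g → h ⊛ (f ⊕ g) ≐ (h ⊛ f) ⊕ (h ⊛ g)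
  ⊛-distribˡ h f g i = trans (⊛-comm h (f ⊕ g) i) (trans (⊛-distribʳ h f g i) (+-cong (⊛-comm f h i) (⊛-comm g h i)))

  seriesRing : CommutativeRing 0ℓ 0ℓ
  seriesRing = record
    { Carrier = Seq ; _≈_ = _≈ˢ_ ; _+_ = _⊕_ ; _*_ = _⊛_ ; -_ = ⊖_ ; 0# = 𝟘 ; 1# = 𝟙
    ; isCommutativeRing = record
      { isRing = record
        { +-isAbelianGroup = record
          { isGroup = record
            { isMonoid = record
              { isSemigroup = record
                { isMagma = record
                  { isEquivalence = record
                    { refl = mk λ _ → refl ; sym = λ p → mk λ i → sym (at p i) ; trans = λ p q → mk λ i → trans (at p i) (at q i) }
                  ; ∙-cong = λ p q → mk λ i → +-cong (at p i) (at q i) }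
                ; assoc = λ f g h → mk λ i → +-assoc (f i) (g i) (h i) }
              ; identity = (λ f → mk λ i → +-identityˡ (f i)) , (λ f → mk λ i → +-identityʳ (f i)) }
            ; inverse = (λ f → mk λ i → -‿inverseˡ (f i)) , (λ f → mk λ i → -‿inverseʳ (f i))
            ; ⁻¹-cong = λ p → mk λ i → -‿cong (at p i) }
          ; comm = λ f g → mk λ i → +-comm (f i) (g i) }
        ; *-cong = λ p q → mk (⊛-cong (at p) (at q))
        ; *-assoc = λ f g h → mk (⊛-assoc f g h)
        ; *-identity = (λ f → mk (⊛-identityˡ f)) , (λ f → mk λ i → trans (⊛-comm f 𝟙 i) (⊛-identityˡ f i))
        ; distrib = (λ h f g → mk (⊛-distribˡ h f g)) , (λ h f g → mk (⊛-distribʳ h f g)) }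
      ; *-comm = λ f g → mk (⊛-comm f g) } }

-- The total ring of fractions

module Fractions (S : CommutativeRing 0ℓ 0ℓ) where
  open CommutativeRing S hiding (zero)
  open IntegerSolver S
  open import Relation.Binary.Reasoning.Setoid setoid
  open import Algebra.Properties.Group +-group using () renaming (x∙y⁻¹≈ε⇒x≈y to x-y≈0⇒x≈y)

  -- Denominators are non-zero-divisors, the property that transitivity of cross-multiplication
  -- consumes.
  record Fraction : Set where
    constructor frac
    field
      N D : Carrier
      regular : ∀ x → x * D ≈ 0# → x ≈ 0#
  open Fraction

  infix 4 _≈ᶠ_
  record _≈ᶠ_ (x y : Fraction) : Set where
    constructor mk
    field cross : N x * D y ≈ N y * D x
  open _≈ᶠ_ public

  regular-* : ∀ {d e} → (∀ x → x * d ≈ 0# → x ≈ 0#) → (∀ x → x * e ≈ 0# → x ≈ 0#) → ∀ x → x * (d * e) ≈ 0# → x ≈ 0#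
  regular-* {d} {e} p q x xde≈0 = p x (q (x * d) (trans (*-assoc x d e) xde≈0))

  -- The difference of the outer cross products becomes zero when multiplied by the middle
  -- denominator, which is regular.
  ≈ᶠ-trans : ∀ {x y z} → x ≈ᶠ y → y ≈ᶠ z → x ≈ᶠ z
  ≈ᶠ-trans {frac a b _} {frac c d reg} {frac e f _} (mk p) (mk q) = mk (x-y≈0⇒x≈y _ _ (reg _ (begin
    (a * f - e * b) * d  ≈⟨ solve 5 (λ a b d e f → (a :* f :- e :* b) :* d := (a :* d) :* f :- (e :* d) :* b) refl a b d e f ⟩
    (a * d) * f - (e * d) * b  ≈⟨ +-cong (*-congʳ p) (-‿cong (*-congʳ (sym q))) ⟩
    (c * b) * f - (c * f) * b  ≈⟨ solve 3 (λ b c f → (c :* b) :* f :- (c :* f) :* b := con 0ℤ) refl b c f ⟩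
    0# ∎)))

  fractionRing : CommutativeRing 0ℓ 0ℓ
  fractionRing = record
    { Carrier = Fraction ; _≈_ = _≈ᶠ_
    ; _+_ = λ x y → frac (N x * D y + N y * D x) (D x * D y) (regular-* (regular x) (regular y))
    ; _*_ = λ x y → frac (N x * N y) (D x * D y) (regular-* (regular x) (regular y))
    ; -_ = λ x → frac (- N x) (D x) (regular x)
    ; 0# = frac 0# 1# (λ x p → trans (sym (*-identityʳ x)) p)
    ; 1# = frac 1# 1# (λ x p → trans (sym (*-identityʳ x)) p)
    ; isCommutativeRing = record
      { isRing = record
        { +-isAbelianGroup = record
          { isGroup = record
            { isMonoid = record
              { isSemigroup = record
                { isMagma = record
                  { isEquivalence = record
                    { refl = mk refl ; sym = λ p → mk (sym (cross p)) ; trans = ≈ᶠ-trans }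
                  ; ∙-cong = λ {x} {y} {u} {v} p q → mk (plus-cong x y u v (cross p) (cross q)) }
                ; assoc = λ x y z → mk (solve 6 (λ a b c d e f →
                    ((a :* d :+ c :* b) :* f :+ e :* (b :* d)) :* (b :* (d :* f)) := (a :* (d :* f) :+ (c :* f :+ e :* d) :* b) :* (b :* d :* f))
                    refl (N x) (D x) (N y) (D y) (N z) (D z)) }
              ; identity = (λ x → mk (solve 2 (λ a b → (con 0ℤ :* b :+ a :* con 1ℤ) :* b := a :* (con 1ℤ :* b)) refl (N x) (D x)))
                         , (λ x → mk (solve 2 (λ a b → (a :* con 1ℤ :+ con 0ℤ :* b) :* b := a :* (b :* con 1ℤ)) refl (N x) (D x))) }
            ; inverse = (λ x → mk (solve 2 (λ a b → (:- a :* b :+ a :* b) :* con 1ℤ := con 0ℤ :* (b :* b)) refl (N x) (D x)))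
                      , (λ x → mk (solve 2 (λ a b → (a :* b :+ :- a :* b) :* con 1ℤ := con 0ℤ :* (b :* b)) refl (N x) (D x)))
            ; ⁻¹-cong = λ {x} {y} p → mk (trans (solve 2 (λ a d → :- a :* d := :- (a :* d)) refl (N x) (D y)) (trans (-‿cong (cross p))
                          (solve 2 (λ a d → :- (a :* d) := :- a :* d) refl (N y) (D x)))) }
          ; comm = λ x y → mk (solve 4 (λ a b c d → (a :* d :+ c :* b) :* (d :* b) := (c :* b :+ a :* d) :* (b :* d)) refl (N x) (D x) (N y) (D y)) }
        ; *-cong = λ {x} {y} {u} {v} p q → mk (times-cong x y u v (cross p) (cross q))
        ; *-assoc = λ x y z → mk (solve 6 (λ a b c d e f → a :* c :* e :* (b :* (d :* f)) := a :* (c :* e) :* (b :* d :* f))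
                    refl (N x) (D x) (N y) (D y) (N z) (D z))
        ; *-identity = (λ x → mk (solve 2 (λ a b → con 1ℤ :* a :* b := a :* (con 1ℤ :* b)) refl (N x) (D x)))
                     , (λ x → mk (solve 2 (λ a b → a :* con 1ℤ :* b := a :* (b :* con 1ℤ)) refl (N x) (D x)))
        ; distrib = (λ x y z → mk (solve 6 (λ a b c d e f →
                      (a :* (c :* f :+ e :* d)) :* ((b :* d) :* (b :* f)) := ((a :* c) :* (b :* f) :+ (a :* e) :* (b :* d)) :* (b :* (d :* f)))
                      refl (N x) (D x) (N y) (D y) (N z) (D z)))
                  , (λ x y z → mk (solve 6 (λ a b c d e f →
                      ((c :* f :+ e :* d) :* a) :* ((d :* b) :* (f :* b)) := ((c :* a) :* (f :* b) :+ (e :* a) :* (d :* b)) :* ((d :* f) :* b))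
                      refl (N x) (D x) (N y) (D y) (N z) (D z))) }
      ; *-comm = λ x y → mk (solve 4 (λ a b c d → a :* c :* (d :* b) := c :* a :* (b :* d)) refl (N x) (D x) (N y) (D y)) } }
    where
    plus-cong : ∀ x y u v → N x * D y ≈ N y * D x → N u * D v ≈ N v * D u
              → (N x * D u + N u * D x) * (D y * D v) ≈ (N y * D v + N v * D y) * (D x * D u)
    plus-cong x y u v p q = begin
      (N x * D u + N u * D x) * (D y * D v)
        ≈⟨ solve 6 (λ a b c e f g → (a :* f :+ e :* b) :* (c :* g) := (a :* c) :* (f :* g) :+ (e :* g) :* (b :* c)) refl
             (N x) (D x) (D y) (N u) (D u) (D v) ⟩
      (N x * D y) * (D u * D v) + (N u * D v) * (D x * D y)
        ≈⟨ +-cong (*-congʳ p) (*-congʳ q) ⟩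
      (N y * D x) * (D u * D v) + (N v * D u) * (D x * D y)
        ≈⟨ solve 6 (λ a b c e f g → (a :* b) :* (f :* g) :+ (e :* f) :* (b :* c) := (a :* g :+ e :* c) :* (b :* f)) refl
             (N y) (D x) (D y) (N v) (D u) (D v) ⟩
      (N y * D v + N v * D y) * (D x * D u) ∎
    times-cong : ∀ x y u v → N x * D y ≈ N y * D x → N u * D v ≈ N v * D u
               → (N x * N u) * (D y * D v) ≈ (N y * N v) * (D x * D u)
    times-cong x y u v p q = begin
      (N x * N u) * (D y * D v) ≈⟨ solve 4 (λ a b c d → (a :* b) :* (c :* d) := (a :* c) :* (b :* d)) refl (N x) (N u) (D y) (D v) ⟩
      (N x * D y) * (N u * D v) ≈⟨ *-cong p q ⟩
      (N y * D x) * (N v * D u) ≈⟨ solve 4 (λ a b c d → (a :* c) :* (b :* d) := (a :* b) :* (c :* d)) refl (N y) (N v) (D x) (D u) ⟩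
      (N y * N v) * (D x * D u) ∎

-- The field of rational functions in `r`

module RationalFunctions where
  open import Data.Integer using (+_)
  nonZero⇒≢0 : ∀ {i} → ℤ.NonZero i → i ≢ 0ℤ
  nonZero⇒≢0 () ≡.refl
  open PowerSeries ℤP.+-*-commutativeRing
  open Fractions seriesRing
  open Fraction
  private
    module S = CommutativeRing seriesRing
    module Q = CommutativeRing fractionRing
  open IntegerSolver seriesRing using (solve; _:+_; _:*_; _:=_; con)

  coef-add : ∀ p q → coefZ (addZ p q) ≐ coefZ p ⊕ coefZ q
  coef-add [] q i = ≡.sym (ℤP.+-identityˡ _)
  coef-add (a ∷ p) [] i = ≡.sym (ℤP.+-identityʳ _)
  coef-add (a ∷ p) (b ∷ q) zero = ≡.refl
  coef-add (a ∷ p) (b ∷ q) (suc i) = coef-add p q i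

  coef-map : ∀ (f : ℤ → ℤ) → f 0ℤ ≡ 0ℤ → ∀ p i → coefZ (L.map f p) i ≡ f (coefZ p i)
  coef-map f f0 [] i = ≡.sym f0
  coef-map f f0 (a ∷ p) zero = ≡.refl
  coef-map f f0 (a ∷ p) (suc i) = coef-map f f0 p i

  coef-scale : ∀ c p → coefZ (scaleZ c p) ≐ c · coefZ p
  coef-scale c = coef-map (c ℤ.*_) (ℤP.*-zeroʳ c)

  coef-mul : ∀ p q → coefZ (mulZ p q) ≐ coefZ p ⊛ coefZ q
  coef-mul [] q i = ≡.sym (⊛-zeroˡ (λ _ → ≡.refl) (coefZ q) i)
  coef-mul (a ∷ p) q zero = ≡.trans (coef-add (scaleZ a q) _ 0)
    (≡.trans (ℤP.+-identityʳ _) (coef-scale a q 0))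
  coef-mul (a ∷ p) q (suc i) = ≡.trans (coef-add (scaleZ a q) _ (suc i))
    (≡.cong₂ ℤ._+_ (coef-scale a q (suc i)) (coef-mul p q i))

  addZ-∷ʳ : ∀ s l z → length s ℕ.≤ length l → addZ s (l ++ z ∷ []) ≡ addZ s l ++ z ∷ []
  addZ-∷ʳ [] l z p = ≡.refl
  addZ-∷ʳ (a ∷ s) (b ∷ l) z (s≤s p) = ≡.cong (_ ∷_) (addZ-∷ʳ s l z p)

  addZ-[] : ∀ p → addZ p [] ≡ p
  addZ-[] [] = ≡.refl
  addZ-[] (a ∷ p) = ≡.refl

  length-addZ : ∀ s l → length s ℕ.≤ length l → length (addZ s l) ≡ length l
  length-addZ [] l p = ≡.refl
  length-addZ (a ∷ s) (b ∷ l) (s≤s p) = ≡.cong suc (length-addZ s l p)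

  -- `nzMul` cuts the product list at a computed length and appends the product of the leading
  -- coefficients. This shows that the product list has exactly that shape, so the cut removes its
  -- last entry and nothing else.
  mulZ-∷ʳ : ∀ u x v y → Σ[ w ∈ PZ ] length w ≡ length u ℕ.+ length v × mulZ (u ++ x ∷ []) (v ++ y ∷ []) ≡ w ++ (x ℤ.* y) ∷ []
  mulZ-∷ʳ [] x [] y = [] , ≡.refl , ≡.cong (_∷ []) (ℤP.+-identityʳ _)
  mulZ-∷ʳ [] x (v ∷ vs) y = (x ℤ.* v) ∷ scaleZ x vs , ≡.cong suc (LP.length-map _ vs) ,
    ≡.cong₂ _∷_ (ℤP.+-identityʳ _) (≡.trans (addZ-[] _) (LP.map-++ _ vs (y ∷ [])))
  mulZ-∷ʳ (u ∷ us) x v y with mulZ-∷ʳ us x v y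
  ... | w , len , eq = addZ (scaleZ u (v ++ y ∷ [])) (0ℤ ∷ w)
    , ≡.trans (length-addZ (scaleZ u (v ++ y ∷ [])) (0ℤ ∷ w) short) (≡.cong suc len)
    , ≡.trans (≡.cong (λ m → addZ (scaleZ u (v ++ y ∷ [])) (0ℤ ∷ m)) eq)
              (addZ-∷ʳ (scaleZ u (v ++ y ∷ [])) (0ℤ ∷ w) (x ℤ.* y) short)
    where
    short : length (scaleZ u (v ++ y ∷ [])) ℕ.≤ suc (length w)
    short = ℕP.≤-trans
      (ℕP.≤-reflexive (≡.trans (LP.length-map _ (v ++ y ∷ [])) (≡.trans (LP.length-++ v) (ℕP.+-comm (length v) 1))))
      (s≤s (ℕP.≤-trans (ℕP.m≤n+m (length v) (length us)) (ℕP.≤-reflexive (≡.sym len))))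

  toPZ-nzMul : ∀ a b → toPZ (nzMul a b) ≡ mulZ (toPZ a) (toPZ b)
  toPZ-nzMul a b with mulZ-∷ʳ (lows a) (lead a) (lows b) (lead b)
  ... | w , len , eq = ≡.trans (≡.cong (_++ _) (≡.trans (≡.cong (L.take _) eq) (take-length w len))) (≡.sym eq)
    where
    take-length : ∀ (w : PZ) {k z} → length w ≡ k → L.take k (w ++ z ∷ []) ≡ w
    take-length [] ≡.refl = ≡.refl
    take-length (x ∷ w) ≡.refl = ≡.cong (x ∷_) (take-length w ≡.refl)

  coef-nzMul : ∀ a b → coefZ (toPZ (nzMul a b)) S.≈ coefZ (toPZ a) ⊛ coefZ (toPZ b)
  coef-nzMul a b = mk λ i → ≡.trans (≡.cong (λ p → coefZ p i) (toPZ-nzMul a b)) (coef-mul (toPZ a) (toPZ b) i)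

  -- A numerator may end in zeros, but to serve as the denominator of an inverse it has to exhibit a
  -- nonzero leading coefficient.
  normalise : ∀ p → (coefZ p S.≈ 𝟘) ⊎ (Σ[ d ∈ NZ ] coefZ p S.≈ coefZ (toPZ d))
  normalise [] = inj₁ S.refl
  normalise (a ∷ p) with normalise p
  ... | inj₂ (d , mk e) = inj₂ (record d { lows = a ∷ lows d } , mk λ { zero → ≡.refl ; (suc i) → e i })
  ... | inj₁ (mk e) with a ℤP.≟ 0ℤ
  ...   | yes a≡0 = inj₁ (mk λ { zero → a≡0 ; (suc i) → e i })
  ...   | no  a≢0 = inj₂ (record { lead = a ; lows = [] ; leadNZ = ℤ.≢-nonZero a≢0 } , mk λ { zero → ≡.refl ; (suc i) → e i })

  coef-last : ∀ w {z} → coefZ (w ++ z ∷ []) (length w) ≡ z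
  coef-last [] = ≡.refl
  coef-last (x ∷ w) = coef-last w

  -- The constant coefficient of the product forces `x 0` to be zero; then the tail of `x` is
  -- annihilated by `d` as well.
  regular-const≢0 : ∀ d → d 0 ≢ 0ℤ → ∀ x → x ⊛ d S.≈ 𝟘 → x ≐ 𝟘
  regular-const≢0 d d₀≢0 x (mk e) i with ℤP.i*j≡0⇒i≡0∨j≡0 (x 0) (e 0)
  ... | inj₂ d₀≡0 = contradiction d₀≡0 d₀≢0
  regular-const≢0 d d₀≢0 x (mk e) zero    | inj₁ x₀≡0 = x₀≡0
  regular-const≢0 d d₀≢0 x (mk e) (suc i) | inj₁ x₀≡0 = regular-const≢0 d d₀≢0 (x ∘ suc) (mk λ j →
    ≡.trans (≡.sym (≡.trans (≡.cong (λ c → c ℤ.* d (suc j) ℤ.+ ((x ∘ suc) ⊛ d) j) x₀≡0) (ℤP.+-identityˡ _))) (e (suc j))) i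

  -- Powers of the indeterminate are divided out of `d` until its constant coefficient is nonzero.
  regular-coef≢0 : ∀ k d → d k ≢ 0ℤ → ∀ x → x ⊛ d S.≈ 𝟘 → x S.≈ 𝟘
  regular-coef≢0 k d dₖ≢0 x e with d 0 ℤP.≟ 0ℤ
  ... | no d₀≢0 = mk (regular-const≢0 d d₀≢0 x e)
  regular-coef≢0 zero    d dₖ≢0 x e | yes d₀≡0 = contradiction d₀≡0 dₖ≢0
  regular-coef≢0 (suc k) d dₖ≢0 x (mk e) | yes d₀≡0 = regular-coef≢0 k (d ∘ suc) dₖ≢0 x (mk λ i →
    ≡.trans (≡.sym (≡.trans (⊛-sucʳ x d i) (≡.trans (≡.cong (λ z → z ℤ.+ (x ⊛ (d ∘ suc)) i) (≡.trans (≡.cong (x (suc i) ℤ.*_) d₀≡0) (ℤP.*-zeroʳ (x (suc i))))) (ℤP.+-identityˡ _)))) (e (suc i)))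

  toFraction : 𝔽 → Fraction
  toFraction x = frac (coefZ (num x)) (coefZ (toPZ (den x)))
    (regular-coef≢0 (length (lows (den x))) _ (λ e → nonZero⇒≢0 (leadNZ (den x)) (≡.trans (≡.sym (coef-last (lows (den x)))) e)))

  infix 4 _≋_
  -- The same relation as `_≈F_`, read in the fractions of power series and wrapped so that both
  -- sides can be inferred.
  record _≋_ (x y : 𝔽) : Set where
    constructor mk
    field un : toFraction x ≈ᶠ toFraction y
  open _≋_ public

  infix 8 -F_
  -F_ : 𝔽 → 𝔽
  -F x = L.map ℤ.-_ (num x) / den x

  private
    𝔽-raw : RawRing 0ℓ 0ℓ
    𝔽-raw = record { Carrier = 𝔽 ; _≈_ = _≋_ ; _+_ = _+F_ ; _*_ = _*F_ ; -_ = -F_ ; 0# = 0F ; 1# = 1F }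

    componentwise : ∀ x y → N x S.≈ N y → D x S.≈ D y → x ≈ᶠ y
    componentwise x y p q = mk (S.*-cong p (S.sym q))

    coef-one : coefZ (1ℤ ∷ []) S.≈ 𝟙
    coef-one = mk λ { zero → ≡.refl ; (suc i) → ≡.refl }

    coef-zero : coefZ (0ℤ ∷ []) S.≈ 𝟘
    coef-zero = mk λ { zero → ≡.refl ; (suc i) → ≡.refl }

    coef-mul′ : ∀ p q → coefZ (mulZ p q) S.≈ coefZ p ⊛ coefZ q
    coef-mul′ p q = mk (coef-mul p q)

    -- The ring laws of `𝔽` are pulled back along this injection, so none of them is checked on
    -- coefficient lists.
    toFraction-mono : IsRingMonomorphism 𝔽-raw Q.rawRing toFraction
    toFraction-mono = record
      { isRingHomomorphism = record
        { isSemiringHomomorphism = record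
          { isNearSemiringHomomorphism = record
            { +-isMonoidHomomorphism = record
              { isMagmaHomomorphism = record
                { isRelHomomorphism = record { cong = un }
                ; homo = λ x y → componentwise _ _
                    (S.trans (mk (coef-add (mulZ (num x) (toPZ (den y))) _))
                             (S.+-cong (coef-mul′ (num x) (toPZ (den y))) (coef-mul′ (num y) (toPZ (den x)))))
                    (coef-nzMul (den x) (den y)) }
              ; ε-homo = componentwise _ _ coef-zero coef-one }
            ; *-homo = λ x y → componentwise _ _ (coef-mul′ (num x) (num y)) (coef-nzMul (den x) (den y)) }
          ; 1#-homo = componentwise _ _ coef-one coef-one }
        ; -‿homo = λ x → componentwise _ _ (mk (coef-map ℤ.-_ ≡.refl (num x))) S.refl }
      ; injective = mk }

  𝔽-ring : CommutativeRing 0ℓ 0ℓ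
  𝔽-ring = record { isCommutativeRing = RingMono.isCommutativeRing toFraction-mono Q.isCommutativeRing }

  ≈F⇒≋ : ∀ x y → x ≈F y → x ≋ y
  ≈F⇒≋ x y e = mk (mk (mk λ i →
    ≡.trans (≡.sym (coef-mul (num x) (toPZ (den y)) i)) (≡.trans (e i) (coef-mul (num y) (toPZ (den x)) i))))

  ≋⇒≈F : ∀ x y → x ≋ y → x ≈F y
  ≋⇒≈F x y (mk (mk (mk e))) i =
    ≡.trans (coef-mul (num x) (toPZ (den y)) i) (≡.trans (e i) (≡.sym (coef-mul (num y) (toPZ (den x)) i)))

  module F = CommutativeRing 𝔽-ring

  -- The inverse exchanges denominator and normalised numerator.
  zero-or-unit : ∀ x → (x ≋ 0F) ⊎ (Σ[ y ∈ 𝔽 ] x *F y ≋ 1F)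
  zero-or-unit x with normalise (num x)
  ... | inj₁ e = inj₁ (mk (mk (S.trans (S.*-congʳ e) (S.trans (S.zeroˡ _) (S.sym (S.trans (S.*-congʳ coef-zero) (S.zeroˡ _)))))))
  ... | inj₂ (d , e) = inj₂ (toPZ (den x) / d , mk (mk (begin
    coefZ (mulZ (num x) (toPZ (den x))) ⊛ coefZ (1ℤ ∷ [])  ≈⟨ S.*-cong (coef-mul′ (num x) (toPZ (den x))) coef-one ⟩
    (coefZ (num x) ⊛ coefZ (toPZ (den x))) ⊛ 𝟙  ≈⟨ S.*-congʳ (S.*-congʳ e) ⟩
    (coefZ (toPZ d) ⊛ coefZ (toPZ (den x))) ⊛ 𝟙  ≈⟨ solve 2 (λ a b → a :* b :* con 1ℤ := con 1ℤ :* (b :* a)) S.refl _ _ ⟩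
    𝟙 ⊛ (coefZ (toPZ (den x)) ⊛ coefZ (toPZ d))  ≈⟨ S.*-cong (S.sym coef-one) (S.sym (coef-nzMul (den x) d)) ⟩
    coefZ (1ℤ ∷ []) ⊛ coefZ (toPZ (nzMul (den x) d))       ∎)))
    where open import Relation.Binary.Reasoning.Setoid S.setoid

  ℕF-suc : ∀ k → ℕF (suc k) ≋ 1F +F ℕF k
  ℕF-suc k = mk (mk (S.*-cong (mk λ { zero → coef₀ ; (suc i) → ≡.refl }) S.refl))
    where
    coef₀ : + suc k ≡ 1ℤ ℤ.* 1ℤ ℤ.+ 0ℤ ℤ.+ (+ k ℤ.* 1ℤ ℤ.+ 0ℤ)
    coef₀ = ≡.sym (≡.cong (λ z → 1ℤ ℤ.+ z) (≡.trans (ℤP.+-identityʳ _) (ℤP.*-identityʳ (+ k))))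

  -- Coordinates of nodes have the form a + r b, so this is the transcendence that tells them apart.
  -- Both sides reduce to a two-entry coefficient list.
  r-transcendental : ∀ {a b a′ b′} → ℕF a +F rF *F ℕF b ≋ ℕF a′ +F rF *F ℕF b′ → a ≡ a′ × b ≡ b′
  r-transcendental {a} {b} {a′} {b′} e = ℤP.+-injective (at coefs 0) , ℤP.+-injective (at coefs 1)
    where
    linear : ℕ → ℕ → 𝔽
    linear a b = (+ a ∷ + b ∷ []) / nzOne

    module ℤS = IntegerSolver ℤP.+-*-commutativeRing
    O I : ∀ {n} → ℤS.Polynomial n
    O = ℤS.con 0ℤ
    I = ℤS.con 1ℤ

    linear≋ : ∀ a b → linear a b ≋ ℕF a +F rF *F ℕF b
    linear≋ a b = mk (mk (S.*-cong (mk λ { zero → coef₀ ; (suc zero) → coef₁ ; (suc (suc i)) → ≡.refl }) den≈))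
      where
      den≈ : coefZ (toPZ (den (ℕF a +F rF *F ℕF b))) S.≈ coefZ (toPZ nzOne)
      den≈ = mk λ { zero → ≡.refl ; (suc i) → ≡.refl }
      coef₀ : + a ≡ coefZ (num (ℕF a +F rF *F ℕF b)) 0
      coef₀ = ℤS.solve 2 (λ a b → a ℤS.:= (a ℤS.:* I ℤS.:+ O) ℤS.:+ ((O ℤS.:* b ℤS.:+ O) ℤS.:* I ℤS.:+ O)) ≡.refl (+ a) (+ b)
      coef₁ : + b ≡ coefZ (num (ℕF a +F rF *F ℕF b)) 1
      coef₁ = ℤS.solve 1 (λ b → b ℤS.:= (I ℤS.:* b ℤS.:+ O) ℤS.:* I ℤS.:+ O) ≡.refl (+ b)

    coefs : coefZ (+ a ∷ + b ∷ []) S.≈ coefZ (+ a′ ∷ + b′ ∷ [])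
    coefs = S.trans (S.sym (S.trans (S.*-congˡ coef-one) (S.*-identityʳ _)))
      (S.trans (cross (un (F.trans (linear≋ a b) (F.trans e (F.sym (linear≋ a′ b′))))))
        (S.trans (S.*-congˡ coef-one) (S.*-identityʳ _)))

  αF-inverse : rF *F αF ≋ 1F
  αF-inverse = ≈F⇒≋ (rF *F αF) 1F λ { zero → ≡.refl ; (suc zero) → ≡.refl ; (suc (suc i)) → ≡.refl }

  -1F-inverse : ℤF ℤ.-1ℤ +F 1F ≋ 0F
  -1F-inverse = ≈F⇒≋ (ℤF ℤ.-1ℤ +F 1F) 0F λ { zero → ≡.refl ; (suc i) → ≡.refl }

-- Compositions under permutation, shift and change of two entries

module Relabelling where
  open import Data.Nat using (_+_; _∸_; _≤_; _<_)
  open import Relation.Binary.PropositionalEquality using (refl; sym; trans; cong; cong₂)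
  open ℕSum using (sum; ∑-distrib-+; sum-permute; sum-cong-≗; sum-replicate-zero)

  vec-ext : ∀ {n} {A : Set} {u v : Vec A n} → (∀ i → lookup u i ≡ lookup v i) → u ≡ v
  vec-ext {u = []} {[]} e = refl
  vec-ext {u = x ∷ u} {y ∷ v} e = cong₂ _∷_ (e zero) (vec-ext (e ∘ suc))

  sum-tabulate : ∀ {n} (v : Vec ℕ n) → ∣ v ∣ ≡ sum (lookup v)
  sum-tabulate [] = refl
  sum-tabulate (x ∷ v) = cong (x +_) (sum-tabulate v)

  -- One form for both generators: `swap` is a transposition with β = 0, and `Φ` is the rotation
  -- with β = 1 at the last place. Degrees, `_⁺_` and `place` are thus treated once for both.
  relabel : ∀ {n} → Permutation n n → (Fin n → ℕ) → Vec ℕ n → Vec ℕ n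
  relabel π β ζ = tabulate λ p → β p + lookup ζ (π ⟨$⟩ʳ p)

  lookup-relabel : ∀ {n} (π : Permutation n n) β ζ p → lookup (relabel π β ζ) p ≡ β p + lookup ζ (π ⟨$⟩ʳ p)
  lookup-relabel π β ζ p = VP.lookup∘tabulate _ p

  ∣relabel∣ : ∀ {n} (π : Permutation n n) β ζ → ∣ relabel π β ζ ∣ ≡ sum β + ∣ ζ ∣
  ∣relabel∣ π β ζ = begin
    ∣ relabel π β ζ ∣  ≡⟨ sum-tabulate (relabel π β ζ) ⟩
    sum (lookup (relabel π β ζ))  ≡⟨ sum-cong-≗ (lookup-relabel π β ζ) ⟩
    sum (λ p → β p + lookup ζ (π ⟨$⟩ʳ p))  ≡⟨ ∑-distrib-+ β (λ p → lookup ζ (π ⟨$⟩ʳ p)) ⟩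
    sum β + sum (λ p → lookup ζ (π ⟨$⟩ʳ p))  ≡⟨ cong (sum β +_) (sym (sum-permute (lookup ζ) π)) ⟩
    sum β + sum (lookup ζ)  ≡⟨ cong (sum β +_) (sym (sum-tabulate ζ)) ⟩
    sum β + ∣ ζ ∣ ∎
    where open ≡.≡-Reasoning

  infixl 8 _⁺_
  _⁺_ : ∀ {n} → Vec ℕ n → Fin n → Vec ℕ n
  ζ ⁺ k = V.updateAt ζ k suc

  ∣⁺∣ : ∀ {n} (ζ : Vec ℕ n) k → ∣ ζ ⁺ k ∣ ≡ suc ∣ ζ ∣
  ∣⁺∣ (x ∷ ζ) zero = refl
  ∣⁺∣ (x ∷ ζ) (suc k) = trans (cong (x +_) (∣⁺∣ ζ k)) (ℕP.+-suc x ∣ ζ ∣)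

  ∣0∣ : ∀ n → ∣ replicate n 0 ∣ ≡ 0
  ∣0∣ zero = refl
  ∣0∣ (suc n) = ∣0∣ n

  ∣ζ∣≡0 : ∀ {n} (ζ : Vec ℕ n) → ∣ ζ ∣ ≡ 0 → ζ ≡ replicate n 0
  ∣ζ∣≡0 [] e = refl
  ∣ζ∣≡0 (zero ∷ ζ) e = cong (0 ∷_) (∣ζ∣≡0 ζ e)

  ⁺-induction : ∀ {n} (P : Vec ℕ n → Set) → P (replicate n 0) → (∀ ζ k → P ζ → P (ζ ⁺ k)) → ∀ ζ → P ζ
  ⁺-induction P P0 P⁺ [] = P0
  ⁺-induction P P0 P⁺ (x ∷ ζ) = front x ζ (⁺-induction (λ ζ → P (0 ∷ ζ)) P0 (λ ζ k → P⁺ (0 ∷ ζ) (suc k)) ζ)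
    where
    front : ∀ x ζ → P (0 ∷ ζ) → P (x ∷ ζ)
    front zero ζ p = p
    front (suc x) ζ p = P⁺ (x ∷ ζ) zero (front x ζ p)

  lookup-⁺-≡ : ∀ {n} (ζ : Vec ℕ n) k → lookup (ζ ⁺ k) k ≡ suc (lookup ζ k)
  lookup-⁺-≡ ζ k = VP.lookup∘updateAt k ζ

  lookup-⁺-≢ : ∀ {n} (ζ : Vec ℕ n) {k p} → p ≢ k → lookup (ζ ⁺ k) p ≡ lookup ζ p
  lookup-⁺-≢ ζ {k} {p} p≢k = VP.lookup∘updateAt′ p k p≢k ζ

  ⟨$⟩ʳ-injective : ∀ {n} (π : Permutation n n) {p q} → π ⟨$⟩ʳ p ≡ π ⟨$⟩ʳ q → p ≡ q
  ⟨$⟩ʳ-injective π e = trans (sym (Perm.inverseˡ π)) (trans (cong (π ⟨$⟩ˡ_) e) (Perm.inverseˡ π))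

  relabel-⁺ : ∀ {n} (π : Permutation n n) β ζ k → relabel π β (ζ ⁺ (π ⟨$⟩ʳ k)) ≡ relabel π β ζ ⁺ k
  relabel-⁺ π β ζ k = vec-ext λ p → trans (lookup-relabel π β (ζ ⁺ (π ⟨$⟩ʳ k)) p) (at p)
    where
    at : ∀ p → β p + lookup (ζ ⁺ (π ⟨$⟩ʳ k)) (π ⟨$⟩ʳ p) ≡ lookup (relabel π β ζ ⁺ k) p
    at p with p Fin.≟ k
    ... | yes refl = trans (cong (β k +_) (lookup-⁺-≡ ζ (π ⟨$⟩ʳ k))) (trans (ℕP.+-suc (β k) _)
                       (sym (trans (lookup-⁺-≡ (relabel π β ζ) k) (cong suc (lookup-relabel π β ζ k)))))
    ... | no p≢k = trans (cong (β p +_) (lookup-⁺-≢ ζ (p≢k ∘ ⟨$⟩ʳ-injective π)))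
                     (sym (trans (lookup-⁺-≢ (relabel π β ζ) p≢k) (lookup-relabel π β ζ p)))

  place : ∀ {n} → Fin n → Fin n → Vec ℕ n → ℕ → ℕ → Vec ℕ n
  place k j ζ a b = (ζ V.[ k ]≔ a) V.[ j ]≔ b

  lookup-place-j : ∀ {n} (k j : Fin n) ζ a b → lookup (place k j ζ a b) j ≡ b
  lookup-place-j k j ζ a b = VP.lookup∘update j (ζ V.[ k ]≔ a) b

  lookup-place-k : ∀ {n} (k j : Fin n) ζ a b → j ≢ k → lookup (place k j ζ a b) k ≡ a
  lookup-place-k k j ζ a b j≢k = trans (VP.lookup∘update′ (j≢k ∘ sym) (ζ V.[ k ]≔ a) b) (VP.lookup∘update k ζ a)

  lookup-place-else : ∀ {n} {k j p : Fin n} ζ a b → p ≢ j → p ≢ k → lookup (place k j ζ a b) p ≡ lookup ζ p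
  lookup-place-else {k = k} ζ a b p≢j p≢k = trans (VP.lookup∘update′ p≢j (ζ V.[ k ]≔ a) b) (VP.lookup∘update′ p≢k ζ a)

  place-unique : ∀ {n} {k j : Fin n} {ζ a b v} → j ≢ k → lookup v k ≡ a → lookup v j ≡ b
               → (∀ p → p ≢ j → p ≢ k → lookup v p ≡ lookup ζ p) → v ≡ place k j ζ a b
  place-unique {k = k} {j} {ζ} {a} {b} {v} j≢k vk vj else = vec-ext at
    where
    at : ∀ p → lookup v p ≡ lookup (place k j ζ a b) p
    at p with p Fin.≟ j
    ... | yes refl = trans vj (sym (lookup-place-j k j ζ a b))
    ... | no p≢j with p Fin.≟ k
    ...   | yes refl = trans vk (sym (lookup-place-k k j ζ a b j≢k))
    ...   | no p≢k = trans (else p p≢j p≢k) (sym (lookup-place-else ζ a b p≢j p≢k))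

  relabel-place : ∀ {n} (π : Permutation n n) β ζ {k j} a b → j ≢ k
                → relabel π β (place (π ⟨$⟩ʳ k) (π ⟨$⟩ʳ j) ζ a b) ≡ place k j (relabel π β ζ) (β k + a) (β j + b)
  relabel-place π β ζ {k} {j} a b j≢k = place-unique j≢k
    (trans (lookup-relabel π β ζ′ k) (cong (β k +_) (lookup-place-k (π ⟨$⟩ʳ k) (π ⟨$⟩ʳ j) ζ a b (j≢k ∘ ⟨$⟩ʳ-injective π))))
    (trans (lookup-relabel π β ζ′ j) (cong (β j +_) (lookup-place-j (π ⟨$⟩ʳ k) (π ⟨$⟩ʳ j) ζ a b)))
    (λ p p≢j p≢k → trans (lookup-relabel π β ζ′ p) (trans
      (cong (β p +_) (lookup-place-else ζ a b (p≢j ∘ ⟨$⟩ʳ-injective π) (p≢k ∘ ⟨$⟩ʳ-injective π)))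
      (sym (lookup-relabel π β ζ p))))
    where
    ζ′ = place (π ⟨$⟩ʳ k) (π ⟨$⟩ʳ j) ζ a b

  place-self : ∀ {n} {k j : Fin n} ζ → j ≢ k → ζ ≡ place k j ζ (lookup ζ k) (lookup ζ j)
  place-self ζ j≢k = place-unique j≢k refl refl (λ _ _ _ → refl)

  ∣place∣ : ∀ {n} {k j : Fin n} ζ a b → j ≢ k → ∣ place k j ζ a b ∣ + (lookup ζ k + lookup ζ j) ≡ ∣ ζ ∣ + (a + b)
  ∣place∣ {k = k} {j} ζ a b j≢k = begin
    ∣ place k j ζ a b ∣ + (lookup ζ k + lookup ζ j)  ≡⟨ solve 3 (λ x y z → x :+ (y :+ z) := (x :+ z) :+ y) refl ∣ place k j ζ a b ∣ (lookup ζ k) (lookup ζ j) ⟩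
    (∣ place k j ζ a b ∣ + lookup ζ j) + lookup ζ k  ≡⟨ cong (λ z → (∣ place k j ζ a b ∣ + z) + lookup ζ k) (sym (VP.lookup∘update′ j≢k ζ a)) ⟩
    (∣ place k j ζ a b ∣ + lookup (ζ V.[ k ]≔ a) j) + lookup ζ k ≡⟨ cong (_+ lookup ζ k) (∣update∣ (ζ V.[ k ]≔ a) j b) ⟩
    (∣ ζ V.[ k ]≔ a ∣ + b) + lookup ζ k  ≡⟨ solve 3 (λ x y z → (x :+ y) :+ z := (x :+ z) :+ y) refl ∣ ζ V.[ k ]≔ a ∣ b (lookup ζ k) ⟩
    (∣ ζ V.[ k ]≔ a ∣ + lookup ζ k) + b  ≡⟨ cong (_+ b) (∣update∣ ζ k a) ⟩
    (∣ ζ ∣ + a) + b  ≡⟨ ℕP.+-assoc ∣ ζ ∣ a b ⟩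
    ∣ ζ ∣ + (a + b) ∎
    where
    open ≡.≡-Reasoning
    open import Data.Nat.Solver using (module +-*-Solver)
    open +-*-Solver
    ∣update∣ : ∀ {n} (v : Vec ℕ n) i x → ∣ v V.[ i ]≔ x ∣ + lookup v i ≡ ∣ v ∣ + x
    ∣update∣ (y ∷ v) zero x = solve 3 (λ x y s → (x :+ s) :+ y := (y :+ s) :+ x) refl x y ∣ v ∣
    ∣update∣ (y ∷ v) (suc i) x = trans (ℕP.+-assoc y _ _) (trans (cong (y +_) (∣update∣ v i x)) (sym (ℕP.+-assoc y _ _)))

  -- The least exponent of x_k in the telescoped quotient of `exchange`. The quotients for k < j and
  -- for j < k differ by the single monomial in which x_k has exponent `b`.
  cutoff : Bool → ℕ → ℕ
  cutoff k<j b = if k<j then b else suc b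

  none : ∀ {n} → Fin n → ℕ
  none _ = 0

  swap : ∀ {n} → Fin n → Fin n → Vec ℕ n → Vec ℕ n
  swap i j = relabel (Perm.transpose i j) none

  transpose-i : ∀ {n} (i j : Fin n) → Perm.transpose i j ⟨$⟩ʳ i ≡ j
  transpose-i i j rewrite dec-true (i Fin.≟ i) refl = refl

  transpose-j : ∀ {n} {i j : Fin n} → j ≢ i → Perm.transpose i j ⟨$⟩ʳ j ≡ i
  transpose-j {i = i} {j} j≢i rewrite dec-false (j Fin.≟ i) j≢i | dec-true (j Fin.≟ j) refl = refl

  transpose-else : ∀ {n} {i j k : Fin n} → k ≢ i → k ≢ j → Perm.transpose i j ⟨$⟩ʳ k ≡ k
  transpose-else {i = i} {j} {k} k≢i k≢j rewrite dec-false (k Fin.≟ i) k≢i | dec-false (k Fin.≟ j) k≢j = refl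

  data TransposeView {n} (i j : Fin n) : Fin n → Fin n → Set where
    at-i : TransposeView i j i j
    at-j : TransposeView i j j i
    else : ∀ {k} → k ≢ i → k ≢ j → TransposeView i j k k

  transposeView : ∀ {n} {i j : Fin n} → j ≢ i → ∀ k → TransposeView i j k (Perm.transpose i j ⟨$⟩ʳ k)
  transposeView {i = i} {j} j≢i k = cases (k Fin.≟ i) (k Fin.≟ j)
    where
    cases : Dec (k ≡ i) → Dec (k ≡ j) → TransposeView i j k (Perm.transpose i j ⟨$⟩ʳ k)
    cases (yes refl) _ = subst (TransposeView i j i) (sym (transpose-i i j)) at-i
    cases (no k≢i) (yes refl) = subst (TransposeView i j j) (sym (transpose-j j≢i)) at-j
    cases (no k≢i) (no k≢j) = subst (TransposeView i j k) (sym (transpose-else k≢i k≢j)) (else k≢i k≢j)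

  transpose-involutive : ∀ {n} {i j : Fin n} → j ≢ i → ∀ k → Perm.transpose i j ⟨$⟩ʳ (Perm.transpose i j ⟨$⟩ʳ k) ≡ k
  transpose-involutive {i = i} {j} j≢i k with Perm.transpose i j ⟨$⟩ʳ k | transposeView j≢i k
  ... | _ | at-i = transpose-j j≢i
  ... | _ | at-j = transpose-i i j
  ... | _ | else k≢i k≢j = transpose-else k≢i k≢j

  lookup-swap : ∀ {n} (i j : Fin n) ζ p → lookup (swap i j ζ) p ≡ lookup ζ (Perm.transpose i j ⟨$⟩ʳ p)
  lookup-swap i j ζ p = lookup-relabel (Perm.transpose i j) none ζ p

  swap-involutive : ∀ {n} {i j : Fin n} → j ≢ i → ∀ ζ → swap i j (swap i j ζ) ≡ ζ
  swap-involutive {i = i} {j} j≢i ζ = vec-ext λ p → trans (lookup-swap i j (swap i j ζ) p)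
    (trans (lookup-swap i j ζ _) (cong (lookup ζ) (transpose-involutive j≢i p)))

  ∣swap∣ : ∀ {n} (i j : Fin n) ζ → ∣ swap i j ζ ∣ ≡ ∣ ζ ∣
  ∣swap∣ {n} i j ζ = trans (∣relabel∣ (Perm.transpose i j) none ζ) (cong (_+ ∣ ζ ∣) (sum-replicate-zero n))

  rotate⁻ : ∀ {n} → Fin (suc n) → Fin (suc n)
  rotate⁻ zero    = fromℕ _
  rotate⁻ (suc k) = inject₁ k

  rotate⁺ : ∀ {n} {i : Fin (suc n)} → View i → Fin (suc n)
  rotate⁺ ‵fromℕ       = zero
  rotate⁺ (‵inject₁ k) = suc k

  rotation : ∀ {n} → Permutation (suc n) (suc n)
  rotation = Perm.permutation (rotate⁺ ∘ view) rotate⁻ right (λ i → left (view i))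
    where
    right : ∀ {n} (i : Fin (suc n)) → rotate⁺ (view (rotate⁻ i)) ≡ i
    right {n} zero rewrite view-fromℕ n = refl
    right (suc k) rewrite view-inject₁ k = refl
    left : ∀ {n} {i : Fin (suc n)} (v : View i) → rotate⁻ (rotate⁺ v) ≡ i
    left ‵fromℕ = refl
    left (‵inject₁ k) = refl

  rotation-last : ∀ n → rotation ⟨$⟩ʳ fromℕ n ≡ zero
  rotation-last n rewrite view-fromℕ n = refl

  rotation-inject₁ : ∀ {n} (k : Fin n) → rotation ⟨$⟩ʳ inject₁ k ≡ suc k
  rotation-inject₁ k rewrite view-inject₁ k = refl

  atLast : ∀ {n} → Fin (suc n) → ℕ
  atLast i with view i
  ... | ‵fromℕ = 1
  ... | ‵inj₁ _ = 0

  atLast-last : ∀ n → atLast (fromℕ n) ≡ 1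
  atLast-last n rewrite view-fromℕ n = refl

  atLast-inject₁ : ∀ {n} (k : Fin n) → atLast (inject₁ k) ≡ 0
  atLast-inject₁ k rewrite view-inject₁ k = refl

  sum-atLast : ∀ n → sum (atLast {n}) ≡ 1
  sum-atLast n = trans (sum-permute (atLast {n}) (Perm.flip (rotation {n})))
    (cong₂ _+_ (atLast-last n) (trans (sum-cong-≗ {n} atLast-inject₁) (sum-replicate-zero n)))

  Φ : ∀ {n} → Vec ℕ (suc n) → Vec ℕ (suc n)
  Φ = relabel rotation atLast

  lookup-Φ-last : ∀ {n} (ζ : Vec ℕ (suc n)) → lookup (Φ ζ) (fromℕ n) ≡ suc (lookup ζ zero)
  lookup-Φ-last {n} ζ = trans (lookup-relabel rotation atLast ζ (fromℕ n)) (cong₂ _+_ (atLast-last n) (cong (lookup ζ) (rotation-last n)))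

  lookup-Φ-inject₁ : ∀ {n} (ζ : Vec ℕ (suc n)) k → lookup (Φ ζ) (inject₁ k) ≡ lookup ζ (suc k)
  lookup-Φ-inject₁ ζ k = trans (lookup-relabel rotation atLast ζ (inject₁ k)) (cong₂ _+_ (atLast-inject₁ k) (cong (lookup ζ) (rotation-inject₁ k)))

  ∣Φ∣ : ∀ {n} (ζ : Vec ℕ (suc n)) → ∣ Φ ζ ∣ ≡ suc ∣ ζ ∣
  ∣Φ∣ {n} ζ = trans (∣relabel∣ rotation atLast ζ) (cong (_+ ∣ ζ ∣) (sum-atLast n))

  Φ⁻ : ∀ {n} → Vec ℕ (suc n) → Vec ℕ (suc n)
  Φ⁻ {n} ζ = ℕ.pred (lookup ζ (fromℕ n)) ∷ tabulate (lookup ζ ∘ inject₁)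

  Φ∘Φ⁻ : ∀ {n} (ζ : Vec ℕ (suc n)) → 0 < lookup ζ (fromℕ n) → Φ (Φ⁻ ζ) ≡ ζ
  Φ∘Φ⁻ {n} ζ 0<ζₙ = vec-ext λ p → at (view p)
    where
    at : ∀ {p} → View p → lookup (Φ (Φ⁻ ζ)) p ≡ lookup ζ p
    at ‵fromℕ = trans (lookup-Φ-last (Φ⁻ ζ)) (ℕP.suc-pred _ {{ℕ.>-nonZero 0<ζₙ}})
    at (‵inject₁ k) = trans (lookup-Φ-inject₁ (Φ⁻ ζ) k) (VP.lookup∘tabulate (lookup ζ ∘ inject₁) k)

  adjacent-≢ : ∀ {n} {i j : Fin n} → toℕ j ≡ suc (toℕ i) → j ≢ i
  adjacent-≢ e refl = ℕP.1+n≢n (sym e)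

  -- A nonzero entry is moved to the last place by swaps; then Φ⁻ lowers the degree.
  swap-Φ-induction : ∀ {n} (P : Vec ℕ (suc n) → Set) → P (replicate (suc n) 0)
    → (∀ i j → toℕ j ≡ suc (toℕ i) → ∀ ζ → P ζ → P (swap i j ζ))
    → (∀ ζ → P ζ → P (Φ ζ)) → ∀ ζ → P ζ
  swap-Φ-induction {n} P P0 Psw PΦ ζ = byDegree ∣ ζ ∣ ζ refl
    where
    positive : ∀ {n} (ζ : Vec ℕ n) {d} → ∣ ζ ∣ ≡ suc d → Σ[ p ∈ Fin n ] 0 < lookup ζ p
    positive (suc x ∷ ζ) e = zero , s≤s z≤n
    positive (zero ∷ ζ) e with positive ζ e
    ... | p , 0<ζp = suc p , 0<ζp
    byDegree : ∀ d ζ → ∣ ζ ∣ ≡ d → P ζ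
    byDegree zero ζ e = subst P (sym (∣ζ∣≡0 ζ e)) P0
    byDegree (suc d) ζ e with positive ζ e
    ... | p , 0<ζp = byPosition (n ∸ toℕ p) p ζ e 0<ζp refl
      where
      byPosition : ∀ m p ζ → ∣ ζ ∣ ≡ suc d → 0 < lookup ζ p → n ∸ toℕ p ≡ m → P ζ
      byPosition m p ζ e 0<ζp em with view p
      ... | ‵fromℕ = subst P (Φ∘Φ⁻ ζ 0<ζp)
              (PΦ (Φ⁻ ζ) (byDegree d (Φ⁻ ζ) (ℕP.suc-injective (trans (sym (∣Φ∣ (Φ⁻ ζ))) (trans (cong ∣_∣ (Φ∘Φ⁻ ζ 0<ζp)) e)))))
      byPosition zero _ ζ e 0<ζp em | ‵inject₁ k =
        contradiction (FinP.toℕ<n k) (ℕP.≤⇒≯ (subst (n ≤_) (FinP.toℕ-inject₁ k) (ℕP.m∸n≡0⇒m≤n em)))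
      byPosition (suc m) _ ζ e 0<ζp em | ‵inject₁ k =
        subst P (swap-involutive (adjacent-≢ adj) ζ)
          (Psw (inject₁ k) (suc k) adj (swap (inject₁ k) (suc k) ζ)
            (byPosition m (suc k) (swap (inject₁ k) (suc k) ζ) (trans (∣swap∣ (inject₁ k) (suc k) ζ) e)
              (subst (0 <_) (sym (trans (lookup-swap (inject₁ k) (suc k) ζ (suc k)) (cong (lookup ζ) (transpose-j (adjacent-≢ adj))))) 0<ζp)
              (ℕP.suc-injective (trans (sym (ℕP.+-∸-assoc 1 (FinP.toℕ<n k))) (trans (cong (n ∸_) (sym (FinP.toℕ-inject₁ k))) em)))))
        where
        adj : toℕ (suc k) ≡ suc (toℕ (inject₁ k))
        adj = cong suc (sym (FinP.toℕ-inject₁ k))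

-- The stable decreasing sort of a composition

module Ranks where
  open import Data.Nat using (_+_; _∸_; _≤_; _<_)
  open import Relation.Binary.PropositionalEquality using (refl; sym; trans; cong; cong₂)
  open ℕSum using (sum; ∑-distrib-+; sum-permute; sum-cong-≗; sum-replicate-zero)
  open Relabelling

  indicator : Bool → ℕ
  indicator b = if b then 1 else 0

  countF-sum : ∀ {n} (b : Fin n → Bool) → countF b ≡ sum (indicator ∘ b)
  countF-sum b = filter-tabulate (λ i → i)
    where
    filter-tabulate : ∀ {m} (f : Fin m → Fin _)
      → length (L.filter (λ i → b i Bool.≟ true) (L.tabulate f)) ≡ sum (indicator ∘ b ∘ f)
    filter-tabulate {zero} f = refl
    filter-tabulate {suc m} f with b (f zero)
    ... | true  = cong suc (filter-tabulate (f ∘ suc))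
    ... | false = filter-tabulate (f ∘ suc)

  -- i precedes k in the stable decreasing sort of γ
  Before : ∀ {n} → Vec ℕ n → Fin n → Fin n → Set
  Before γ i k = lookup γ k < lookup γ i ⊎ (lookup γ k ≡ lookup γ i × i Fin.< k)

  abstract
    -- Abstract, so that the decision stays folded in goals and enters only by its outcome.
    before? : ∀ {n} (γ : Vec ℕ n) i k → Dec (Before γ i k)
    before? γ i k = (lookup γ k ℕ.<? lookup γ i) ⊎-dec ((lookup γ k ℕ.≟ lookup γ i) ×-dec (i Fin.<? k))

  [before] : ∀ {n} → Vec ℕ n → Fin n → Fin n → ℕ
  [before] γ i k = indicator (does (before? γ i k))

  -- The coefficient of r in coordinate i of the node, n - 1 - rank, obtained as a count and hence
  -- without truncated subtraction.
  corank : ∀ {n} → Vec ℕ n → Fin n → ℕ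
  corank γ i = sum ([before] γ i)

  [before]-true : ∀ {n} (γ : Vec ℕ n) {i k} → Before γ i k → [before] γ i k ≡ 1
  [before]-true γ {i} {k} p = cong indicator (dec-true (before? γ i k) p)

  [before]-false : ∀ {n} (γ : Vec ℕ n) {i k} → ¬ Before γ i k → [before] γ i k ≡ 0
  [before]-false γ {i} {k} ¬p = cong indicator (dec-false (before? γ i k) ¬p)

  [before]-cong : ∀ {m n} (γ : Vec ℕ m) (γ′ : Vec ℕ n) {i k i′ k′} → (Before γ i k → Before γ′ i′ k′) → (Before γ′ i′ k′ → Before γ i k)
    → [before] γ i k ≡ [before] γ′ i′ k′
  [before]-cong γ γ′ {i} {k} to from with before? γ i k
  ... | yes p = sym ([before]-true γ′ (to p))
  ... | no ¬p = sym ([before]-false γ′ (¬p ∘ from))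

  before-irrefl : ∀ {n} (γ : Vec ℕ n) {i} → ¬ Before γ i i
  before-irrefl γ (inj₁ p) = ℕP.n≮n _ p
  before-irrefl γ (inj₂ (_ , p)) = ℕP.n≮n _ p

  before-trans : ∀ {n} (γ : Vec ℕ n) {i j k} → Before γ i j → Before γ j k → Before γ i k
  before-trans γ (inj₁ p) (inj₁ q) = inj₁ (ℕP.<-trans q p)
  before-trans γ (inj₁ p) (inj₂ (q , _)) = inj₁ (subst (_< _) (sym q) p)
  before-trans γ (inj₂ (p , _)) (inj₁ q) = inj₁ (subst (_ <_) p q)
  before-trans γ (inj₂ (p , p′)) (inj₂ (q , q′)) = inj₂ (trans q p , ℕP.<-trans p′ q′)

  before-total : ∀ {n} (γ : Vec ℕ n) i k → i ≢ k → Before γ i k ⊎ Before γ k i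
  before-total γ i k i≢k with ℕP.<-cmp (lookup γ i) (lookup γ k)
  ... | tri< p _ _ = inj₂ (inj₁ p)
  ... | tri> _ _ p = inj₁ (inj₁ p)
  ... | tri≈ _ e _ with FinP.<-cmp i k
  ...   | tri< p _ _ = inj₁ (inj₂ (sym e , p))
  ...   | tri≈ _ p _ = contradiction p i≢k
  ...   | tri> _ _ p = inj₂ (inj₂ (e , p))

  [≡] : ∀ {n} → Fin n → Fin n → ℕ
  [≡] i k = indicator (does (k Fin.≟ i))

  sum-[≡] : ∀ {n} (i : Fin n) → sum ([≡] i) ≡ 1
  sum-[≡] {suc n} zero = cong suc (sum-replicate-zero n)
  sum-[≡] {suc n} (suc i) = trans (sum-cong-≗ {n} (λ k → refl)) (sum-[≡] i)

  sum-mono : ∀ {n} (f g : Fin n → ℕ) → (∀ i → f i ≤ g i) → sum f ≤ sum g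
  sum-mono {zero} f g p = z≤n
  sum-mono {suc n} f g p = ℕP.+-mono-≤ (p zero) (sum-mono (f ∘ suc) (g ∘ suc) (p ∘ suc))

  sum-1 : ∀ n → sum {n} (λ _ → 1) ≡ n
  sum-1 zero = refl
  sum-1 (suc n) = cong suc (sum-1 n)

  rank-sum : ∀ {n} (γ : Vec ℕ n) i → rank γ i ≡ sum (λ k → [before] γ k i)
  rank-sum γ i = trans (cong₂ _+_ (countF-sum greater) (countF-sum tied)) (trans (sym (∑-distrib-+ (indicator ∘ greater) (indicator ∘ tied))) (sum-cong-≗ pointwise))
    where
    greater tied : Fin _ → Bool
    greater k = does (lookup γ i ℕ.<? lookup γ k)
    tied k = does (k Fin.<? i) ∧ does (lookup γ k ℕ.≟ lookup γ i)
    tied-yes : ∀ {k} → k Fin.< i → lookup γ k ≡ lookup γ i → tied k ≡ true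
    tied-yes {k} p e = dec-true ((k Fin.<? i) ×-dec (lookup γ k ℕ.≟ lookup γ i)) (p , e)
    tied-no : ∀ {k} → ¬ (k Fin.< i × lookup γ k ≡ lookup γ i) → tied k ≡ false
    tied-no {k} ¬p = dec-false ((k Fin.<? i) ×-dec (lookup γ k ℕ.≟ lookup γ i)) ¬p
    pointwise : ∀ k → indicator (greater k) + indicator (tied k) ≡ [before] γ k i
    pointwise k with ℕP.<-cmp (lookup γ i) (lookup γ k)
    ... | tri< p e _ = trans (cong₂ _+_ (cong indicator (dec-true (lookup γ i ℕ.<? lookup γ k) p)) (cong indicator (tied-no (λ q → e (sym (proj₂ q))))))
                         (sym ([before]-true γ (inj₁ p)))
    ... | tri> p e q = trans (cong₂ _+_ (cong indicator (dec-false (lookup γ i ℕ.<? lookup γ k) p)) (cong indicator (tied-no (λ q → e (sym (proj₂ q))))))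
                         (sym ([before]-false γ λ { (inj₁ q) → p q ; (inj₂ (q , _)) → e q }))
    ... | tri≈ p e _ = trans (cong (_+ indicator (tied k)) (cong indicator (dec-false (lookup γ i ℕ.<? lookup γ k) p))) (position (k Fin.<? i))
      where
      position : Dec (k Fin.< i) → indicator (tied k) ≡ [before] γ k i
      position (yes q) = trans (cong indicator (tied-yes q (sym e))) (sym ([before]-true γ (inj₂ (e , q))))
      position (no ¬q) = trans (cong indicator (tied-no (¬q ∘ proj₁))) (sym ([before]-false γ λ { (inj₁ q) → p q ; (inj₂ (_ , q)) → ¬q q }))

  -- Each place is i itself, precedes i or follows i, and exactly one of these holds.
  suc-rank+corank : ∀ {n} (γ : Vec ℕ n) i → suc (rank γ i + corank γ i) ≡ n
  suc-rank+corank {n} γ i = begin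
    1 + (rank γ i + corank γ i)  ≡⟨ cong₂ _+_ (sym (sum-[≡] i)) (trans (cong (_+ corank γ i) (rank-sum γ i)) (sym (∑-distrib-+ (λ k → [before] γ k i) ([before] γ i)))) ⟩
    sum ([≡] i) + sum (λ k → [before] γ k i + [before] γ i k)  ≡⟨ sym (∑-distrib-+ ([≡] i) (λ k → [before] γ k i + [before] γ i k)) ⟩
    sum (λ k → [≡] i k + ([before] γ k i + [before] γ i k))  ≡⟨ sum-cong-≗ pointwise ⟩
    sum {n} (λ _ → 1)  ≡⟨ sum-1 n ⟩
    n ∎
    where
    open ≡.≡-Reasoning
    pointwise : ∀ k → [≡] i k + ([before] γ k i + [before] γ i k) ≡ 1
    pointwise k with k Fin.≟ i
    ... | yes refl = cong suc (cong₂ _+_ ([before]-false γ (before-irrefl γ {k})) ([before]-false γ (before-irrefl γ {k})))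
    ... | no k≢i with before-total γ k i k≢i
    ...   | inj₁ p = cong₂ _+_ ([before]-true γ p) ([before]-false γ (before-irrefl γ {k} ∘ before-trans γ p))
    ...   | inj₂ p = cong₂ _+_ ([before]-false γ (λ q → before-irrefl γ (before-trans γ p q))) ([before]-true γ p)

  corank-spec : ∀ {n} (γ : Vec ℕ n) i → n ∸ 1 ∸ rank γ i ≡ corank γ i
  corank-spec γ i = trans (cong (λ m → m ∸ 1 ∸ rank γ i) (sym (suc-rank+corank γ i))) (ℕP.m+n∸m≡n (rank γ i) (corank γ i))

  corank-cong : ∀ {n} (γ γ′ : Vec ℕ n) i → (∀ k → Before γ i k → Before γ′ i k) → (∀ k → Before γ′ i k → Before γ i k) → corank γ i ≡ corank γ′ i
  corank-cong γ γ′ i to from = sum-cong-≗ λ k → [before]-cong γ γ′ (to k) (from k)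

  corank-relabel : ∀ {n} (π : Permutation n n) (γ γ′ : Vec ℕ n) p
    → (∀ q → Before γ′ p q → Before γ (π ⟨$⟩ʳ p) (π ⟨$⟩ʳ q)) → (∀ q → Before γ (π ⟨$⟩ʳ p) (π ⟨$⟩ʳ q) → Before γ′ p q)
    → corank γ′ p ≡ corank γ (π ⟨$⟩ʳ p)
  corank-relabel π γ γ′ p to from = trans (sum-cong-≗ λ q → [before]-cong γ′ γ (to q) (from q)) (sym (sum-permute ([before] γ (π ⟨$⟩ʳ p)) π))

  -- Whatever follows q also follows p, and so does q itself.
  corank-decreasing : ∀ {n} (γ : Vec ℕ n) {p q} → Before γ p q → corank γ q < corank γ p
  corank-decreasing γ {p} {q} b = ℕP.≤-trans (ℕP.≤-reflexive (trans (cong (_+ corank γ q) (sym (sum-[≡] q))) (sym (∑-distrib-+ ([≡] q) ([before] γ q)))))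
    (sum-mono _ ([before] γ p) pointwise)
    where
    pointwise : ∀ k → [≡] q k + [before] γ q k ≤ [before] γ p k
    pointwise k with k Fin.≟ q
    ... | yes refl = ℕP.≤-reflexive (trans (cong suc ([before]-false γ (before-irrefl γ {k}))) (sym ([before]-true γ b)))
    ... | no _ with before? γ q k
    ...   | yes c = ℕP.≤-reflexive (sym ([before]-true γ (before-trans γ b c)))
    ...   | no _ = z≤n

  corank-injective : ∀ {n} (γ : Vec ℕ n) {p q} → p ≢ q → corank γ p ≢ corank γ q
  corank-injective γ {p} {q} p≢q e with before-total γ p q p≢q
  ... | inj₁ b = ℕP.<-irrefl (sym e) (corank-decreasing γ b)
  ... | inj₂ b = ℕP.<-irrefl e (corank-decreasing γ b)

  -- Between two equal neighbouring entries nothing can be sorted in. At such a node x_i - x_j = r,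
  -- which kills the factor x_i - x_j - r of the swap relation.
  corank-adjacent : ∀ {n} (γ : Vec ℕ n) {i j} → toℕ j ≡ suc (toℕ i) → lookup γ i ≡ lookup γ j → corank γ i ≡ suc (corank γ j)
  corank-adjacent γ {i} {j} adj e = trans (sum-cong-≗ pointwise) (trans (∑-distrib-+ ([≡] j) ([before] γ j)) (cong (_+ corank γ j) (sum-[≡] j)))
    where
    i<j : i Fin.< j
    i<j = ℕP.≤-reflexive (sym adj)
    pointwise : ∀ k → [before] γ i k ≡ [≡] j k + [before] γ j k
    pointwise k with k Fin.≟ j
    ... | yes refl = trans ([before]-true γ (inj₂ (sym e , i<j))) (cong suc (sym ([before]-false γ (before-irrefl γ {k}))))
    ... | no k≢j = [before]-cong γ γ to (before-trans γ (inj₂ (sym e , i<j)))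
      where
      to : Before γ i k → Before γ j k
      to (inj₁ p) = inj₁ (subst (_ <_) e p)
      to (inj₂ (q , p)) = inj₂ (trans q e , ℕP.≤∧≢⇒< (subst (_≤ toℕ k) (sym adj) p) (λ j≡k → k≢j (sym (FinP.toℕ-injective j≡k))))

  -- No index lies between i and j, so only the order of the pair i, j itself is reversed.
  transpose-< : ∀ {n} {i j : Fin n} → toℕ j ≡ suc (toℕ i) → ∀ p q → ¬ (p ≡ i × q ≡ j)
    → p Fin.< q → Perm.transpose i j ⟨$⟩ʳ p Fin.< Perm.transpose i j ⟨$⟩ʳ q
  transpose-< {i = i} {j} adj p q ¬ij = cases (transposeView (adjacent-≢ adj) p) (transposeView (adjacent-≢ adj) q) ¬ij
    where
    cases : ∀ {p q p′ q′} → TransposeView i j p p′ → TransposeView i j q q′ → ¬ (p ≡ i × q ≡ j) → p Fin.< q → p′ Fin.< q′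
    cases at-i at-i _ l = contradiction l (ℕP.n≮n _)
    cases at-i at-j ¬ij l = contradiction (refl , refl) ¬ij
    cases at-i (else q≢i q≢j) _ l = ℕP.≤∧≢⇒< (subst (_≤ _) (sym adj) l) (q≢j ∘ sym ∘ FinP.toℕ-injective)
    cases at-j at-i _ l = contradiction (ℕP.<-trans l (ℕP.≤-reflexive (sym adj))) (ℕP.n≮n _)
    cases at-j at-j _ l = contradiction l (ℕP.n≮n _)
    cases at-j (else q≢i q≢j) _ l = ℕP.<-trans (ℕP.≤-reflexive (sym adj)) l
    cases (else p≢i p≢j) at-i _ l = ℕP.<-trans l (ℕP.≤-reflexive (sym adj))
    cases (else p≢i p≢j) at-j _ l = ℕP.≤∧≢⇒< (s≤s⁻¹ (subst (suc _ ≤_) adj l)) (p≢i ∘ FinP.toℕ-injective)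
    cases (else p≢i p≢j) (else q≢i q≢j) _ l = l

  transpose-<⁻ : ∀ {n} {i j : Fin n} → toℕ j ≡ suc (toℕ i) → ∀ p q → ¬ (p ≡ j × q ≡ i)
    → Perm.transpose i j ⟨$⟩ʳ p Fin.< Perm.transpose i j ⟨$⟩ʳ q → p Fin.< q
  transpose-<⁻ {i = i} {j} adj p q ¬ji l = ≡.subst₂ Fin._<_ (transpose-involutive j≢i p) (transpose-involutive j≢i q)
    (transpose-< adj (s p) (s q) (λ (sp≡i , sq≡j) → ¬ji (back sp≡i (transpose-i i j) , back sq≡j (transpose-j j≢i))) l)
    where
    j≢i = adjacent-≢ adj
    s = Perm.transpose i j ⟨$⟩ʳ_
    back : ∀ {x y z} → s x ≡ y → s y ≡ z → x ≡ z
    back {x} e f = trans (sym (transpose-involutive j≢i x)) (trans (cong s e) f)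

  -- Positions matter only for ties. As the entries at i and j differ, the one pair of positions
  -- whose order is reversed never decides a comparison.
  corank-swap : ∀ {n} (γ : Vec ℕ n) {i j} → toℕ j ≡ suc (toℕ i) → lookup γ i ≢ lookup γ j
    → ∀ p → corank (swap i j γ) p ≡ corank γ (Perm.transpose i j ⟨$⟩ʳ p)
  corank-swap γ {i} {j} adj γᵢ≢γⱼ p = corank-relabel (Perm.transpose i j) γ (swap i j γ) p to from
    where
    j≢i = adjacent-≢ adj
    to : ∀ q → Before (swap i j γ) p q → Before γ (Perm.transpose i j ⟨$⟩ʳ p) (Perm.transpose i j ⟨$⟩ʳ q)
    to q b rewrite lookup-swap i j γ p | lookup-swap i j γ q with b
    ... | inj₁ l = inj₁ l
    ... | inj₂ (e , l) = inj₂ (e , transpose-< adj p q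
            (λ { (refl , refl) → γᵢ≢γⱼ (trans (cong (lookup γ) (sym (transpose-j j≢i))) (trans e (cong (lookup γ) (transpose-i i j)))) }) l)
    from : ∀ q → Before γ (Perm.transpose i j ⟨$⟩ʳ p) (Perm.transpose i j ⟨$⟩ʳ q) → Before (swap i j γ) p q
    from q b rewrite lookup-swap i j γ p | lookup-swap i j γ q with b
    ... | inj₁ l = inj₁ l
    ... | inj₂ (e , l) = inj₂ (e , transpose-<⁻ adj p q
            (λ { (refl , refl) → γᵢ≢γⱼ (trans (cong (lookup γ) (sym (transpose-j j≢i))) (trans (sym e) (cong (lookup γ) (transpose-i i j)))) }) l)

  -- Hence a node whose last entry is zero has last coordinate zero, and the factor x_n vanishes
  -- there.
  corank-last-0 : ∀ {n} (γ : Vec ℕ (suc n)) → lookup γ (fromℕ n) ≡ 0 → corank γ (fromℕ n) ≡ 0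
  corank-last-0 {n} γ e = trans (sum-cong-≗ λ k → [before]-false γ {fromℕ n} {k} (¬before k)) (sum-replicate-zero (suc n))
    where
    ¬before : ∀ k → ¬ Before γ (fromℕ n) k
    ¬before k (inj₁ p) = ℕP.n≮0 (subst (lookup γ k <_) e p)
    ¬before k (inj₂ (_ , p)) = ℕP.<⇒≱ p (FinP.≤fromℕ k)

  -- The first place wins its ties. After moving to the end it would lose them, but the added 1
  -- turns these ties into strict inequalities; entries larger by one become ties that still precede
  -- it.
  corank-Φ : ∀ {n} (γ : Vec ℕ (suc n)) p → corank (Φ γ) p ≡ corank γ (rotation ⟨$⟩ʳ p)
  corank-Φ {n} γ p = corank-relabel rotation γ (Φ γ) p (λ q → to (view p) (view q)) (λ q → from (view p) (view q))
    where
    to : ∀ {p q} → View p → View q → Before (Φ γ) p q → Before γ (rotation ⟨$⟩ʳ p) (rotation ⟨$⟩ʳ q)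
    to ‵fromℕ ‵fromℕ b = contradiction b (before-irrefl (Φ γ))
    to ‵fromℕ (‵inject₁ k) b rewrite rotation-last n | rotation-inject₁ k | lookup-Φ-last γ | lookup-Φ-inject₁ γ k with b
    ... | inj₂ (_ , l) = contradiction (FinP.≤fromℕ (inject₁ k)) (ℕP.<⇒≱ l)
    ... | inj₁ l with ℕP.m≤n⇒m<n∨m≡n (s≤s⁻¹ l)
    ...   | inj₁ l′ = inj₁ l′
    ...   | inj₂ e = inj₂ (e , s≤s z≤n)
    to (‵inject₁ k) ‵fromℕ b rewrite rotation-last n | rotation-inject₁ k | lookup-Φ-last γ | lookup-Φ-inject₁ γ k with b
    ... | inj₁ l = inj₁ (ℕP.<-trans (ℕP.n<1+n _) l)
    ... | inj₂ (e , _) = inj₁ (ℕP.≤-reflexive e)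
    to (‵inject₁ k) (‵inject₁ q) b rewrite rotation-inject₁ q | rotation-inject₁ k | lookup-Φ-inject₁ γ q | lookup-Φ-inject₁ γ k with b
    ... | inj₁ l = inj₁ l
    ... | inj₂ (e , l) = inj₂ (e , s≤s (≡.subst₂ _<_ (FinP.toℕ-inject₁ k) (FinP.toℕ-inject₁ q) l))
    from : ∀ {p q} → View p → View q → Before γ (rotation ⟨$⟩ʳ p) (rotation ⟨$⟩ʳ q) → Before (Φ γ) p q
    from ‵fromℕ ‵fromℕ b = contradiction b (before-irrefl γ)
    from ‵fromℕ (‵inject₁ k) b rewrite rotation-last n | rotation-inject₁ k | lookup-Φ-last γ | lookup-Φ-inject₁ γ k with b
    ... | inj₁ l = inj₁ (ℕP.m≤n⇒m≤1+n l)
    ... | inj₂ (e , _) = inj₁ (s≤s (ℕP.≤-reflexive e))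
    from (‵inject₁ k) ‵fromℕ b rewrite rotation-last n | rotation-inject₁ k | lookup-Φ-last γ | lookup-Φ-inject₁ γ k with b
    ... | inj₂ (_ , ())
    ... | inj₁ l with ℕP.m≤n⇒m<n∨m≡n l
    ...   | inj₁ l′ = inj₁ l′
    ...   | inj₂ e = inj₂ (e , subst (_< _) (sym (FinP.toℕ-inject₁ k)) (subst (toℕ k <_) (sym (FinP.toℕ-fromℕ n)) (FinP.toℕ<n k)))
    from (‵inject₁ k) (‵inject₁ q) b rewrite rotation-inject₁ q | rotation-inject₁ k | lookup-Φ-inject₁ γ q | lookup-Φ-inject₁ γ k with b
    ... | inj₁ l = inj₁ l
    ... | inj₂ (e , l) = inj₂ (e , ≡.subst₂ _<_ (sym (FinP.toℕ-inject₁ k)) (sym (FinP.toℕ-inject₁ q)) (s≤s⁻¹ l))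

-- Formal linear combinations and polynomial functions

module Polynomials (K : CommutativeRing 0ℓ 0ℓ) where
  open CommutativeRing K hiding (zero)
  open IntegerSolver K
  open import Algebra.Properties.Ring ring using (-1*x≈-x)
  open import Algebra.Properties.Semiring.Exp semiring using (_^_; ^-congˡ; ^-homo-*)
  open import Algebra.Properties.CommutativeMonoid.Sum *-commutativeMonoid using ()
    renaming (sum to prod; sum-cong-≋ to prod-cong)
  open import Relation.Binary.Reasoning.Setoid setoid
  open Relabelling

  -- The representation of `Poly` over an arbitrary basis: terms may repeat and cancel.
  Comb : Set → Set
  Comb A = List (Carrier × A)

  lin : ∀ {A} → (A → Carrier) → Comb A → Carrier
  lin φ p = L.foldr _+_ 0# (L.map (λ ce → proj₁ ce * φ (proj₂ ce)) p)

  scale : ∀ {A} → Carrier → Comb A → Comb A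
  scale c = L.map λ ce → (c * proj₁ ce , proj₂ ce)

  reindex : ∀ {A B} → (A → B) → Comb A → Comb B
  reindex f = L.map λ ce → (proj₁ ce , f (proj₂ ce))

  module _ {A : Set} where
    lin-++ : ∀ (φ : A → Carrier) p q → lin φ (p ++ q) ≈ lin φ p + lin φ q
    lin-++ φ [] q = sym (+-identityˡ _)
    lin-++ φ (x ∷ p) q = trans (+-congˡ (lin-++ φ p q)) (sym (+-assoc _ _ _))

    lin-scale : ∀ (φ : A → Carrier) c p → lin φ (scale c p) ≈ c * lin φ p
    lin-scale φ c [] = sym (zeroʳ c)
    lin-scale φ c ((a , e) ∷ p) = trans (+-cong (*-assoc c a (φ e)) (lin-scale φ c p)) (sym (distribˡ c _ _))

    lin-reindex : ∀ {B : Set} (φ : B → Carrier) (f : A → B) p → lin φ (reindex f p) ≈ lin (φ ∘ f) p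
    lin-reindex φ f [] = refl
    lin-reindex φ f (x ∷ p) = +-congˡ (lin-reindex φ f p)

    lin-cong : ∀ {φ ψ : A → Carrier} p → All (λ ce → φ (proj₂ ce) ≈ ψ (proj₂ ce)) p → lin φ p ≈ lin ψ p
    lin-cong [] [] = refl
    lin-cong (x ∷ p) (e ∷ es) = +-cong (*-congˡ e) (lin-cong p es)

    lin-cong′ : ∀ {φ ψ : A → Carrier} → (∀ e → φ e ≈ ψ e) → ∀ p → lin φ p ≈ lin ψ p
    lin-cong′ e p = lin-cong p (All.universal (λ ce → e (proj₂ ce)) p)

    -- The factor `a` stays on the left because the swap relation for `e` is known only after
    -- multiplication by x_i - x_j; in this form it passes through linear combinations.
    lin-linear : ∀ {φ φ₁ φ₂ : A → Carrier} a a₁ a₂ → (∀ e → a * φ e ≈ a₁ * φ₁ e + a₂ * φ₂ e)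
      → ∀ p → a * lin φ p ≈ a₁ * lin φ₁ p + a₂ * lin φ₂ p
    lin-linear a a₁ a₂ h [] = solve 3 (λ a b c → a :* con 0ℤ := b :* con 0ℤ :+ c :* con 0ℤ) refl a a₁ a₂
    lin-linear {φ} {φ₁} {φ₂} a a₁ a₂ h ((c , e) ∷ p) = begin
      a * (c * φ e + lin φ p)  ≈⟨ solve 4 (λ a c x y → a :* (c :* x :+ y) := c :* (a :* x) :+ a :* y) refl a c (φ e) (lin φ p) ⟩
      c * (a * φ e) + a * lin φ p  ≈⟨ +-cong (*-congˡ (h e)) (lin-linear a a₁ a₂ h p) ⟩
      c * (a₁ * φ₁ e + a₂ * φ₂ e) + (a₁ * lin φ₁ p + a₂ * lin φ₂ p)
        ≈⟨ solve 7 (λ c a₁ a₂ x₁ x₂ y₁ y₂ → c :* (a₁ :* x₁ :+ a₂ :* x₂) :+ (a₁ :* y₁ :+ a₂ :* y₂)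
             := a₁ :* (c :* x₁ :+ y₁) :+ a₂ :* (c :* x₂ :+ y₂)) refl c a₁ a₂ (φ₁ e) (φ₂ e) (lin φ₁ p) (lin φ₂ p) ⟩
      a₁ * (c * φ₁ e + lin φ₁ p) + a₂ * (c * φ₂ e + lin φ₂ p) ∎

    lin-0 : ∀ {φ : A → Carrier} → (∀ e → φ e ≈ 0#) → ∀ p → lin φ p ≈ 0#
    lin-0 h [] = refl
    lin-0 h ((c , e) ∷ p) = trans (+-cong (trans (*-congˡ (h e)) (zeroʳ c)) (lin-0 h p)) (+-identityˡ 0#)

    lin-* : ∀ c (φ : A → Carrier) p → lin (λ e → c * φ e) p ≈ c * lin φ p
    lin-* c φ [] = sym (zeroʳ c)
    lin-* c φ ((a , e) ∷ p) = trans (+-cong (solve 3 (λ a c x → a :* (c :* x) := c :* (a :* x)) refl a c (φ e)) (lin-* c φ p)) (sym (distribˡ c _ _))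

    lin-+ : ∀ (φ ψ : A → Carrier) p → lin (λ e → φ e + ψ e) p ≈ lin φ p + lin ψ p
    lin-+ φ ψ [] = sym (+-identityˡ 0#)
    lin-+ φ ψ ((c , e) ∷ p) = trans (+-congˡ (lin-+ φ ψ p))
      (solve 5 (λ c x y u v → c :* (x :+ y) :+ (u :+ v) := (c :* x :+ u) :+ (c :* y :+ v)) refl c (φ e) (ψ e) (lin φ p) (lin ψ p))

  bind : ∀ {A B : Set} → Comb A → (A → Comb B) → Comb B
  bind [] f = []
  bind ((c , e) ∷ p) f = scale c (f e) ++ bind p f

  lin-bind : ∀ {A B : Set} (φ : B → Carrier) (p : Comb A) (f : A → Comb B) → lin φ (bind p f) ≈ lin (λ e → lin φ (f e)) p
  lin-bind φ [] f = refl
  lin-bind φ ((c , e) ∷ p) f = trans (lin-++ φ (scale c (f e)) (bind p f)) (+-cong (lin-scale φ c (f e)) (lin-bind φ p f))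

  infix 4 _~_
  -- Equality in the free module, by duality. Coefficients, values at a point and transposed
  -- operators are all instances of the functional φ.
  _~_ : ∀ {A} → Comb A → Comb A → Set
  p ~ q = ∀ φ → lin φ p ≈ lin φ q

  δ : ∀ {n} → Vec ℕ n → Vec ℕ n → Carrier
  δ η e = if does (VP.≡-dec ℕ._≟_ e η) then 1# else 0#

  δ-≢ : ∀ {n} {η e : Vec ℕ n} → e ≢ η → δ η e ≈ 0#
  δ-≢ {η = η} {e} e≢η rewrite dec-false (VP.≡-dec ℕ._≟_ e η) e≢η = refl

  -- All terms with the exponent of the first one are collected and contribute its coefficient,
  -- which is zero. Deleting them leaves a shorter list with the same coefficients.
  coefficients-determine : ∀ {n} (p : Comb (Vec ℕ n)) → (∀ η → lin (δ η) p ≈ 0#) → p ~ []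
  coefficients-determine p = byLength (length p) p ℕP.≤-refl
    where
    without : ∀ {n} → Vec ℕ n → Comb (Vec ℕ n) → Comb (Vec ℕ n)
    without η [] = []
    without η ((c , e) ∷ p) with VP.≡-dec ℕ._≟_ e η
    ... | yes _ = without η p
    ... | no _  = (c , e) ∷ without η p

    length-without : ∀ {n} (η : Vec ℕ n) p → length (without η p) ℕ.≤ length p
    length-without η [] = z≤n
    length-without η ((c , e) ∷ p) with VP.≡-dec ℕ._≟_ e η
    ... | yes _ = ℕP.m≤n⇒m≤1+n (length-without η p)
    ... | no _  = s≤s (length-without η p)

    split : ∀ {n} φ (η : Vec ℕ n) p → lin φ p ≈ lin (δ η) p * φ η + lin φ (without η p)
    split φ η [] = sym (trans (+-identityʳ _) (zeroˡ _))
    split φ η ((c , e) ∷ p) with VP.≡-dec ℕ._≟_ e η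
    ... | yes ≡.refl = trans (+-congˡ (split φ e p))
            (solve 4 (λ c x y z → c :* x :+ (y :* x :+ z) := (c :* con 1ℤ :+ y) :* x :+ z) refl c (φ e) (lin (δ e) p) (lin φ (without e p)))
    ... | no _ = trans (+-congˡ (split φ η p))
            (solve 5 (λ c x y z w → c :* x :+ (y :* w :+ z) := (c :* con 0ℤ :+ y) :* w :+ (c :* x :+ z)) refl c (φ e) (lin (δ η) p) (lin φ (without η p)) (φ η))

    byLength : ∀ {n} m (p : Comb (Vec ℕ n)) → length p ℕ.≤ m → (∀ η → lin (δ η) p ≈ 0#) → p ~ []
    byLength m [] _ h φ = refl
    byLength (suc m) p@((c , e) ∷ p′) (s≤s len) h φ = trans (split φ e p) (trans (+-cong (trans (*-congʳ (h e)) (zeroˡ _)) rest) (+-identityˡ 0#))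
      where
      shorter : length (without e p) ℕ.≤ m
      shorter with VP.≡-dec ℕ._≟_ e e
      ... | yes _ = ℕP.≤-trans (length-without e p′) len
      ... | no e≢e = contradiction ≡.refl e≢e
      rest : lin φ (without e p) ≈ 0#
      rest = byLength m (without e p) shorter (λ η → begin
        lin (δ η) (without e p)  ≈⟨ sym (+-identityˡ _) ⟩
        0# + lin (δ η) (without e p)  ≈⟨ +-congʳ (sym (trans (*-congʳ (h e)) (zeroˡ _))) ⟩
        lin (δ e) p * δ η e + lin (δ η) (without e p)  ≈⟨ sym (split (δ η) e p) ⟩
        lin (δ η) p  ≈⟨ h η ⟩
        0# ∎) φ

  Point : ℕ → Set
  Point n = Fin n → Carrier

  rotatePoint : ∀ {n} → Point (suc n) → Point (suc n)
  rotatePoint {n} v zero    = v (fromℕ n) - 1#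
  rotatePoint     v (suc k) = v (inject₁ k)

  mon : ∀ {n} → Point n → Vec ℕ n → Carrier
  mon v e = prod (λ i → v i ^ lookup e i)

  mon-cong : ∀ {n} {v w : Point n} → (∀ i → v i ≈ w i) → ∀ e → mon v e ≈ mon w e
  mon-cong h e = prod-cong λ i → ^-congˡ (lookup e i) (h i)

  mon-0 : ∀ {n} (v : Point n) → mon v (replicate n 0) ≈ 1#
  mon-0 {zero} v = refl
  mon-0 {suc n} v = trans (*-identityˡ _) (mon-0 (v ∘ suc))

  mon-⁺ : ∀ {n} (v : Point n) e k → mon v (e ⁺ k) ≈ v k * mon v e
  mon-⁺ v (x ∷ e) zero = *-assoc _ _ _
  mon-⁺ v (x ∷ e) (suc k) = trans (*-congˡ (mon-⁺ (v ∘ suc) e k))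
    (solve 3 (λ a b c → a :* (b :* c) := b :* (a :* c)) refl (v zero ^ x) (v (suc k)) (mon (v ∘ suc) e))

  mon-+ : ∀ {n} (v : Point n) d e → mon v (V.zipWith ℕ._+_ d e) ≈ mon v d * mon v e
  mon-+ v [] [] = sym (*-identityˡ 1#)
  mon-+ v (x ∷ d) (y ∷ e) = trans (*-cong (^-homo-* (v zero) x y) (mon-+ (v ∘ suc) d e))
    (solve 4 (λ a b c d → (a :* b) :* (c :* d) := (a :* c) :* (b :* d)) refl (v zero ^ x) (v zero ^ y) (mon (v ∘ suc) d) (mon (v ∘ suc) e))

  mon-scale : ∀ {n} (v : Point n) c e → mon (λ i → c * v i) e ≈ c ^ ∣ e ∣ * mon v e
  mon-scale {n} v c = ⁺-induction (λ e → mon (λ i → c * v i) e ≈ c ^ ∣ e ∣ * mon v e)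
    (trans (mon-0 (λ i → c * v i)) (sym (trans (*-cong (reflexive (≡.cong (c ^_) (∣0∣ n))) (mon-0 v)) (*-identityˡ 1#))))
    λ e k h → begin
      mon (λ i → c * v i) (e ⁺ k)  ≈⟨ mon-⁺ (λ i → c * v i) e k ⟩
      c * v k * mon (λ i → c * v i) e  ≈⟨ *-congˡ h ⟩
      c * v k * (c ^ ∣ e ∣ * mon v e)  ≈⟨ solve 4 (λ c x y z → c :* x :* (y :* z) := (c :* y) :* (x :* z)) refl c (v k) (c ^ ∣ e ∣) (mon v e) ⟩
      c ^ suc ∣ e ∣ * (v k * mon v e)  ≈⟨ *-cong (reflexive (≡.cong (c ^_) (≡.sym (∣⁺∣ e k)))) (sym (mon-⁺ v e k)) ⟩
      c ^ ∣ e ⁺ k ∣ * mon v (e ⁺ k) ∎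

  ev : ∀ {n} → Comb (Vec ℕ n) → Point n → Carrier
  ev p v = lin (mon v) p

  Deg< : ∀ {n} → ℕ → Comb (Vec ℕ n) → Set
  Deg< d = All λ ce → ∣ proj₂ ce ∣ ℕ.< d

  -- The degree bound is strict, so that `IsPoly 0` forces the function to be zero.
  IsPoly : ∀ {n} → ℕ → (Point n → Carrier) → Set
  IsPoly d F = Σ[ p ∈ Comb (Vec ℕ _) ] Deg< d p × (∀ v → F v ≈ ev p v)

  module _ {n : ℕ} where
    poly-resp : ∀ {d} {F G : Point n → Carrier} → (∀ v → F v ≈ G v) → IsPoly d F → IsPoly d G
    poly-resp h (p , b , e) = p , b , λ v → trans (sym (h v)) (e v)

    poly-≤ : ∀ {d d′} {F : Point n → Carrier} → d ℕ.≤ d′ → IsPoly d F → IsPoly d′ F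
    poly-≤ l (p , b , e) = p , All.map (λ q → ℕP.≤-trans q l) b , e

    poly-cast : ∀ {d d′} {F : Point n → Carrier} → d ≡ d′ → IsPoly d F → IsPoly d′ F
    poly-cast e = poly-≤ (ℕP.≤-reflexive e)

    poly-0 : ∀ {d} → IsPoly d (λ (v : Point n) → 0#)
    poly-0 = [] , [] , λ v → refl

    poly-mon : ∀ {d} (e : Vec ℕ n) → ∣ e ∣ ℕ.< d → IsPoly d (λ v → mon v e)
    poly-mon e l = (1# , e) ∷ [] , l ∷ [] , λ v → sym (trans (+-identityʳ _) (*-identityˡ _))

    poly-ev : ∀ {d} (p : Comb (Vec ℕ n)) → Deg< d p → IsPoly d (ev p)
    poly-ev p b = p , b , λ v → refl

    poly-+ : ∀ {d} {F G : Point n → Carrier} → IsPoly d F → IsPoly d G → IsPoly d (λ v → F v + G v)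
    poly-+ (p , b , e) (q , c , f) = p ++ q , AllP.++⁺ b c , λ v → trans (+-cong (e v) (f v)) (sym (lin-++ (mon v) p q))

    poly-scale : ∀ {d} c {F : Point n → Carrier} → IsPoly d F → IsPoly d (λ v → c * F v)
    poly-scale c (p , b , e) = scale c p , AllP.map⁺ b , λ v → trans (*-congˡ (e v)) (sym (lin-scale (mon v) c p))

    poly-neg : ∀ {d} {F : Point n → Carrier} → IsPoly d F → IsPoly d (λ v → - F v)
    poly-neg P = poly-resp (λ v → -1*x≈-x _) (poly-scale (- 1#) P)

    poly-var : ∀ {d} k {F : Point n → Carrier} → IsPoly d F → IsPoly (suc d) (λ v → v k * F v)
    poly-var k (p , b , e) = reindex (_⁺ k) p , AllP.map⁺ (All.map (λ {ce} l → ℕP.≤-trans (s≤s (ℕP.≤-reflexive (∣⁺∣ (proj₂ ce) k))) (s≤s l)) b)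
      , λ v → trans (*-congˡ (e v)) (sym (trans (lin-reindex (mon v) (_⁺ k) p) (trans (lin-cong′ (λ e → mon-⁺ v e k) p) (lin-* (v k) (mon v) p))))

    poly-lin : ∀ {d} {A : Set} {F : A → Point n → Carrier} p → All (λ ca → IsPoly d (F (proj₂ ca))) p → IsPoly d (λ v → lin (λ a → F a v) p)
    poly-lin [] [] = poly-0
    poly-lin ((c , a) ∷ p) (P ∷ Ps) = poly-+ (poly-scale c P) (poly-lin p Ps)

-- Division by a linear factor

module Division (K : CommutativeRing 0ℓ 0ℓ) where
  open CommutativeRing K hiding (zero)
  open IntegerSolver K
  open Relabelling
  open Polynomials K

  infix 4 _≤ᵛ_
  _≤ᵛ_ : ∀ {n} → Vec ℕ n → Vec ℕ n → Set
  d ≤ᵛ e = ∀ k → lookup d k ℕ.≤ lookup e k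

  ⁺-mono : ∀ {n} (d e : Vec ℕ n) k → d ≤ᵛ e → d ⁺ k ≤ᵛ e ⁺ k
  ⁺-mono d e k le p with p Fin.≟ k
  ... | yes ≡.refl rewrite lookup-⁺-≡ d k | lookup-⁺-≡ e k = s≤s (le k)
  ... | no p≢k rewrite lookup-⁺-≢ d p≢k | lookup-⁺-≢ e p≢k = le p

  ≤ᵛ-⁺ : ∀ {n} (e : Vec ℕ n) k → e ≤ᵛ e ⁺ k
  ≤ᵛ-⁺ e k p with p Fin.≟ k
  ... | yes ≡.refl rewrite lookup-⁺-≡ e k = ℕP.n≤1+n _
  ... | no p≢k rewrite lookup-⁺-≢ e p≢k = ℕP.≤-refl

  ⁺-comm : ∀ {n} (e : Vec ℕ n) j k → e ⁺ j ⁺ k ≡ e ⁺ k ⁺ j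
  ⁺-comm e j k with j Fin.≟ k
  ... | yes ≡.refl = ≡.refl
  ... | no j≢k = VP.updateAt-commutes k j (j≢k ∘ ≡.sym) e

  All-bind : ∀ {A B : Set} {P : B → Set} (p : Comb A) (f : A → Comb B)
    → All (λ ce → All (P ∘ proj₂) (f (proj₂ ce))) p → All (P ∘ proj₂) (bind p f)
  All-bind [] f [] = []
  All-bind (x ∷ p) f (h ∷ hs) = AllP.++⁺ (AllP.map⁺ h) (All-bind p f hs)

  module _ {n} (q : Fin n) (c : Carrier) where
    -- The transpose of multiplication by x_q − c, acting on functionals.
    times-linear : (Vec ℕ n → Carrier) → Vec ℕ n → Carrier
    times-linear φ e = φ (e ⁺ q) + - c * φ e

    -- The bound `e′ ≤ᵛ e` ensures that division brings in no new variables, so the polynomial stays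
    -- within the live ones of the queue.
    Remainder : Vec ℕ n → Vec ℕ n → Set
    Remainder e e′ = ∣ e′ ∣ ℕ.≤ ∣ e ∣ × e′ ≤ᵛ e × lookup e′ q ≡ 0

    Quotient : Vec ℕ n → Vec ℕ n → Set
    Quotient e e′ = ∣ e′ ∣ ℕ.< ∣ e ∣ × e′ ≤ᵛ e

    -- `division` is the identity x^e = rem + (x_q - c) quot, read through an arbitrary functional.
    record DivMod (e : Vec ℕ n) : Set where
      field
        rem quot   : Comb (Vec ℕ n)
        rem-terms  : All (Remainder e ∘ proj₂) rem
        quot-terms : All (Quotient e ∘ proj₂) quot
        division   : ∀ φ → φ e ≈ lin φ rem + lin (times-linear φ) quot
    open DivMod

    divMod : ∀ e → DivMod e
    divMod = ⁺-induction DivMod base step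
      where
      open import Relation.Binary.Reasoning.Setoid setoid
      base : DivMod (replicate n 0)
      base = record
        { rem = (1# , replicate n 0) ∷ [] ; quot = []
        ; rem-terms = (ℕP.≤-refl , (λ k → ℕP.≤-refl) , VP.lookup-replicate q 0) ∷ [] ; quot-terms = []
        ; division = λ φ → solve 1 (λ x → x := (con 1ℤ :* x :+ con 0ℤ) :+ con 0ℤ) refl (φ (replicate n 0)) }
      step : ∀ e k → DivMod e → DivMod (e ⁺ k)
      step e k D with k Fin.≟ q
      -- Multiplication by x_k keeps the remainder free of x_q, so both parts are simply multiplied
      -- by it.
      ... | no k≢q = record
        { rem = reindex (_⁺ k) (rem D) ; quot = reindex (_⁺ k) (quot D)
        ; rem-terms = AllP.map⁺ (All.map (λ {ce} (a , b , z) → ∣∣-mono (proj₂ ce) a , ⁺-mono (proj₂ ce) e k b , ≡.trans (lookup-⁺-≢ (proj₂ ce) (k≢q ∘ ≡.sym)) z) (rem-terms D))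
        ; quot-terms = AllP.map⁺ (All.map (λ {ce} (a , b) → ≡.subst₂ ℕ._<_ (≡.sym (∣⁺∣ (proj₂ ce) k)) (≡.sym (∣⁺∣ e k)) (s≤s a) , ⁺-mono (proj₂ ce) e k b) (quot-terms D))
        ; division = λ φ → begin
            φ (e ⁺ k)  ≈⟨ division D (λ e → φ (e ⁺ k)) ⟩
            lin (λ e → φ (e ⁺ k)) (rem D) + lin (times-linear (λ e → φ (e ⁺ k))) (quot D)
              ≈⟨ +-cong (sym (lin-reindex φ (_⁺ k) (rem D)))
                        (trans (lin-cong′ (λ e → +-congʳ (reflexive (≡.cong φ (⁺-comm e q k)))) (quot D)) (sym (lin-reindex (times-linear φ) (_⁺ k) (quot D)))) ⟩
            lin φ (reindex (_⁺ k) (rem D)) + lin (times-linear φ) (reindex (_⁺ k) (quot D)) ∎ }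
        where
        ∣∣-mono : ∀ e′ → ∣ e′ ∣ ℕ.≤ ∣ e ∣ → ∣ e′ ⁺ k ∣ ℕ.≤ ∣ e ⁺ k ∣
        ∣∣-mono e′ a = ≡.subst₂ ℕ._≤_ (≡.sym (∣⁺∣ e′ k)) (≡.sym (∣⁺∣ e k)) (s≤s a)
      -- If x^e = R + (x_q - c) Q, then x_q x^e = c R + (x_q - c)(R + x_q Q).
      ... | yes ≡.refl = record
        { rem = scale c (rem D) ; quot = rem D ++ reindex (_⁺ k) (quot D)
        ; rem-terms = AllP.map⁺ (All.map (λ (a , b , z) → ℕP.≤-trans a (ℕP.≤-trans (ℕP.n≤1+n _) (ℕP.≤-reflexive (≡.sym (∣⁺∣ e k)))) , (λ p → ℕP.≤-trans (b p) (≤ᵛ-⁺ e k p)) , z) (rem-terms D))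
        ; quot-terms = AllP.++⁺
            (All.map (λ (a , b , z) → ℕP.≤-trans (s≤s a) (ℕP.≤-reflexive (≡.sym (∣⁺∣ e k))) , (λ p → ℕP.≤-trans (b p) (≤ᵛ-⁺ e k p))) (rem-terms D))
            (AllP.map⁺ (All.map (λ {ce} (a , b) → ≡.subst₂ ℕ._<_ (≡.sym (∣⁺∣ (proj₂ ce) k)) (≡.sym (∣⁺∣ e k)) (s≤s a) , ⁺-mono (proj₂ ce) e k b) (quot-terms D)))
        ; division = λ φ → begin
            φ (e ⁺ k)  ≈⟨ division D (λ e → φ (e ⁺ k)) ⟩
            lin (λ e → φ (e ⁺ k)) (rem D) + lin (times-linear (λ e → φ (e ⁺ k))) (quot D)
              ≈⟨ solve 4 (λ c x y z → y :+ z := c :* x :+ ((y :+ :- c :* x) :+ z)) refl c (lin φ (rem D)) _ _ ⟩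
            c * lin φ (rem D) + ((lin (λ e → φ (e ⁺ k)) (rem D) + - c * lin φ (rem D)) + lin (times-linear (λ e → φ (e ⁺ k))) (quot D))
              ≈⟨ +-cong (sym (lin-scale φ c (rem D))) (+-cong
                   (trans (+-congˡ (sym (lin-* (- c) φ (rem D)))) (sym (lin-+ (λ e → φ (e ⁺ k)) (λ e → - c * φ e) (rem D))))
                   (sym (lin-reindex (times-linear φ) (_⁺ k) (quot D)))) ⟩
            lin φ (scale c (rem D)) + (lin (times-linear φ) (rem D) + lin (times-linear φ) (reindex (_⁺ k) (quot D)))
              ≈⟨ +-congˡ (sym (lin-++ (times-linear φ) (rem D) (reindex (_⁺ k) (quot D)))) ⟩
            lin φ (scale c (rem D)) + lin (times-linear φ) (rem D ++ reindex (_⁺ k) (quot D)) ∎ }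

    remainder quotient : Comb (Vec ℕ n) → Comb (Vec ℕ n)
    remainder p = bind p (rem ∘ divMod)
    quotient p = bind p (quot ∘ divMod)

    remainder-terms : ∀ {P Q : Vec ℕ n → Set} → (∀ {e e′} → P e → Remainder e e′ → Q e′) → ∀ {p} → All (P ∘ proj₂) p → All (Q ∘ proj₂) (remainder p)
    remainder-terms h {p} Ps = All-bind p (rem ∘ divMod) (All.map (λ {ce} P → All.map (h P) (rem-terms (divMod (proj₂ ce)))) Ps)

    quotient-terms : ∀ {P Q : Vec ℕ n → Set} → (∀ {e e′} → P e → Quotient e e′ → Q e′) → ∀ {p} → All (P ∘ proj₂) p → All (Q ∘ proj₂) (quotient p)
    quotient-terms h {p} Ps = All-bind p (quot ∘ divMod) (All.map (λ {ce} P → All.map (h P) (quot-terms (divMod (proj₂ ce)))) Ps)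

    division-combination : ∀ p φ → lin φ p ≈ lin φ (remainder p) + lin (times-linear φ) (quotient p)
    division-combination p φ = trans (lin-cong′ (λ e → division (divMod e) φ) p)
      (trans (lin-+ _ _ p) (sym (+-cong (lin-bind φ p (rem ∘ divMod)) (lin-bind (times-linear φ) p (quot ∘ divMod)))))

    division-ev : ∀ p v → ev p v ≈ ev (remainder p) v + (v q - c) * ev (quotient p) v
    division-ev p v = trans (division-combination p (mon v)) (+-congˡ (trans
      (lin-cong′ (λ e → trans (+-congʳ (mon-⁺ v e q)) (sym (distribʳ (mon v e) (v q) (- c)))) (quotient p)) (lin-* (v q - c) (mon v) (quotient p))))

-- The ground field, seen from outside

-- An interface to the rational functions, so that goals never unfold to lists of coefficients.
record TranscendentalParameter : Set₁ where
  field K : CommutativeRing 0ℓ 0ℓ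
  open CommutativeRing K hiding (zero) public
  field
    0-or-unit        : ∀ x → x ≈ 0# ⊎ Σ[ y ∈ Carrier ] x * y ≈ 1#
    ι                : ℕ → Carrier
    ι-zero           : ι 0 ≈ 0#
    ι-suc            : ∀ k → ι (suc k) ≈ 1# + ι k
    r                : Carrier
    r-transcendental : ∀ {a b a′ b′} → ι a + r * ι b ≈ ι a′ + r * ι b′ → a ≡ a′ × b ≡ b′

-- A polynomial is determined by its values at the nodes

module Nodes (T : TranscendentalParameter) where
  open TranscendentalParameter T
  open import Algebra.Properties.Group +-group using () renaming (x∙y⁻¹≈ε⇒x≈y to x-y≈0⇒x≈y)
  open IntegerSolver K
  open Relabelling
  open Ranks
  open Polynomials K
  open Division K

  node : ∀ {n} → Vec ℕ n → Point n
  node μ i = ι (lookup μ i) + r * ι (corank μ i)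

  cancel-nonzero : ∀ {x y} → ¬ (x ≈ 0#) → x * y ≈ 0# → y ≈ 0#
  cancel-nonzero {x} {y} x≉0 xy≈0 with 0-or-unit x
  ... | inj₁ x≈0 = contradiction x≈0 x≉0
  ... | inj₂ (x⁻¹ , xx⁻¹≈1) = begin
    y  ≈⟨ sym (trans (*-congʳ xx⁻¹≈1) (*-identityˡ y)) ⟩
    (x * x⁻¹) * y  ≈⟨ solve 3 (λ x z y → (x :* z) :* y := (x :* y) :* z) refl x x⁻¹ y ⟩
    (x * y) * x⁻¹  ≈⟨ trans (*-congʳ xy≈0) (zeroˡ x⁻¹) ⟩
    0# ∎
    where open import Relation.Binary.Reasoning.Setoid setoid

  -- The r-parts of the two coordinates are coranks of different places, and the corank is
  -- injective.
  node-distinct : ∀ {n} (μ : Vec ℕ n) {i j} → i ≢ j → ¬ (node μ i - node μ j ≈ 0#)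
  node-distinct μ i≢j e = corank-injective μ i≢j (proj₂ (r-transcendental (x-y≈0⇒x≈y _ _ e)))

  -- Only nodes μ ≥ t are used, with equality outside the queue Q of live variables. Its head has the least
  -- lower bound in the order of Before, and raising that bound by one moves the variable to the back.
  module Queue {n : ℕ} where
    -- By `window`, live bounds differ by at most one, and a bound that is one higher belongs to a
    -- larger index. This keeps the queue sorted when its head is raised and moved to the back.
    record Admissible (t : Vec ℕ n) (Q : List (Fin n)) : Set where
      constructor admissible
      field
        sorted : AllPairs (λ p q → Before t q p) Q
        window : ∀ {p q} → p ∈ Q → q ∈ Q → lookup t q ℕ.< suc (lookup t p) ⊎ (lookup t q ≡ suc (lookup t p) × p Fin.< q)

    record Above (t : Vec ℕ n) (Q : List (Fin n)) (μ : Vec ℕ n) : Set where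
      constructor above
      field
        bound  : t ≤ᵛ μ
        frozen : ∀ {k} → k ∉ Q → lookup μ k ≡ lookup t k

    open Admissible
    open Above

    head∉tail : ∀ {t q Q} → Admissible t (q ∷ Q) → q ∉ Q
    head∉tail {t} (admissible (h ∷ _) _) q∈Q = before-irrefl t (All.lookup h q∈Q)

    drop-head : ∀ {t q Q} → Admissible t (q ∷ Q) → Admissible t Q
    drop-head (admissible (_ ∷ s) w) = admissible s λ p q → w (there p) (there q)

    AllPairs-map-∈ : ∀ {A : Set} {R S : A → A → Set} {xs} → (∀ {x y} → x ∈ xs → y ∈ xs → R x y → S x y) → AllPairs R xs → AllPairs S xs
    AllPairs-map-∈ h [] = []
    AllPairs-map-∈ h (px ∷ ps) = All.tabulate (λ y∈ → h (here ≡.refl) (there y∈) (All.lookup px y∈)) ∷ AllPairs-map-∈ (λ x y → h (there x) (there y)) ps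

    ∈-rotate : ∀ {q k : Fin n} {Q} → k ∈ Q ++ q ∷ [] → k ∈ q ∷ Q
    ∈-rotate {Q = Q} k∈ with ∈-++⁻ Q k∈
    ... | inj₁ k∈Q = there k∈Q
    ... | inj₂ (here ≡.refl) = here ≡.refl

    -- That the raised head may stand last is literally the old `window` between it and the others;
    -- the new `window` towards it is the old sortedness.
    raise-head : ∀ {t q Q} → Admissible t (q ∷ Q) → Admissible (t ⁺ q) (Q ++ q ∷ [])
    raise-head {t} {q} {Q} adm@(admissible (h ∷ s) w) = admissible
      (AllPairsP.++⁺ (AllPairs-map-∈ keep s) ([] ∷ []) (All.tabulate λ p∈Q → last-before p∈Q ∷ []))
      (λ p∈ q∈ → window′ (∈-rotate p∈) (∈-rotate q∈))
      where
      ∈⇒≢ : ∀ {p} → p ∈ Q → p ≢ q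
      ∈⇒≢ p∈Q ≡.refl = head∉tail adm p∈Q
      keep : ∀ {x y} → x ∈ Q → y ∈ Q → Before t y x → Before (t ⁺ q) y x
      keep x∈Q y∈Q b rewrite lookup-⁺-≢ t (∈⇒≢ x∈Q) | lookup-⁺-≢ t (∈⇒≢ y∈Q) = b
      last-before : ∀ {p} → p ∈ Q → Before (t ⁺ q) q p
      last-before p∈Q rewrite lookup-⁺-≢ t (∈⇒≢ p∈Q) | lookup-⁺-≡ t q = w (here ≡.refl) (there p∈Q)
      window′ : ∀ {p p′} → p ∈ q ∷ Q → p′ ∈ q ∷ Q
        → lookup (t ⁺ q) p′ ℕ.< suc (lookup (t ⁺ q) p) ⊎ (lookup (t ⁺ q) p′ ≡ suc (lookup (t ⁺ q) p) × p Fin.< p′)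
      window′ (here ≡.refl) (here ≡.refl) = inj₁ ℕP.≤-refl
      window′ (here ≡.refl) (there p′∈) rewrite lookup-⁺-≢ t (∈⇒≢ p′∈) | lookup-⁺-≡ t q with w (here ≡.refl) (there p′∈)
      ... | inj₁ l = inj₁ (ℕP.m≤n⇒m≤1+n l)
      ... | inj₂ (e , _) = inj₁ (s≤s (ℕP.≤-reflexive e))
      window′ (there p∈) (here ≡.refl) rewrite lookup-⁺-≢ t (∈⇒≢ p∈) | lookup-⁺-≡ t q with All.lookup h p∈
      ... | inj₁ l = inj₁ (s≤s l)
      ... | inj₂ (e , l) = inj₂ (≡.cong suc e , l)
      window′ (there p∈) (there p′∈) rewrite lookup-⁺-≢ t (∈⇒≢ p∈) | lookup-⁺-≢ t (∈⇒≢ p′∈) = w (there p∈) (there p′∈)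

    -- Hence the coordinate of the head is constant on the nodes where it takes its least value.
    head-corank : ∀ {t q Q μ} → Admissible t (q ∷ Q) → Above t (q ∷ Q) μ → lookup μ q ≡ lookup t q → corank μ q ≡ corank t q
    head-corank {t} {q} {Q} {μ} adm ab e = corank-cong μ t q to from
      where
      open import Data.List.Membership.DecPropositional (Fin._≟_ {n}) using (_∈?_)
      not-live : ∀ {k} → k ∈ Q → ∀ ν → t ≤ᵛ ν → lookup ν q ≡ lookup t q → ¬ Before ν q k
      not-live {k} k∈Q ν t≤ν e b = before-irrefl ν {k} (before-trans ν (later (All.lookup (AllPairs.head (sorted adm)) k∈Q)) b)
        where
        later : Before t k q → Before ν k q
        later (inj₁ l) = inj₁ (ℕP.≤-trans (ℕP.≤-reflexive (≡.cong suc e)) (ℕP.≤-trans l (t≤ν k)))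
        later (inj₂ (e′ , l)) with ℕP.m≤n⇒m<n∨m≡n (t≤ν k)
        ... | inj₁ t<ν = inj₁ (ℕP.≤-trans (ℕP.≤-reflexive (≡.cong suc (≡.trans e e′))) t<ν)
        ... | inj₂ t≡ν = inj₂ (≡.trans e (≡.trans e′ t≡ν) , l)
      frozen′ : ∀ {k} → k ∉ Q → lookup μ k ≡ lookup t k
      frozen′ {k} k∉Q with k Fin.≟ q
      ... | yes ≡.refl = e
      ... | no k≢q = frozen ab λ { (here k≡q) → k≢q k≡q ; (there k∈Q) → k∉Q k∈Q }
      to : ∀ k → Before μ q k → Before t q k
      to k b with k ∈? Q
      ... | yes k∈Q = contradiction b (not-live k∈Q μ (bound ab) e)
      ... | no k∉Q rewrite e | frozen′ k∉Q = b
      from : ∀ k → Before t q k → Before μ q k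
      from k b with k ∈? Q
      ... | yes k∈Q = contradiction b (not-live k∈Q t (λ _ → ℕP.≤-refl) ≡.refl)
      ... | no k∉Q rewrite e | frozen′ k∉Q = b

    Supported : List (Fin n) → Vec ℕ n → Set
    Supported Q e = ∀ {k} → k ∉ Q → lookup e k ≡ 0

    Below : ℕ → List (Fin n) → Vec ℕ n → Set
    Below d Q e = ∣ e ∣ ℕ.< d × Supported Q e

    vanishing-empty : ∀ {t} d p → All (Below d [] ∘ proj₂) p → (∀ μ → Above t [] μ → ∣ μ ∣ ℕ.< d ℕ.+ ∣ t ∣ → ev p (node μ) ≈ 0#) → p ~ []
    vanishing-empty zero [] _ _ φ = refl
    vanishing-empty zero (_ ∷ p) ((() , _) ∷ _)
    vanishing-empty {t} (suc d) p terms h φ = begin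
      lin φ p  ≈⟨ lin-cong p (All.map (λ {ce} → constant (proj₂ ce)) terms) ⟩
      lin (λ e → φ (replicate n 0) * mon (node t) e) p  ≈⟨ lin-* (φ (replicate n 0)) (mon (node t)) p ⟩
      φ (replicate n 0) * ev p (node t)  ≈⟨ *-congˡ (h t (above (λ _ → ℕP.≤-refl) (λ _ → ≡.refl)) (s≤s (ℕP.m≤n+m ∣ t ∣ d))) ⟩
      φ (replicate n 0) * 0#  ≈⟨ zeroʳ _ ⟩
      0# ∎
      where
      open import Relation.Binary.Reasoning.Setoid setoid
      constant : ∀ e → Below (suc d) [] e → φ e ≈ φ (replicate n 0) * mon (node t) e
      constant e (_ , supp) = trans (reflexive (≡.cong φ e≡0)) (sym (trans (*-congˡ (trans (reflexive (≡.cong (mon (node t)) e≡0)) (mon-0 (node t)))) (*-identityʳ _)))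
        where
        e≡0 : e ≡ replicate n 0
        e≡0 = vec-ext λ k → ≡.trans (supp λ ()) (≡.sym (VP.lookup-replicate k 0))

    -- Divide by x_q - c, with c the least value of the head coordinate. The remainder is free of
    -- x_q and agrees with `p` where μ_q is minimal, so it is zero by induction with q removed from
    -- the queue. Then the quotient vanishes where μ_q is larger, as the factor is invertible there,
    -- and induction applies with a raised bound and smaller `d`.
    vanishing : ∀ m Q → length Q ≡ m → ∀ d {t} → Admissible t Q → ∀ p → All (Below d Q ∘ proj₂) p
      → (∀ μ → Above t Q μ → ∣ μ ∣ ℕ.< d ℕ.+ ∣ t ∣ → ev p (node μ) ≈ 0#) → p ~ []
    vanishing zero [] _ d adm p terms h = vanishing-empty d p terms h
    vanishing (suc m) (q ∷ Q) len zero adm [] terms h φ = refl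
    vanishing (suc m) (q ∷ Q) len zero adm (_ ∷ p) ((() , _) ∷ _) h
    vanishing (suc m) (q ∷ Q) len (suc d) {t} adm p terms h φ = trans (division-combination q c p φ)
      (trans (+-cong (rem≈0 φ) (quot≈0 (times-linear q c φ))) (+-identityˡ 0#))
      where
      c = node t q

      at-level : ∀ {μ} → Above t (q ∷ Q) μ → lookup μ q ≡ lookup t q → node μ q - c ≈ 0#
      at-level {μ} ab e = trans (+-congʳ (reflexive (≡.cong₂ (λ a b → ι a + r * ι b) e (head-corank adm ab e)))) (-‿inverseʳ c)

      unfreeze : ∀ {μ} → Above t Q μ → Above t (q ∷ Q) μ
      unfreeze (above b f) = above b λ k∉ → f (k∉ ∘ there)

      rem≈0 : remainder q c p ~ []
      rem≈0 = vanishing m Q (ℕP.suc-injective len) (suc d) (drop-head adm) (remainder q c p)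
        (remainder-terms q c (λ {e} {e′} (l , supp) (a , b , z) → ℕP.≤-trans (s≤s a) l , support e e′ supp b z) terms)
        λ μ ab l → begin
          ev (remainder q c p) (node μ)  ≈⟨ sym (+-identityʳ _) ⟩
          ev (remainder q c p) (node μ) + 0#  ≈⟨ +-congˡ (sym (trans (*-congʳ (at-level (unfreeze ab) (frozen ab (head∉tail adm)))) (zeroˡ _))) ⟩
          ev (remainder q c p) (node μ) + (node μ q - c) * ev (quotient q c p) (node μ)  ≈⟨ sym (division-ev q c p (node μ)) ⟩
          ev p (node μ)  ≈⟨ h μ (unfreeze ab) l ⟩
          0# ∎
        where
        open import Relation.Binary.Reasoning.Setoid setoid
        support : ∀ e e′ → Supported (q ∷ Q) e → e′ ≤ᵛ e → lookup e′ q ≡ 0 → Supported Q e′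
        support e e′ supp b z {k} k∉Q with k Fin.≟ q
        ... | yes ≡.refl = z
        ... | no k≢q = ℕP.n≤0⇒n≡0 (ℕP.≤-trans (b k) (ℕP.≤-reflexive (supp λ { (here e) → k≢q e ; (there i) → k∉Q i })))

      quot≈0 : quotient q c p ~ []
      quot≈0 = vanishing (suc m) (Q ++ q ∷ []) (≡.trans (LP.length-++ Q) (≡.trans (ℕP.+-comm _ 1) len)) d (raise-head adm) (quotient q c p)
        (quotient-terms q c (λ {e} {e′} (l , supp) (a , b) → s≤s⁻¹ (ℕP.≤-trans (s≤s a) l) , λ {k} k∉ →
          ℕP.n≤0⇒n≡0 (ℕP.≤-trans (b k) (ℕP.≤-reflexive (supp (k∉ ∘ rotate-∈))))) terms)
        λ μ ab l → cancel-nonzero (raised ab) (begin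
          (node μ q - c) * ev (quotient q c p) (node μ)  ≈⟨ sym (+-identityˡ _) ⟩
          0# + (node μ q - c) * ev (quotient q c p) (node μ)  ≈⟨ +-congʳ (sym (rem≈0 (mon (node μ)))) ⟩
          ev (remainder q c p) (node μ) + (node μ q - c) * ev (quotient q c p) (node μ)  ≈⟨ sym (division-ev q c p (node μ)) ⟩
          -- Division lowers `d` by one and raising the bound of q adds one to |t|, so the range of
          -- degrees in which `p` is known to vanish is the same.
          ev p (node μ)  ≈⟨ h μ (lower ab) (ℕP.≤-trans l (ℕP.≤-reflexive (≡.trans (≡.cong (d ℕ.+_) (∣⁺∣ t q)) (ℕP.+-suc d ∣ t ∣)))) ⟩
          0# ∎)
        where
        open import Relation.Binary.Reasoning.Setoid setoid
        rotate-∈ : ∀ {k} → k ∈ q ∷ Q → k ∈ Q ++ q ∷ []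
        rotate-∈ (here e) = ∈-++⁺ʳ Q (here e)
        rotate-∈ (there i) = ∈-++⁺ˡ i
        lower : ∀ {μ} → Above (t ⁺ q) (Q ++ q ∷ []) μ → Above t (q ∷ Q) μ
        lower (above b f) = above (λ k → ℕP.≤-trans (≤ᵛ-⁺ t q k) (b k))
          λ k∉ → ≡.trans (f (k∉ ∘ ∈-rotate)) (lookup-⁺-≢ t (λ k≡q → k∉ (here k≡q)))
        raised : ∀ {μ} → Above (t ⁺ q) (Q ++ q ∷ []) μ → ¬ (node μ q - c ≈ 0#)
        raised {μ} ab e = ℕP.<-irrefl (≡.sym (proj₁ (r-transcendental (x-y≈0⇒x≈y _ _ e)))) (≡.subst (ℕ._≤ lookup μ q) (lookup-⁺-≡ t q) (bound ab q))

  -- All bounds start at 0, where ties are broken by the index; therefore the variables enter the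
  -- queue in reverse order.
  nodes-determine : ∀ {n} d (p : Comb (Vec ℕ n)) → Deg< d p → (∀ μ → ∣ μ ∣ ℕ.< d → ev p (node μ) ≈ 0#) → p ~ []
  nodes-determine {n} d p deg h = vanishing n (L.tabulate Fin.opposite) (LP.length-tabulate Fin.opposite) d {replicate n 0}
    (admissible (AllPairsP.tabulate⁺-< (λ {i} {j} i<j → inj₂ (zeros (Fin.opposite i) (Fin.opposite j) , antitone i<j)))
                (λ {p} {q} _ _ → inj₁ (s≤s (ℕP.≤-reflexive (zeros q p)))))
    p (All.map (λ l → l , λ {k} k∉ → contradiction (all-live k) k∉) deg)
    λ μ _ l → h μ (≡.subst (∣ μ ∣ ℕ.<_) (≡.trans (≡.cong (d ℕ.+_) (∣0∣ n)) (ℕP.+-identityʳ d)) l)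
    where
    open Queue
    zeros : ∀ (p q : Fin n) → lookup (replicate n 0) p ≡ lookup (replicate n 0) q
    zeros p q = ≡.trans (VP.lookup-replicate p 0) (≡.sym (VP.lookup-replicate q 0))
    antitone : ∀ {i j : Fin n} → i Fin.< j → Fin.opposite j Fin.< Fin.opposite i
    antitone {i} {j} i<j rewrite FinP.opposite-prop i | FinP.opposite-prop j = ℕP.∸-monoʳ-< (s≤s i<j) (FinP.toℕ<n j)
    all-live : ∀ k → k ∈ L.tabulate Fin.opposite
    all-live k = ≡.subst (_∈ L.tabulate Fin.opposite) (FinP.opposite-involutive k) (∈-tabulate⁺ (Fin.opposite k))

  zero-at-nodes⇒zero : ∀ {n d} {F : Point n → Carrier} → IsPoly d F → (∀ μ → ∣ μ ∣ ℕ.< d → F (node μ) ≈ 0#) → ∀ v → F v ≈ 0#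
  zero-at-nodes⇒zero (p , deg , e) h v = trans (e v) (nodes-determine _ p deg (λ μ l → trans (sym (e (node μ))) (h μ l)) (mon v))

-- The interpolation polynomials `e ζ`

module Interpolation (T : TranscendentalParameter) where
  open TranscendentalParameter T
  open import Algebra.Properties.Group +-group using () renaming (x∙y⁻¹≈ε⇒x≈y to x-y≈0⇒x≈y)
  open import Algebra.Properties.CommutativeMonoid.Sum *-commutativeMonoid using ()
    renaming (sum to prod; sum-cong-≋ to prod-cong; sum-permute to prod-permute)
  open import Algebra.Properties.Semiring.Exp semiring using (_^_; ^-cong)
  open import Relation.Binary.Reasoning.Setoid setoid
  open IntegerSolver K
  open Relabelling
  open Ranks
  open Polynomials K
  open Division K
  open Nodes T

  record Interpolates {n} (ζ : Vec ℕ n) (F : Point n → Carrier) : Set where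
    field
      lower  : IsPoly ∣ ζ ∣ (λ v → F v - mon v ζ)
      vanish : ∀ μ → ∣ μ ∣ ℕ.< ∣ ζ ∣ → F (node μ) ≈ 0#
  open Interpolates

  ev-cong : ∀ {n} (p : Comb (Vec ℕ n)) {v w} → (∀ i → v i ≈ w i) → ev p v ≈ ev p w
  ev-cong p h = lin-cong′ (mon-cong h) p

  module _ {n} {ζ : Vec ℕ n} {F : Point n → Carrier} (I : Interpolates ζ F) where
    expand : ∀ v → F v ≈ mon v ζ + ev (proj₁ (lower I)) v
    expand v = trans (solve 2 (λ x y → x := y :+ (x :- y)) refl (F v) (mon v ζ)) (+-congˡ (proj₂ (proj₂ (lower I)) v))

    interpolates-cong : ∀ {v w} → (∀ i → v i ≈ w i) → F v ≈ F w
    interpolates-cong {v} {w} h = trans (expand v) (trans (+-cong (mon-cong h ζ) (ev-cong (proj₁ (lower I)) h)) (sym (expand w)))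

    interpolates-poly : IsPoly (suc ∣ ζ ∣) F
    interpolates-poly = poly-resp (λ v → sym (expand v)) (poly-+ (poly-mon ζ ℕP.≤-refl) (poly-≤ (ℕP.n≤1+n _) (poly-ev (proj₁ (lower I)) (proj₁ (proj₂ (lower I))))))

  -- The top monomials cancel, and the difference, now of degree below |ζ|, vanishes at every node
  -- of degree below |ζ|.
  interpolates-unique : ∀ {n} {ζ : Vec ℕ n} {F G} → Interpolates ζ F → Interpolates ζ G → ∀ v → F v ≈ G v
  interpolates-unique {ζ = ζ} {F} {G} I J v = x-y≈0⇒x≈y _ _ (zero-at-nodes⇒zero
    (poly-resp (λ v → solve 3 (λ f g m → (f :- m) :+ :- (g :- m) := f :- g) refl (F v) (G v) (mon v ζ)) (poly-+ (lower I) (poly-neg (lower J))))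
    (λ μ l → trans (+-cong (vanish I μ l) (-‿cong (vanish J μ l))) (-‿inverseʳ 0#)) v)

  mon-relabel : ∀ {n} (π : Permutation n n) (v : Point n) ζ → mon v (relabel π none ζ) ≈ mon (v ∘ (π ⟨$⟩ˡ_)) ζ
  mon-relabel π v ζ = begin
    prod (λ p → v p ^ lookup (relabel π none ζ) p)  ≈⟨ prod-cong (λ p → ^-cong (reflexive (≡.cong v (≡.sym (Perm.inverseˡ π)))) (lookup-relabel π none ζ p)) ⟩
    prod (λ p → v (π ⟨$⟩ˡ (π ⟨$⟩ʳ p)) ^ lookup ζ (π ⟨$⟩ʳ p))  ≈⟨ sym (prod-permute (λ p → v (π ⟨$⟩ˡ p) ^ lookup ζ p) π) ⟩
    prod (λ p → v (π ⟨$⟩ˡ p) ^ lookup ζ p) ∎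

  module Swap {n} {i j : Fin n} (adj : toℕ j ≡ suc (toℕ i)) where
    j≢i : j ≢ i
    j≢i = adjacent-≢ adj

    s : Fin n → Fin n
    s = Perm.transpose i j ⟨$⟩ʳ_

    mon-swap : ∀ (v : Point n) ζ → mon v (swap i j ζ) ≈ mon (v ∘ s) ζ
    mon-swap v ζ = trans (mon-relabel (Perm.transpose i j) v ζ) (mon-cong (λ k → reflexive (≡.cong v (inverse≗s k))) ζ)
      where
      inverse≗s : ∀ k → Perm.transpose i j ⟨$⟩ˡ k ≡ s k
      inverse≗s k = ≡.trans (≡.cong (Perm.transpose i j ⟨$⟩ˡ_) (≡.sym (transpose-involutive j≢i k))) (Perm.inverseˡ (Perm.transpose i j))

    poly-swap : ∀ {d} {F : Point n → Carrier} → IsPoly d F → IsPoly d (λ v → F (v ∘ s))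
    poly-swap (p , b , e) = reindex (swap i j) p , AllP.map⁺ (All.map (λ {ce} → ≡.subst (ℕ._< _) (≡.sym (∣swap∣ i j (proj₂ ce)))) b)
      , λ v → trans (e (v ∘ s)) (sym (trans (lin-reindex (mon v) (swap i j) p) (lin-cong′ (mon-swap v) p)))

    DividedDifference : (d : ℕ) → (Point n → Carrier) → Set
    DividedDifference d F = Σ[ G ∈ (Point n → Carrier) ] IsPoly d G × (∀ v → (v i - v j) * G v ≈ F v - F (v ∘ s))

    -- The twisted Leibniz rule Δ(x_k f) = x_k Δf + Δ(x_k) s f, where Δ(x_k) is one of the constants
    -- 1, -1, 0.
    mon-difference : ∀ ζ → DividedDifference ∣ ζ ∣ (λ v → mon v ζ)
    mon-difference = ⁺-induction (λ ζ → DividedDifference ∣ ζ ∣ (λ v → mon v ζ))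
      ((λ v → 0#) , poly-0 , λ v → trans (zeroʳ _) (sym (trans (+-cong (mon-0 v) (-‿cong (mon-0 (v ∘ s)))) (-‿inverseʳ 1#)))) step
      where
      difference-of-variables : ∀ k → Σ[ c ∈ Carrier ] (∀ (v : Point n) → v k - v (s k) ≈ c * (v i - v j))
      difference-of-variables k with s k | transposeView j≢i k
      ... | _ | at-i = 1# , λ v → sym (*-identityˡ _)
      ... | _ | at-j = - 1# , λ v → solve 2 (λ x y → y :- x := :- con 1ℤ :* (x :- y)) refl (v i) (v j)
      ... | _ | else _ _ = 0# , λ v → trans (-‿inverseʳ _) (sym (zeroˡ _))
      step : ∀ ζ k → DividedDifference ∣ ζ ∣ (λ v → mon v ζ) → DividedDifference ∣ ζ ⁺ k ∣ (λ v → mon v (ζ ⁺ k))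
      step ζ k (G , P , e) = (λ v → v k * G v + c * mon v (swap i j ζ))
        , poly-cast (≡.sym (∣⁺∣ ζ k)) (poly-+ (poly-var k P) (poly-scale c (poly-mon (swap i j ζ) (s≤s (ℕP.≤-reflexive (∣swap∣ i j ζ))))))
        , λ v → begin
          (v i - v j) * (v k * G v + c * mon v (swap i j ζ))
            ≈⟨ solve 5 (λ a x g c m → a :* (x :* g :+ c :* m) := x :* (a :* g) :+ (c :* a) :* m) refl (v i - v j) (v k) (G v) c (mon v (swap i j ζ)) ⟩
          v k * ((v i - v j) * G v) + (c * (v i - v j)) * mon v (swap i j ζ)
            ≈⟨ +-cong (*-congˡ (e v)) (*-cong (sym (hc v)) (mon-swap v ζ)) ⟩
          v k * (mon v ζ - mon (v ∘ s) ζ) + (v k - v (s k)) * mon (v ∘ s) ζ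
            ≈⟨ solve 4 (λ x y a b → x :* (a :- b) :+ (x :- y) :* b := x :* a :- y :* b) refl (v k) (v (s k)) (mon v ζ) (mon (v ∘ s) ζ) ⟩
          v k * mon v ζ - v (s k) * mon (v ∘ s) ζ
            ≈⟨ sym (+-cong (mon-⁺ v ζ k) (-‿cong (mon-⁺ (v ∘ s) ζ k))) ⟩
          mon v (ζ ⁺ k) - mon (v ∘ s) (ζ ⁺ k) ∎
        where
        c = proj₁ (difference-of-variables k)
        hc = proj₂ (difference-of-variables k)

    ev-difference : ∀ {d} p → Deg< d p → DividedDifference d (ev p)
    ev-difference p b = (λ v → lin (λ e → proj₁ (mon-difference e) v) p)
      , poly-lin p (All.map (λ {ce} l → poly-≤ (ℕP.<⇒≤ l) (proj₁ (proj₂ (mon-difference (proj₂ ce))))) b)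
      , λ v → begin
        (v i - v j) * lin (λ e → proj₁ (mon-difference e) v) p  ≈⟨ lin-linear (v i - v j) 1# (- 1#) (λ e → trans (proj₂ (proj₂ (mon-difference e)) v)
                                                                     (solve 2 (λ x y → x :- y := con 1ℤ :* x :+ :- con 1ℤ :* y) refl (mon v e) (mon (v ∘ s) e))) p ⟩
        1# * ev p v + - 1# * ev p (v ∘ s)  ≈⟨ solve 2 (λ x y → con 1ℤ :* x :+ :- con 1ℤ :* y := x :- y) refl (ev p v) (ev p (v ∘ s)) ⟩
        ev p v - ev p (v ∘ s) ∎

    -- The operator σ f = s f + r (f − s f)/(x_i − x_j), characterised without division.
    σ-Related : (F G : Point n → Carrier) → Set
    σ-Related F G = ∀ v → (v i - v j) * G v ≈ (v i - v j - r) * F (v ∘ s) + r * F v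

    -- With G the divided difference of F, which has smaller degree, s F + r G has top monomial x^(s
    -- ζ). At a node with μ_i ≠ μ_j the swapped coordinates form the node of `swap i j μ`, where F
    -- vanishes; if μ_i = μ_j, the factor x_i - x_j - r is zero.
    interpolates-swap : ∀ {ζ F} → Interpolates ζ F → Σ[ G ∈ (Point n → Carrier) ] Interpolates (swap i j ζ) G × σ-Related F G
    interpolates-swap {ζ} {F} I = F′ , record { lower = lower′ ; vanish = vanish′ } , related
      where
      g = proj₁ (lower I)
      Dζ = mon-difference ζ
      Dg = ev-difference g (proj₁ (proj₂ (lower I)))
      G : Point n → Carrier
      G v = proj₁ Dζ v + proj₁ Dg v
      G-difference : ∀ v → (v i - v j) * G v ≈ F v - F (v ∘ s)
      G-difference v = begin
        (v i - v j) * G v  ≈⟨ distribˡ _ _ _ ⟩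
        (v i - v j) * proj₁ Dζ v + (v i - v j) * proj₁ Dg v  ≈⟨ +-cong (proj₂ (proj₂ Dζ) v) (proj₂ (proj₂ Dg) v) ⟩
        (mon v ζ - mon (v ∘ s) ζ) + (ev g v - ev g (v ∘ s))  ≈⟨ solve 4 (λ a b c d → (a :- b) :+ (c :- d) := (a :+ c) :- (b :+ d)) refl (mon v ζ) (mon (v ∘ s) ζ) (ev g v) (ev g (v ∘ s)) ⟩
        (mon v ζ + ev g v) - (mon (v ∘ s) ζ + ev g (v ∘ s))  ≈⟨ sym (+-cong (expand I v) (-‿cong (expand I (v ∘ s)))) ⟩
        F v - F (v ∘ s) ∎
      F′ : Point n → Carrier
      F′ v = F (v ∘ s) + r * G v
      related : σ-Related F F′
      related v = begin
        (v i - v j) * (F (v ∘ s) + r * G v)  ≈⟨ solve 4 (λ a x r g → a :* (x :+ r :* g) := a :* x :+ r :* (a :* g)) refl (v i - v j) (F (v ∘ s)) r (G v) ⟩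
        (v i - v j) * F (v ∘ s) + r * ((v i - v j) * G v)  ≈⟨ +-congˡ (*-congˡ (G-difference v)) ⟩
        (v i - v j) * F (v ∘ s) + r * (F v - F (v ∘ s))  ≈⟨ solve 4 (λ a x r y → a :* x :+ r :* (y :- x) := (a :- r) :* x :+ r :* y) refl (v i - v j) (F (v ∘ s)) r (F v) ⟩
        (v i - v j - r) * F (v ∘ s) + r * F v ∎
      lower′ : IsPoly ∣ swap i j ζ ∣ (λ v → F′ v - mon v (swap i j ζ))
      lower′ = poly-cast (≡.sym (∣swap∣ i j ζ)) (poly-resp
        (λ v → trans (solve 3 (λ x m y → (x :- m) :+ y := (x :+ y) :- m) refl (F (v ∘ s)) (mon (v ∘ s) ζ) (r * G v)) (+-congˡ (-‿cong (sym (mon-swap v ζ)))))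
        (poly-+ (poly-swap (lower I)) (poly-scale r (poly-+ (proj₁ (proj₂ Dζ)) (proj₁ (proj₂ Dg))))))
      vanish′ : ∀ μ → ∣ μ ∣ ℕ.< ∣ swap i j ζ ∣ → F′ (node μ) ≈ 0#
      vanish′ μ l = cancel-nonzero (node-distinct μ (j≢i ∘ ≡.sym)) (begin
        (node μ i - node μ j) * F′ (node μ)  ≈⟨ related (node μ) ⟩
        (node μ i - node μ j - r) * F (node μ ∘ s) + r * F (node μ)  ≈⟨ +-cong first (trans (*-congˡ (vanish I μ l′)) (zeroʳ r)) ⟩
        0# + 0#  ≈⟨ +-identityˡ 0# ⟩
        0# ∎)
        where
        l′ : ∣ μ ∣ ℕ.< ∣ ζ ∣
        l′ = ≡.subst (∣ μ ∣ ℕ.<_) (∣swap∣ i j ζ) l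
        first : (node μ i - node μ j - r) * F (node μ ∘ s) ≈ 0#
        first = cases (lookup μ i ℕ.≟ lookup μ j)
          where
          cases : Dec (lookup μ i ≡ lookup μ j) → (node μ i - node μ j - r) * F (node μ ∘ s) ≈ 0#
          cases (yes e) = trans (*-congʳ (begin
                node μ i - node μ j - r
                  ≈⟨ +-congʳ (+-congʳ (+-cong (reflexive (≡.cong ι e)) (*-congˡ (trans (reflexive (≡.cong ι (corank-adjacent μ adj e))) (ι-suc _))))) ⟩
                (ι (lookup μ j) + r * (1# + ι (corank μ j))) - node μ j - r
                  ≈⟨ solve 3 (λ a r b → ((a :+ r :* (con 1ℤ :+ b)) :- (a :+ r :* b)) :- r := con 0ℤ) refl (ι (lookup μ j)) r (ι (corank μ j)) ⟩
                0# ∎)) (zeroˡ _)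
          cases (no μᵢ≢μⱼ) = trans (*-congˡ (trans
                (interpolates-cong I λ p → reflexive (≡.cong₂ (λ a b → ι a + r * ι b) (≡.sym (lookup-swap i j μ p)) (≡.sym (corank-swap μ adj μᵢ≢μⱼ p))))
                (vanish I (swap i j μ) (≡.subst (ℕ._< ∣ ζ ∣) (≡.sym (∣swap∣ i j μ)) l′)))) (zeroʳ _)

  module _ {n : ℕ} where
    last : Fin (suc n)
    last = fromℕ n

    Φ-0 : Φ (replicate (suc n) 0) ≡ replicate (suc n) 0 ⁺ last
    Φ-0 = vec-ext λ p → at (view p)
      where
      at : ∀ {p} → View p → lookup (Φ (replicate (suc n) 0)) p ≡ lookup (replicate (suc n) 0 ⁺ last) p
      at ‵fromℕ = ≡.trans (lookup-Φ-last (replicate (suc n) 0)) (≡.sym (≡.trans (lookup-⁺-≡ (replicate (suc n) 0) last) (≡.cong suc (VP.lookup-replicate last 0))))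
      at (‵inject₁ k) = ≡.trans (lookup-Φ-inject₁ (replicate (suc n) 0) k) (≡.trans (VP.lookup-replicate k 0)
        (≡.sym (≡.trans (lookup-⁺-≢ (replicate (suc n) 0) (FinP.fromℕ≢inject₁ ∘ ≡.sym)) (VP.lookup-replicate (inject₁ k) 0))))

    Φ-⁺ : ∀ (ζ : Vec ℕ (suc n)) k → Φ (ζ ⁺ k) ≡ Φ ζ ⁺ rotate⁻ k
    Φ-⁺ ζ k = ≡.trans (≡.cong (λ p → Φ (ζ ⁺ p)) (≡.sym (Perm.inverseʳ rotation {k}))) (relabel-⁺ rotation atLast ζ (rotate⁻ k))

    rotatePoint-shift : ∀ k → Σ[ c ∈ Carrier ] (∀ (v : Point (suc n)) → rotatePoint v k ≈ v (rotate⁻ k) - c)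
    rotatePoint-shift zero = 1# , λ v → refl
    rotatePoint-shift (suc k) = 0# , λ v → solve 1 (λ x → x := x :- con 0ℤ) refl (v (inject₁ k))

    -- The substitution x_n - 1 alters only terms of lower degree; the bound says that what remains
    -- has degree below that of `Φ ζ`, up to |ζ|.
    mon-Φ : ∀ ζ → IsPoly (suc ∣ ζ ∣) (λ v → v last * mon (rotatePoint v) ζ - mon v (Φ ζ))
    mon-Φ = ⁺-induction (λ ζ → IsPoly (suc ∣ ζ ∣) (λ v → v last * mon (rotatePoint v) ζ - mon v (Φ ζ)))
      (poly-resp (λ v → sym (begin
        v last * mon (rotatePoint v) (replicate (suc n) 0) - mon v (Φ (replicate (suc n) 0))
          ≈⟨ +-cong (*-congˡ (mon-0 (rotatePoint v))) (-‿cong (trans (reflexive (≡.cong (mon v) Φ-0)) (trans (mon-⁺ v (replicate (suc n) 0) last) (*-congˡ (mon-0 v))))) ⟩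
        v last * 1# - v last * 1#  ≈⟨ -‿inverseʳ _ ⟩
        0# ∎)) poly-0)
      step
      where
      step : ∀ ζ k → IsPoly (suc ∣ ζ ∣) (λ v → v last * mon (rotatePoint v) ζ - mon v (Φ ζ))
        → IsPoly (suc ∣ ζ ⁺ k ∣) (λ v → v last * mon (rotatePoint v) (ζ ⁺ k) - mon v (Φ (ζ ⁺ k)))
      step ζ k P = poly-cast (≡.cong suc (≡.sym (∣⁺∣ ζ k))) (poly-resp (λ v → sym (begin
          v last * mon (rotatePoint v) (ζ ⁺ k) - mon v (Φ (ζ ⁺ k))
            ≈⟨ +-cong (*-congˡ (trans (mon-⁺ (rotatePoint v) ζ k) (*-congʳ (hc v)))) (-‿cong (trans (reflexive (≡.cong (mon v) (Φ-⁺ ζ k))) (mon-⁺ v (Φ ζ) (rotate⁻ k)))) ⟩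
          v last * ((v (rotate⁻ k) - c) * mon (rotatePoint v) ζ) - v (rotate⁻ k) * mon v (Φ ζ)
            ≈⟨ solve 5 (λ y x c m m′ → y :* ((x :- c) :* m) :- x :* m′ := x :* (y :* m :- m′) :+ :- c :* ((y :* m :- m′) :+ m′)) refl
                 (v last) (v (rotate⁻ k)) c (mon (rotatePoint v) ζ) (mon v (Φ ζ)) ⟩
          v (rotate⁻ k) * (v last * mon (rotatePoint v) ζ - mon v (Φ ζ)) + - c * ((v last * mon (rotatePoint v) ζ - mon v (Φ ζ)) + mon v (Φ ζ)) ∎))
        (poly-+ (poly-var (rotate⁻ k) P) (poly-scale (- c) (poly-+ (poly-≤ (ℕP.n≤1+n _) P) (poly-mon (Φ ζ) (s≤s (ℕP.≤-reflexive (∣Φ∣ ζ))))))))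
        where
        c = proj₁ (rotatePoint-shift k)
        hc = proj₂ (rotatePoint-shift k)

    -- If the last entry of μ is zero, the factor x_n vanishes. Otherwise μ = Φ μ⁻, and
    -- `rotatePoint` takes the node of μ to that of μ⁻, of degree one less.
    interpolates-Φ : ∀ {ζ F} → Interpolates ζ F → Interpolates (Φ ζ) (λ v → v last * F (rotatePoint v))
    interpolates-Φ {ζ} {F} I = record { lower = lower′ ; vanish = vanish′ }
      where
      g = proj₁ (lower I)
      lower′ : IsPoly ∣ Φ ζ ∣ (λ v → v last * F (rotatePoint v) - mon v (Φ ζ))
      lower′ = poly-cast (≡.sym (∣Φ∣ ζ)) (poly-resp
        (λ v → begin
          (v last * mon (rotatePoint v) ζ - mon v (Φ ζ)) + lin (λ e → v last * mon (rotatePoint v) e) g  ≈⟨ +-congˡ (lin-* (v last) (mon (rotatePoint v)) g) ⟩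
          (v last * mon (rotatePoint v) ζ - mon v (Φ ζ)) + v last * ev g (rotatePoint v)
            ≈⟨ solve 4 (λ y m m′ x → (y :* m :- m′) :+ y :* x := y :* (m :+ x) :- m′) refl (v last) (mon (rotatePoint v) ζ) (mon v (Φ ζ)) (ev g (rotatePoint v)) ⟩
          v last * (mon (rotatePoint v) ζ + ev g (rotatePoint v)) - mon v (Φ ζ)  ≈⟨ +-congʳ (*-congˡ (sym (expand I (rotatePoint v)))) ⟩
          v last * F (rotatePoint v) - mon v (Φ ζ) ∎)
        (poly-+ (mon-Φ ζ) (poly-lin g (All.map (λ {ce} l → term (proj₂ ce) l) (proj₁ (proj₂ (lower I)))))))
        where
        term : ∀ e → ∣ e ∣ ℕ.< ∣ ζ ∣ → IsPoly (suc ∣ ζ ∣) (λ v → v last * mon (rotatePoint v) e)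
        term e l = poly-resp (λ v → solve 2 (λ x y → (x :- y) :+ y := x) refl (v last * mon (rotatePoint v) e) (mon v (Φ e)))
          (poly-+ (poly-≤ (s≤s (ℕP.<⇒≤ l)) (mon-Φ e)) (poly-mon (Φ e) (s≤s (ℕP.≤-trans (ℕP.≤-reflexive (∣Φ∣ e)) l))))
      vanish′ : ∀ μ → ∣ μ ∣ ℕ.< ∣ Φ ζ ∣ → node μ last * F (rotatePoint (node μ)) ≈ 0#
      vanish′ μ l = cases (lookup μ last) ≡.refl
        where
        cases : ∀ m → lookup μ last ≡ m → node μ last * F (rotatePoint (node μ)) ≈ 0#
        cases zero eq = trans (*-congʳ (trans (+-cong (trans (reflexive (≡.cong ι eq)) ι-zero)
                           (trans (*-congˡ (trans (reflexive (≡.cong ι (corank-last-0 μ eq))) ι-zero)) (zeroʳ r))) (+-identityˡ 0#))) (zeroˡ _)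
        cases (suc m) eq = trans (*-congˡ (trans (interpolates-cong I at) (vanish I μ⁻ (s≤s⁻¹ (≡.subst₂ ℕ._<_ (≡.trans (≡.cong ∣_∣ (≡.sym Φμ⁻)) (∣Φ∣ μ⁻)) (∣Φ∣ ζ) l))))) (zeroʳ _)
          where
          μ⁻ = Φ⁻ μ
          Φμ⁻ : Φ μ⁻ ≡ μ
          Φμ⁻ = Φ∘Φ⁻ μ (≡.subst (0 ℕ.<_) (≡.sym eq) (s≤s z≤n))
          at : ∀ p → rotatePoint (node μ) p ≈ node μ⁻ p
          at zero = begin
            node μ last - 1#  ≈⟨ +-congʳ (reflexive (≡.cong (λ ν → node ν last) (≡.sym Φμ⁻))) ⟩
            (ι (lookup (Φ μ⁻) last) + r * ι (corank (Φ μ⁻) last)) - 1#  ≈⟨ +-congʳ (+-cong (trans (reflexive (≡.cong ι (lookup-Φ-last μ⁻))) (ι-suc _))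
                                                                                    (*-congˡ (reflexive (≡.cong ι (≡.trans (corank-Φ μ⁻ last) (≡.cong (corank μ⁻) (rotation-last n))))))) ⟩
            ((1# + ι (lookup μ⁻ zero)) + r * ι (corank μ⁻ zero)) - 1#  ≈⟨ solve 2 (λ a b → ((con 1ℤ :+ a) :+ b) :- con 1ℤ := a :+ b) refl (ι (lookup μ⁻ zero)) (r * ι (corank μ⁻ zero)) ⟩
            node μ⁻ zero ∎
          at (suc k) = begin
            node μ (inject₁ k)  ≈⟨ reflexive (≡.cong (λ ν → node ν (inject₁ k)) (≡.sym Φμ⁻)) ⟩
            ι (lookup (Φ μ⁻) (inject₁ k)) + r * ι (corank (Φ μ⁻) (inject₁ k))  ≈⟨ +-cong (reflexive (≡.cong ι (lookup-Φ-inject₁ μ⁻ k)))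
                                                                                    (*-congˡ (reflexive (≡.cong ι (≡.trans (corank-Φ μ⁻ (inject₁ k)) (≡.cong (corank μ⁻) (rotation-inject₁ k)))))) ⟩
            node μ⁻ (suc k) ∎

    interpolates-0 : Interpolates (replicate (suc n) 0) (λ v → 1#)
    interpolates-0 = record
      { lower = poly-resp (λ v → sym (trans (+-congˡ (-‿cong (mon-0 v))) (-‿inverseʳ 1#))) poly-0
      ; vanish = λ μ l → contradiction (≡.subst (∣ μ ∣ ℕ.<_) (∣0∣ n) l) ℕP.n≮0 }

    abstract
      -- Which swaps and rotations lead to ζ is hidden: the relations for `e` below come from
      -- uniqueness and not from this choice.
      interpolation : ∀ (ζ : Vec ℕ (suc n)) → Σ[ F ∈ (Point (suc n) → Carrier) ] Interpolates ζ F
      interpolation = swap-Φ-induction (λ ζ → Σ[ F ∈ (Point (suc n) → Carrier) ] Interpolates ζ F)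
        ((λ v → 1#) , interpolates-0)
        (λ i j adj ζ (F , I) → let (G , J , _) = Swap.interpolates-swap adj I in G , J)
        (λ ζ (F , I) → (λ v → v last * F (rotatePoint v)) , interpolates-Φ I)

    e : Vec ℕ (suc n) → Point (suc n) → Carrier
    e ζ = proj₁ (interpolation ζ)

    e-interpolates : ∀ ζ → Interpolates ζ (e ζ)
    e-interpolates ζ = proj₂ (interpolation ζ)

    e-0 : ∀ v → e (replicate (suc n) 0) v ≈ 1#
    e-0 = interpolates-unique (e-interpolates (replicate (suc n) 0)) interpolates-0

    e-Φ : ∀ ζ v → e (Φ ζ) v ≈ v last * e ζ (rotatePoint v)
    e-Φ ζ = interpolates-unique (e-interpolates (Φ ζ)) (interpolates-Φ (e-interpolates ζ))

    e-swap : ∀ {i j} (adj : toℕ j ≡ suc (toℕ i)) ζ → Swap.σ-Related adj (e ζ) (e (swap i j ζ))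
    e-swap {i} {j} adj ζ v = trans (*-congˡ (interpolates-unique (e-interpolates (swap i j ζ)) (proj₁ (proj₂ constructed)) v)) (proj₂ (proj₂ constructed) v)
      where constructed = Swap.interpolates-swap adj (e-interpolates ζ)

-- Cherednik operators and their commutation with the generators

module Cherednik (T : TranscendentalParameter) where
  open TranscendentalParameter T
  open import Algebra.Properties.CommutativeMonoid.Sum +-commutativeMonoid using (sum; sum-cong-≋; sum-permute; ∑-distrib-+; sum-replicate-zero)
  open import Relation.Binary.Reasoning.Setoid setoid
  open IntegerSolver K
  open import Algebra.Properties.Ring ring using (-1*x≈-x)
  open Relabelling
  open Ranks using (transpose-<; transpose-<⁻)
  open Polynomials K using (rotatePoint; Comb; lin; lin-++; lin-scale; lin-linear; scale)

  -- A telescoped quotient is a difference of two prefix sums whichever exponent is larger, so signs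
  -- need no case distinction.
  partial : (ℕ → Carrier) → ℕ → Carrier
  partial h zero    = 0#
  partial h (suc c) = partial h c + h c

  partial-cong : ∀ {h h′} N → (∀ c → c ℕ.< N → h c ≈ h′ c) → partial h N ≈ partial h′ N
  partial-cong zero e = refl
  partial-cong (suc N) e = +-cong (partial-cong N λ c l → e c (ℕP.m≤n⇒m≤1+n l)) (e N ℕP.≤-refl)

  partial-shift : ∀ h N → partial h (suc N) ≈ h 0 + partial (h ∘ suc) N
  partial-shift h zero = +-comm _ _
  partial-shift h (suc N) = trans (+-congʳ (partial-shift h N)) (+-assoc _ _ _)

  module _ {n : ℕ} where
    -- The monomials of degree ζ_k + ζ_j in x_k, x_j alone, indexed by the exponent of x_k.
    along : (Vec ℕ n → Carrier) → Fin n → Fin n → Vec ℕ n → ℕ → Carrier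
    along φ k j ζ c = φ (place k j ζ c (lookup ζ k ℕ.+ lookup ζ j ℕ.∸ c))

    -- (x_k x^ζ − s_kj x_k x^ζ)/(x_k − x_j) if k < j and x_k (x^ζ − s_kj x^ζ)/(x_k − x_j) otherwise, telescoped.
    exchange : (Vec ℕ n → Carrier) → Fin n → Fin n → Vec ℕ n → Carrier
    exchange φ k j ζ = partial (along φ k j ζ) (suc (lookup ζ k)) - partial (along φ k j ζ) (cutoff (does (k Fin.<? j)) (lookup ζ j))

    -- φ applied to the Cherednik operator ξ_k x^ζ, φ extended linearly from monomials.
    ξ : (Vec ℕ n → Carrier) → Fin n → Vec ℕ n → Carrier
    ξ φ k ζ = ι (lookup ζ k) * φ ζ + r * sum (λ j → exchange φ k j ζ)

    exchange-self : ∀ φ k ζ → exchange φ k k ζ ≈ 0#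
    exchange-self φ k ζ rewrite dec-false (k Fin.<? k) (ℕP.n≮n _) = -‿inverseʳ _

    -- A finite combination behind a functional yields both linearity in φ and, for φ = e at a
    -- point, polynomiality in the point.
    Representable : ((Vec ℕ n → Carrier) → Carrier) → Set
    Representable L = Σ[ p ∈ Comb (Vec ℕ n) ] (∀ φ → L φ ≈ lin φ p)

    rep-at : ∀ ζ → Representable (λ φ → φ ζ)
    rep-at ζ = (1# , ζ) ∷ [] , λ φ → sym (trans (+-identityʳ _) (*-identityˡ _))

    rep-0 : Representable (λ φ → 0#)
    rep-0 = [] , λ φ → refl

    rep-+ : ∀ {L M} → Representable L → Representable M → Representable (λ φ → L φ + M φ)
    rep-+ (p , e) (q , f) = p ++ q , λ φ → trans (+-cong (e φ) (f φ)) (sym (lin-++ φ p q))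

    rep-* : ∀ c {L} → Representable L → Representable (λ φ → c * L φ)
    rep-* c (p , e) = scale c p , λ φ → trans (*-congˡ (e φ)) (sym (lin-scale φ c p))

    rep-sum : ∀ {m} {L : Fin m → (Vec ℕ n → Carrier) → Carrier} → (∀ j → Representable (L j)) → Representable (λ φ → sum (λ j → L j φ))
    rep-sum {zero} R = rep-0
    rep-sum {suc m} R = rep-+ (R zero) (rep-sum (R ∘ suc))

    rep-partial : ∀ {h : (Vec ℕ n → Carrier) → ℕ → Carrier} → (∀ c → Representable (λ φ → h φ c)) → ∀ N → Representable (λ φ → partial (h φ) N)
    rep-partial R zero = rep-0
    rep-partial R (suc N) = rep-+ (rep-partial R N) (R N)

    rep-ξ : ∀ k ζ → Representable (λ φ → ξ φ k ζ)
    rep-ξ k ζ = rep-+ (rep-* (ι (lookup ζ k)) (rep-at ζ)) (rep-* r (rep-sum λ j →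
      let R = rep-partial (λ c → rep-at (place k j ζ c (lookup ζ k ℕ.+ lookup ζ j ℕ.∸ c)))
          (p , e) = rep-* (- 1#) (R (cutoff (does (k Fin.<? j)) (lookup ζ j)))
      in rep-+ (R (suc (lookup ζ k))) (p , λ φ → trans (sym (-1*x≈-x _)) (e φ))))

    ξ-linear : ∀ {φ φ₁ φ₂} a a₁ a₂ → (∀ η → a * φ η ≈ a₁ * φ₁ η + a₂ * φ₂ η) → ∀ k ζ → a * ξ φ k ζ ≈ a₁ * ξ φ₁ k ζ + a₂ * ξ φ₂ k ζ
    ξ-linear {φ} {φ₁} {φ₂} a a₁ a₂ h k ζ = begin
      a * ξ φ k ζ  ≈⟨ *-congˡ (e φ) ⟩
      a * lin φ p  ≈⟨ lin-linear a a₁ a₂ h p ⟩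
      a₁ * lin φ₁ p + a₂ * lin φ₂ p  ≈⟨ sym (+-cong (*-congˡ (e φ₁)) (*-congˡ (e φ₂))) ⟩
      a₁ * ξ φ₁ k ζ + a₂ * ξ φ₂ k ζ ∎
      where
      p = proj₁ (rep-ξ k ζ)
      e = proj₂ (rep-ξ k ζ)

    sum-δ : ∀ {m} (i : Fin m) x → sum (λ j → if does (j Fin.≟ i) then x else 0#) ≈ x
    sum-δ {suc m} zero x = trans (+-congˡ (sum-replicate-zero m)) (+-identityʳ x)
    sum-δ {suc m} (suc i) x = trans (+-identityˡ _) (sum-δ i x)

    sum-differ-at : ∀ {m} (f g : Fin m → Carrier) p₀ κ → f p₀ ≈ g p₀ + κ → (∀ p → p ≢ p₀ → f p ≈ g p) → sum f ≈ sum g + κ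
    sum-differ-at f g p₀ κ at off = begin
      sum f  ≈⟨ sum-cong-≋ pointwise ⟩
      sum (λ p → g p + (if does (p Fin.≟ p₀) then κ else 0#))  ≈⟨ ∑-distrib-+ g _ ⟩
      sum g + sum (λ p → if does (p Fin.≟ p₀) then κ else 0#)  ≈⟨ +-congˡ (sum-δ p₀ κ) ⟩
      sum g + κ ∎
      where
      pointwise : ∀ p → f p ≈ g p + (if does (p Fin.≟ p₀) then κ else 0#)
      pointwise p with p Fin.≟ p₀
      ... | yes ≡.refl = at
      ... | no p≢p₀ = trans (off p p≢p₀) (sym (+-identityʳ _))

    module Swapping {i j : Fin n} (adj : toℕ j ≡ suc (toℕ i)) where
      private
        j≢i = adjacent-≢ adj
        i<j : i Fin.< j
        i<j = ℕP.≤-reflexive (≡.sym adj)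
        s : Fin n → Fin n
        s = Perm.transpose i j ⟨$⟩ʳ_

      along-swap : ∀ φ {k p} ζ c → p ≢ k → along φ k p (swap i j ζ) c ≡ along (φ ∘ swap i j) (s k) (s p) ζ c
      along-swap φ {k} {p} ζ c p≢k = ≡.cong φ (≡.trans
        (≡.cong (place k p (swap i j ζ) c) (≡.cong (ℕ._∸ c) (≡.cong₂ ℕ._+_ (lookup-swap i j ζ k) (lookup-swap i j ζ p))))
        (≡.sym (relabel-place (Perm.transpose i j) none ζ c (lookup ζ (s k) ℕ.+ lookup ζ (s p) ℕ.∸ c) p≢k)))

      -- The boundary monomial by which the two kinds of quotient differ: for {k, p} = {i, j} it is
      -- x^ζ itself.
      along-swapped : ∀ φ {k p} ζ → p ≢ k → s k ≡ p → s p ≡ k → along φ k p (swap i j ζ) (lookup ζ k) ≡ φ ζ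
      along-swapped φ {k} {p} ζ p≢k sk≡p sp≡k = ≡.cong φ (≡.sym (place-unique p≢k ≡.refl
        (≡.sym (≡.trans (≡.cong (ℕ._∸ lookup ζ k) (≡.cong₂ ℕ._+_ (≡.trans (lookup-swap i j ζ k) (≡.cong (lookup ζ) sk≡p)) (≡.trans (lookup-swap i j ζ p) (≡.cong (lookup ζ) sp≡k))))
                 (ℕP.m+n∸n≡m (lookup ζ p) (lookup ζ k))))
        λ q q≢p q≢k → ≡.sym (≡.trans (lookup-swap i j ζ q) (≡.cong (lookup ζ) (fixed q≢p q≢k (transposeView j≢i k) (transposeView j≢i q))))))
        where
        fixed : ∀ {q k′ q′} → q ≢ p → q ≢ k → TransposeView i j k k′ → TransposeView i j q q′ → q′ ≡ q
        fixed q≢p q≢k _ (else _ _) = ≡.refl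
        fixed q≢p q≢k at-i at-i = contradiction ≡.refl q≢k
        fixed q≢p q≢k at-i at-j = contradiction (≡.trans (≡.sym (transpose-i i j)) sk≡p) q≢p
        fixed q≢p q≢k at-j at-i = contradiction (≡.trans (≡.sym (transpose-j j≢i)) sk≡p) q≢p
        fixed q≢p q≢k at-j at-j = contradiction ≡.refl q≢k
        fixed q≢p q≢k (else k≢i k≢j) _ = contradiction (≡.trans (≡.sym sk≡p) (transpose-else k≢i k≢j)) p≢k

      exchange-swap : ∀ φ {k p k′ p′} ζ → p ≢ k → s k ≡ k′ → s p ≡ p′ → exchange φ k p (swap i j ζ) ≈
        partial (along (φ ∘ swap i j) k′ p′ ζ) (suc (lookup ζ k′)) - partial (along (φ ∘ swap i j) k′ p′ ζ) (cutoff (does (k Fin.<? p)) (lookup ζ p′))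
      exchange-swap φ {k} {p} ζ p≢k ≡.refl ≡.refl = +-cong
        (trans (reflexive (≡.cong (partial (along φ k p (swap i j ζ)) ∘ suc) (lookup-swap i j ζ k))) (partial-cong (suc (lookup ζ (s k))) λ c _ → reflexive (along-swap φ ζ c p≢k)))
        (-‿cong (trans (reflexive (≡.cong (partial (along φ k p (swap i j ζ)) ∘ cutoff (does (k Fin.<? p))) (lookup-swap i j ζ p)))
          (partial-cong (cutoff (does (k Fin.<? p)) (lookup ζ (s p))) λ c _ → reflexive (along-swap φ ζ c p≢k))))

      -- For any pair other than i, j the swap respects the order of the two places, so the cutoffs
      -- agree.
      exchange-swap-other : ∀ φ k p ζ → ¬ (k ≡ i × p ≡ j) → ¬ (k ≡ j × p ≡ i) → exchange φ k p (swap i j ζ) ≈ exchange (φ ∘ swap i j) (s k) (s p) ζ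
      exchange-swap-other φ k p ζ ¬ij ¬ji with p Fin.≟ k
      ... | yes ≡.refl = trans (exchange-self φ k (swap i j ζ)) (sym (exchange-self (φ ∘ swap i j) (s k) ζ))
      ... | no p≢k = trans (exchange-swap φ ζ p≢k ≡.refl ≡.refl) (+-congˡ (-‿cong (reflexive (≡.cong
              (λ b → partial (along (φ ∘ swap i j) (s k) (s p) ζ) (cutoff b (lookup ζ (s p))))
              (does-⇔ (mk⇔ (transpose-< adj k p ¬ij) (transpose-<⁻ adj k p ¬ji)) (k Fin.<? p) (s k Fin.<? s p))))))

      along-swapped′ : ∀ φ {k p} ζ → p ≢ k → s k ≡ p → s p ≡ k → along (φ ∘ swap i j) p k ζ (lookup ζ k) ≡ φ ζ
      along-swapped′ φ {k} ζ p≢k ≡.refl sp≡k = ≡.trans (≡.cong (λ q → along (φ ∘ swap i j) (s k) q ζ (lookup ζ k)) (≡.sym sp≡k))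
        (≡.trans (≡.sym (along-swap φ ζ (lookup ζ k) p≢k)) (along-swapped φ ζ p≢k ≡.refl sp≡k))

      -- Swapping reverses the order of this pair, so the lower ends of the two intervals differ by
      -- one; the extra monomial is x^ζ.
      exchange-swap-ij : ∀ φ ζ → exchange φ i j (swap i j ζ) ≈ exchange (φ ∘ swap i j) j i ζ + φ ζ
      exchange-swap-ij φ ζ = begin
        exchange φ i j (swap i j ζ)  ≈⟨ exchange-swap φ ζ j≢i (transpose-i i j) (transpose-j j≢i) ⟩
        P (suc (lookup ζ j)) - P (cutoff (does (i Fin.<? j)) (lookup ζ i))  ≡⟨ ≡.cong (λ b → P (suc (lookup ζ j)) - P (cutoff b (lookup ζ i))) (dec-true (i Fin.<? j) i<j) ⟩
        P (suc (lookup ζ j)) - P (lookup ζ i)  ≈⟨ solve 3 (λ x y h → x :- y := (x :- (y :+ h)) :+ h) refl (P (suc (lookup ζ j))) (P (lookup ζ i)) (along (φ ∘ swap i j) j i ζ (lookup ζ i)) ⟩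
        (P (suc (lookup ζ j)) - P (suc (lookup ζ i))) + along (φ ∘ swap i j) j i ζ (lookup ζ i)
          ≈⟨ +-cong (reflexive (≡.cong (λ b → P (suc (lookup ζ j)) - P (cutoff b (lookup ζ i))) (≡.sym (dec-false (j Fin.<? i) (ℕP.<⇒≯ i<j)))))
                    (reflexive (along-swapped′ φ ζ j≢i (transpose-i i j) (transpose-j j≢i))) ⟩
        exchange (φ ∘ swap i j) j i ζ + φ ζ ∎
        where P = partial (along (φ ∘ swap i j) j i ζ)

      exchange-swap-ji : ∀ φ ζ → exchange φ j i (swap i j ζ) ≈ exchange (φ ∘ swap i j) i j ζ - φ ζ
      exchange-swap-ji φ ζ = begin
        exchange φ j i (swap i j ζ)  ≈⟨ exchange-swap φ ζ (j≢i ∘ ≡.sym) (transpose-j j≢i) (transpose-i i j) ⟩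
        P (suc (lookup ζ i)) - P (cutoff (does (j Fin.<? i)) (lookup ζ j))  ≡⟨ ≡.cong (λ b → P (suc (lookup ζ i)) - P (cutoff b (lookup ζ j))) (dec-false (j Fin.<? i) (ℕP.<⇒≯ i<j)) ⟩
        P (suc (lookup ζ i)) - P (suc (lookup ζ j))  ≈⟨ solve 3 (λ x y h → x :- (y :+ h) := (x :- y) :- h) refl (P (suc (lookup ζ i))) (P (lookup ζ j)) (along (φ ∘ swap i j) i j ζ (lookup ζ j)) ⟩
        (P (suc (lookup ζ i)) - P (lookup ζ j)) - along (φ ∘ swap i j) i j ζ (lookup ζ j)
          ≈⟨ +-cong (reflexive (≡.cong (λ b → P (suc (lookup ζ i)) - P (cutoff b (lookup ζ j))) (≡.sym (dec-true (i Fin.<? j) i<j))))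
                    (-‿cong (reflexive (along-swapped′ φ ζ (j≢i ∘ ≡.sym) (transpose-j j≢i) (transpose-i i j)))) ⟩
        exchange (φ ∘ swap i j) i j ζ - φ ζ ∎
        where P = partial (along (φ ∘ swap i j) i j ζ)

      ξ-swap-rule : ∀ φ k κ ζ → sum (λ p → exchange φ k p (swap i j ζ)) ≈ sum (λ p → exchange (φ ∘ swap i j) (s k) (s p) ζ) + κ
        → ξ φ k (swap i j ζ) ≈ ξ (φ ∘ swap i j) (s k) ζ + r * κ
      ξ-swap-rule φ k κ ζ h = begin
        ξ φ k (swap i j ζ)
          ≈⟨ +-cong (*-congʳ (reflexive (≡.cong ι (lookup-swap i j ζ k)))) (*-congˡ (trans h (+-congʳ (sym (sum-permute (λ p → exchange (φ ∘ swap i j) (s k) p ζ) (Perm.transpose i j)))))) ⟩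
        ι (lookup ζ (s k)) * φ (swap i j ζ) + r * (sum (λ p → exchange (φ ∘ swap i j) (s k) p ζ) + κ)
          ≈⟨ solve 4 (λ a r b c → a :+ r :* (b :+ c) := (a :+ r :* b) :+ r :* c) refl (ι (lookup ζ (s k)) * φ (swap i j ζ)) r (sum (λ p → exchange (φ ∘ swap i j) (s k) p ζ)) κ ⟩
        ξ (φ ∘ swap i j) (s k) ζ + r * κ ∎

      -- The same κ in `rule` and `κ-spec` expresses that ξ_k and multiplication by x_k commute with
      -- the swap up to matching corrections.
      record ξ-SwapRule (k : Fin n) : Set where
        field
          κ      : Carrier
          rule   : ∀ φ ζ → ξ φ k (swap i j ζ) ≈ ξ (φ ∘ swap i j) (s k) ζ + r * (κ * φ ζ)
          κ-spec : ∀ (x : Fin n → Carrier) → x k - x (s k) ≈ κ * (x i - x j)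

      ξ-swap : ∀ k → ξ-SwapRule k
      ξ-swap k = cases k (k Fin.≟ i) (k Fin.≟ j)
        where
        cases : ∀ k → Dec (k ≡ i) → Dec (k ≡ j) → ξ-SwapRule k
        cases .i (yes ≡.refl) _ = record
          { κ = 1#
          ; rule = λ φ ζ → ξ-swap-rule φ i (1# * φ ζ) ζ (sum-differ-at _ (λ p → exchange (φ ∘ swap i j) (s i) (s p) ζ) j (1# * φ ζ)
              (trans (exchange-swap-ij φ ζ) (+-cong (reflexive (≡.cong₂ (λ k p → exchange (φ ∘ swap i j) k p ζ) (≡.sym (transpose-i i j)) (≡.sym (transpose-j j≢i)))) (sym (*-identityˡ _))))
              (λ p p≢j → exchange-swap-other φ i p ζ (p≢j ∘ proj₂) (j≢i ∘ ≡.sym ∘ proj₁)))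
          ; κ-spec = λ x → trans (+-congˡ (-‿cong (reflexive (≡.cong x (transpose-i i j))))) (sym (*-identityˡ _)) }
        cases .j (no _) (yes ≡.refl) = record
          { κ = - 1#
          ; rule = λ φ ζ → ξ-swap-rule φ j (- 1# * φ ζ) ζ (sum-differ-at _ (λ p → exchange (φ ∘ swap i j) (s j) (s p) ζ) i (- 1# * φ ζ)
              (trans (exchange-swap-ji φ ζ) (+-cong (reflexive (≡.cong₂ (λ k p → exchange (φ ∘ swap i j) k p ζ) (≡.sym (transpose-j j≢i)) (≡.sym (transpose-i i j)))) (sym (-1*x≈-x _))))
              (λ p p≢i → exchange-swap-other φ j p ζ (j≢i ∘ proj₁) (p≢i ∘ proj₂)))
          ; κ-spec = λ x → trans (+-congˡ (-‿cong (reflexive (≡.cong x (transpose-j j≢i))))) (solve 2 (λ x y → y :- x := :- con 1ℤ :* (x :- y)) refl (x i) (x j)) }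
        cases k (no k≢i) (no k≢j) = record
          { κ = 0#
          ; rule = λ φ ζ → ξ-swap-rule φ k (0# * φ ζ) ζ (trans (sum-cong-≋ λ p → exchange-swap-other φ k p ζ (k≢i ∘ proj₁) (k≢j ∘ proj₁))
              (sym (trans (+-congˡ (zeroˡ (φ ζ))) (+-identityʳ _))))
          ; κ-spec = λ x → trans (+-congˡ (-‿cong (reflexive (≡.cong x (transpose-else k≢i k≢j))))) (trans (-‿inverseʳ (x k)) (sym (zeroˡ (x i - x j)))) }

  module _ {n : ℕ} where
    private
      ρ : Fin (suc n) → Fin (suc n)
      ρ = rotation ⟨$⟩ʳ_

    -- Records, for distinct places k and j, the units that `Φ` adds at each and whether k < j
    -- before and after rotation.
    data RotationCase : ℕ → ℕ → Bool → Bool → Set where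
      neither : ∀ {b} → RotationCase 0 0 b b
      j-last  : RotationCase 0 1 true false
      k-last  : RotationCase 1 0 false true

    rotationCase : ∀ {k p} → View k → View p → p ≢ k → RotationCase (atLast k) (atLast p) (does (k Fin.<? p)) (does (ρ k Fin.<? ρ p))
    rotationCase ‵fromℕ ‵fromℕ p≢k = contradiction ≡.refl p≢k
    rotationCase (‵inject₁ k) (‵inject₁ p) p≢k rewrite atLast-inject₁ k | atLast-inject₁ p | rotation-inject₁ k | rotation-inject₁ p
      | FinP.toℕ-inject₁ k | FinP.toℕ-inject₁ p = neither
    rotationCase (‵inject₁ k) ‵fromℕ p≢k rewrite atLast-inject₁ k | atLast-last n | rotation-inject₁ k | rotation-last n
      | dec-true (inject₁ k Fin.<? fromℕ n) (≡.subst₂ ℕ._<_ (≡.sym (FinP.toℕ-inject₁ k)) (≡.sym (FinP.toℕ-fromℕ n)) (FinP.toℕ<n k)) = j-last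
    rotationCase ‵fromℕ (‵inject₁ p) p≢k rewrite atLast-inject₁ p | atLast-last n | rotation-inject₁ p | rotation-last n
      | dec-false (fromℕ n Fin.<? inject₁ p) (ℕP.≤⇒≯ (FinP.≤fromℕ (inject₁ p))) = k-last

    -- The unit added by `Φ` and the reversed order compensate each other in the cutoff: a unit at j
    -- leaves the interval alone, a unit at k shifts it by one.
    rotate-partial : ∀ (G : ℕ → ℕ → Carrier) a b {α β t t′} → RotationCase α β t t′
      → partial (λ c → G c (α ℕ.+ a ℕ.+ (β ℕ.+ b) ℕ.∸ c)) (suc (α ℕ.+ a)) - partial (λ c → G c (α ℕ.+ a ℕ.+ (β ℕ.+ b) ℕ.∸ c)) (cutoff t (β ℕ.+ b))
      ≈ partial (λ c → G (α ℕ.+ c) (β ℕ.+ (a ℕ.+ b ℕ.∸ c))) (suc a) - partial (λ c → G (α ℕ.+ c) (β ℕ.+ (a ℕ.+ b ℕ.∸ c))) (cutoff t′ b)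
    rotate-partial G a b neither = refl
    rotate-partial G a b j-last = +-cong (shift-j (suc a) (λ c l → ℕP.≤-trans (s≤s⁻¹ l) (ℕP.m≤m+n a b))) (-‿cong (shift-j (suc b) (λ c l → ℕP.≤-trans (s≤s⁻¹ l) (ℕP.m≤n+m b a))))
      where
      shift-j : ∀ N → (∀ c → c ℕ.< N → c ℕ.≤ a ℕ.+ b) → partial (λ c → G c (a ℕ.+ suc b ℕ.∸ c)) N ≈ partial (λ c → G c (suc (a ℕ.+ b ℕ.∸ c))) N
      shift-j N bound = partial-cong N λ c l → reflexive (≡.cong (G c) (≡.trans (≡.cong (ℕ._∸ c) (ℕP.+-suc a b)) (ℕP.+-∸-assoc 1 (bound c l))))
    rotate-partial G a b k-last = trans (+-cong (partial-shift L (suc a)) (-‿cong (partial-shift L b)))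
      (solve 3 (λ h x y → (h :+ x) :- (h :+ y) := x :- y) refl (L 0) (partial (L ∘ suc) (suc a)) (partial (L ∘ suc) b))
      where
      L : ℕ → Carrier
      L c = G c (suc a ℕ.+ b ℕ.∸ c)

    exchange-Φ : ∀ φ k p (ζ : Vec ℕ (suc n)) → exchange φ k p (Φ ζ) ≈ exchange (φ ∘ Φ) (ρ k) (ρ p) ζ
    exchange-Φ φ k p ζ = cases (p Fin.≟ k)
      where
      cases : Dec (p ≡ k) → exchange φ k p (Φ ζ) ≈ exchange (φ ∘ Φ) (ρ k) (ρ p) ζ
      cases (yes ≡.refl) = trans (exchange-self φ k (Φ ζ)) (sym (exchange-self (φ ∘ Φ) (ρ k) ζ))
      cases (no p≢k) = begin
        exchange φ k p (Φ ζ)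
          ≡⟨ ≡.cong₂ (λ x y → partial (λ c → G c (x ℕ.+ y ℕ.∸ c)) (suc x) - partial (λ c → G c (x ℕ.+ y ℕ.∸ c)) (cutoff (does (k Fin.<? p)) y))
               (lookup-relabel rotation atLast ζ k) (lookup-relabel rotation atLast ζ p) ⟩
        _ ≈⟨ rotate-partial G (lookup ζ (ρ k)) (lookup ζ (ρ p)) (rotationCase (view k) (view p) p≢k) ⟩
        _ ≈⟨ +-cong (unrotate (suc (lookup ζ (ρ k)))) (-‿cong (unrotate (cutoff (does (ρ k Fin.<? ρ p)) (lookup ζ (ρ p))))) ⟩
        exchange (φ ∘ Φ) (ρ k) (ρ p) ζ ∎
        where
        G : ℕ → ℕ → Carrier
        G x y = φ (place k p (Φ ζ) x y)
        unrotate : ∀ N → partial (λ c → G (atLast k ℕ.+ c) (atLast p ℕ.+ (lookup ζ (ρ k) ℕ.+ lookup ζ (ρ p) ℕ.∸ c))) N ≈ partial (along (φ ∘ Φ) (ρ k) (ρ p) ζ) N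
        unrotate N = partial-cong N λ c _ → reflexive (≡.cong φ (≡.sym (relabel-place rotation atLast ζ c _ p≢k)))

    -- Again one κ for both: at the last place it is 1, which comes from the added unit in ξ and
    -- from the shift x_n - 1 in the variable.
    record ξ-ΦRule (k : Fin (suc n)) : Set where
      field
        κ      : Carrier
        rule   : ∀ φ ζ → ξ φ k (Φ ζ) ≈ ξ (φ ∘ Φ) (ρ k) ζ + κ * φ (Φ ζ)
        κ-spec : ∀ (x : Fin (suc n) → Carrier) → x k ≈ rotatePoint x (ρ k) + κ

    ξ-Φ : ∀ k → ξ-ΦRule k
    ξ-Φ k = cases (view k)
      where
      sum-exchange : ∀ φ k ζ → sum (λ p → exchange φ k p (Φ ζ)) ≈ sum (λ p → exchange (φ ∘ Φ) (ρ k) p ζ)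
      sum-exchange φ k ζ = trans (sum-cong-≋ λ p → exchange-Φ φ k p ζ) (sym (sum-permute (λ p → exchange (φ ∘ Φ) (ρ k) p ζ) rotation))
      cases : ∀ {k} → View k → ξ-ΦRule k
      cases ‵fromℕ = record
        { κ = 1#
        ; rule = λ φ ζ → trans (+-cong (*-congʳ (trans (reflexive (≡.cong ι (≡.trans (lookup-Φ-last ζ) (≡.cong (suc ∘ lookup ζ) (≡.sym (rotation-last n)))))) (ι-suc _))) (*-congˡ (sum-exchange φ (fromℕ n) ζ)))
            (solve 3 (λ a x y → (con 1ℤ :+ a) :* x :+ y := (a :* x :+ y) :+ con 1ℤ :* x) refl (ι (lookup ζ (ρ (fromℕ n)))) (φ (Φ ζ)) (r * sum (λ p → exchange (φ ∘ Φ) (ρ (fromℕ n)) p ζ)))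
        ; κ-spec = λ x → trans (solve 1 (λ x → x := (x :- con 1ℤ) :+ con 1ℤ) refl (x (fromℕ n))) (+-congʳ (reflexive (≡.cong (rotatePoint x) (≡.sym (rotation-last n))))) }
      cases (‵inject₁ k) = record
        { κ = 0#
        ; rule = λ φ ζ → trans (+-cong (*-congʳ (reflexive (≡.cong ι (≡.trans (lookup-Φ-inject₁ ζ k) (≡.cong (lookup ζ) (≡.sym (rotation-inject₁ k))))))) (*-congˡ (sum-exchange φ (inject₁ k) ζ)))
            (sym (trans (+-congˡ (zeroˡ (φ (Φ ζ)))) (+-identityʳ _)))
        ; κ-spec = λ x → trans (reflexive (≡.cong (rotatePoint x) (≡.sym (rotation-inject₁ k)))) (sym (+-identityʳ _)) }

-- Multiplication of `e ζ` by a variable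

module Raising (T : TranscendentalParameter) where
  open TranscendentalParameter T
  open import Algebra.Properties.Group +-group using () renaming (x∙y⁻¹≈ε⇒x≈y to x-y≈0⇒x≈y)
  open import Algebra.Properties.CommutativeMonoid.Sum +-commutativeMonoid using (sum-cong-≋; sum-replicate-zero)
  open import Relation.Binary.Reasoning.Setoid setoid
  open IntegerSolver K
  open Relabelling
  open Polynomials K
  open Nodes T
  open Interpolation T
  open Cherednik T

  -- Any degree bound will do here, since the identity is verified at the nodes of all degrees.
  IsPolynomial : ∀ {n} → (Point n → Carrier) → Set
  IsPolynomial F = Σ[ d ∈ ℕ ] IsPoly d F

  polynomial-+ : ∀ {n} {F G : Point n → Carrier} → IsPolynomial F → IsPolynomial G → IsPolynomial (λ v → F v + G v)
  polynomial-+ (d , P) (d′ , Q) = d ℕ.+ d′ , poly-+ (poly-≤ (ℕP.m≤m+n d d′) P) (poly-≤ (ℕP.m≤n+m d′ d) Q)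

  polynomial-lin : ∀ {n} {A : Set} {F : A → Point n → Carrier} → (∀ a → IsPolynomial (F a)) → ∀ p → IsPolynomial (λ v → lin (λ a → F a v) p)
  polynomial-lin h [] = 0 , poly-0
  polynomial-lin h ((c , a) ∷ p) = polynomial-+ (proj₁ (h a) , poly-scale c (proj₂ (h a))) (polynomial-lin h p)

  module _ {n : ℕ} where
    eAt : Point (suc n) → Vec ℕ (suc n) → Carrier
    eAt v ζ = e ζ v

    raised : Fin (suc n) → Vec ℕ (suc n) → Point (suc n) → Carrier
    raised k ζ v = e (ζ ⁺ k) v + ξ (eAt v) k ζ

    RaisedBy : Fin (suc n) → Vec ℕ (suc n) → Set
    RaisedBy k ζ = ∀ v → v k * e ζ v ≈ raised k ζ v

    e-polynomial : ∀ (ζ : Vec ℕ (suc n)) → IsPolynomial (e ζ)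
    e-polynomial ζ = suc ∣ ζ ∣ , interpolates-poly (e-interpolates ζ)

    defect-polynomial : ∀ k ζ → IsPolynomial (λ v → v k * e ζ v - raised k ζ v)
    defect-polynomial k ζ = polynomial-+ {F = λ v → v k * e ζ v} {G = λ v → - raised k ζ v}
      (suc (suc ∣ ζ ∣) , poly-var k {F = e ζ} (interpolates-poly (e-interpolates ζ)))
      (proj₁ raised-polynomial , poly-neg {F = raised k ζ} (proj₂ raised-polynomial))
      where
      ξ-polynomial : IsPolynomial (λ v → ξ (eAt v) k ζ)
      ξ-polynomial = let (d , P) = polynomial-lin {n = suc n} {F = e} e-polynomial (proj₁ (rep-ξ k ζ)) in
        d , poly-resp {F = λ v → lin (eAt v) (proj₁ (rep-ξ k ζ))} {G = λ v → ξ (eAt v) k ζ} (λ v → sym (proj₂ (rep-ξ k ζ) (eAt v))) P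
      raised-polynomial : IsPolynomial (raised k ζ)
      raised-polynomial = polynomial-+ {F = e (ζ ⁺ k)} {G = λ v → ξ (eAt v) k ζ} (e-polynomial (ζ ⁺ k)) ξ-polynomial

    -- Multiplied by A = x_i - x_j, every `e (swap i j η)` becomes (A - r) s e_η + r e_η. As the
    -- corrections in `ξ-SwapRule` match, the defect becomes a combination of the defects for ζ at
    -- the swapped point and at the point itself, both zero. The factor A is then cancelled at the
    -- nodes.
    raised-swap : ∀ {i j} → toℕ j ≡ suc (toℕ i) → ∀ k ζ → RaisedBy (Perm.transpose i j ⟨$⟩ʳ k) ζ → RaisedBy k (swap i j ζ)
    raised-swap {i} {j} adj k ζ h v = x-y≈0⇒x≈y _ _ (zero-at-nodes⇒zero {F = λ v → v k * e (swap i j ζ) v - raised k (swap i j ζ) v} (proj₂ (defect-polynomial k (swap i j ζ)))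
      (λ μ _ → cancel-nonzero (node-distinct μ (adjacent-≢ adj ∘ ≡.sym)) (at (node μ))) v)
      where
      open Swapping adj
      open ξ-SwapRule (ξ-swap k)
      s = Perm.transpose i j ⟨$⟩ʳ_
      at : ∀ x → (x i - x j) * (x k * e (swap i j ζ) x - raised k (swap i j ζ) x) ≈ 0#
      at x = begin
        A * (x k * e (swap i j ζ) x - raised k (swap i j ζ) x)
          ≈⟨ *-congˡ (+-congˡ (-‿cong (+-cong (reflexive (≡.cong (eAt x) (≡.sym (relabel-⁺ (Perm.transpose i j) none ζ k)))) (rule (eAt x) ζ)))) ⟩
        A * (x k * ψ ζ - (ψ (ζ ⁺ s k) + (ξ ψ (s k) ζ + r * (κ * e ζ x))))
          ≈⟨ solve 8 (λ a xk p q z r κ y → a :* (xk :* p :- (q :+ (z :+ r :* (κ :* y)))) := (xk :* (a :* p) :- (a :* q :+ a :* z)) :- (κ :* a) :* (r :* y))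
               refl A (x k) (ψ ζ) (ψ (ζ ⁺ s k)) (ξ ψ (s k) ζ) r κ (e ζ x) ⟩
        (x k * (A * ψ ζ) - (A * ψ (ζ ⁺ s k) + A * ξ ψ (s k) ζ)) - (κ * A) * (r * e ζ x)
          ≈⟨ +-cong (+-cong (*-congˡ (σ ζ)) (-‿cong (+-cong (σ (ζ ⁺ s k)) (ξ-linear A (A - r) r σ (s k) ζ)))) (-‿cong (*-congʳ (sym (κ-spec x)))) ⟩
        (x k * ((A - r) * e ζ u + r * e ζ x) - (((A - r) * e (ζ ⁺ s k) u + r * e (ζ ⁺ s k) x) + ((A - r) * ξ (eAt u) (s k) ζ + r * ξ (eAt x) (s k) ζ))) - (x k - x (s k)) * (r * e ζ x)
          ≈⟨ solve 10 (λ xk b r eu ex fu fx gu gx xs →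
               (xk :* (b :* eu :+ r :* ex) :- ((b :* fu :+ r :* fx) :+ (b :* gu :+ r :* gx))) :- (xk :- xs) :* (r :* ex)
               := b :* (xk :* eu :- (fu :+ gu)) :+ r :* (xs :* ex :- (fx :+ gx)))
               refl (x k) (A - r) r (e ζ u) (e ζ x) (e (ζ ⁺ s k) u) (e (ζ ⁺ s k) x) (ξ (eAt u) (s k) ζ) (ξ (eAt x) (s k) ζ) (x (s k)) ⟩
        (A - r) * (x k * e ζ u - raised (s k) ζ u) + r * (x (s k) * e ζ x - raised (s k) ζ x)
          ≈⟨ +-cong (*-congˡ (trans (+-congʳ (trans (*-congʳ (reflexive (≡.cong x (≡.sym (transpose-involutive (adjacent-≢ adj) k))))) (h u))) (-‿inverseʳ _)))
                    (*-congˡ (trans (+-congʳ (h x)) (-‿inverseʳ _))) ⟩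
        (A - r) * 0# + r * 0#  ≈⟨ trans (+-cong (zeroʳ _) (zeroʳ _)) (+-identityˡ 0#) ⟩
        0# ∎
        where
        A = x i - x j
        u = x ∘ s
        ψ : Vec ℕ (suc n) → Carrier
        ψ η = e (swap i j η) x
        σ : ∀ η → A * ψ η ≈ (A - r) * e η u + r * e η x
        σ η = e-swap adj η x

    -- `e-Φ` has no denominator, so the identity at ζ and the rotated point is multiplied by x_n
    -- directly.
    raised-Φ : ∀ k ζ → RaisedBy (rotation ⟨$⟩ʳ k) ζ → RaisedBy k (Φ ζ)
    raised-Φ k ζ h x = sym (begin
      e (Φ ζ ⁺ k) x + ξ (eAt x) k (Φ ζ)
        ≈⟨ +-cong (reflexive (≡.cong (eAt x) (≡.sym (relabel-⁺ rotation atLast ζ k)))) (rule (eAt x) ζ) ⟩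
      e (Φ (ζ ⁺ k′)) x + (ξ (eAt x ∘ Φ) k′ ζ + κ * e (Φ ζ) x)
        ≈⟨ +-cong (e-Φ (ζ ⁺ k′) x) (+-cong ξ-pulled (*-congˡ (e-Φ ζ x))) ⟩
      x (last {n}) * e (ζ ⁺ k′) v + (x (last {n}) * ξ (eAt v) k′ ζ + κ * (x (last {n}) * e ζ v))
        ≈⟨ solve 5 (λ y a b κ c → y :* a :+ (y :* b :+ κ :* (y :* c)) := y :* ((a :+ b) :+ κ :* c)) refl (x (last {n})) (e (ζ ⁺ k′) v) (ξ (eAt v) k′ ζ) κ (e ζ v) ⟩
      x (last {n}) * (raised k′ ζ v + κ * e ζ v)
        ≈⟨ *-congˡ (+-congʳ (sym (h v))) ⟩
      x (last {n}) * (v k′ * e ζ v + κ * e ζ v)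
        ≈⟨ solve 4 (λ y a κ c → y :* (a :* c :+ κ :* c) := (a :+ κ) :* (y :* c)) refl (x (last {n})) (v k′) κ (e ζ v) ⟩
      (v k′ + κ) * (x (last {n}) * e ζ v)
        ≈⟨ *-cong (sym (κ-spec x)) (sym (e-Φ ζ x)) ⟩
      x k * e (Φ ζ) x ∎)
      where
      open ξ-ΦRule (ξ-Φ k)
      k′ = rotation ⟨$⟩ʳ k
      v = rotatePoint x
      ξ-pulled : ξ (eAt x ∘ Φ) k′ ζ ≈ x (last {n}) * ξ (eAt v) k′ ζ
      ξ-pulled = trans (sym (*-identityˡ _)) (trans
        (ξ-linear {φ = eAt x ∘ Φ} {φ₁ = eAt v} {φ₂ = eAt v} 1# (x (last {n})) 0# (λ η → trans (*-identityˡ _) (trans (e-Φ η x) (sym (trans (+-congˡ (zeroˡ (eAt v η))) (+-identityʳ _))))) k′ ζ)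
        (trans (+-congˡ (zeroˡ (ξ (eAt v) k′ ζ))) (+-identityʳ _)))

    -- For the last variable, Φ 0 is the unit composition at the last place and ξ_n annihilates 1.
    -- Adjacent swaps fix 0 and carry the identity down to the other variables.
    raised-0 : ∀ k → RaisedBy k (replicate (suc n) 0)
    raised-0 = >-weakInduction (λ k → RaisedBy k 0ᵛ) at-last step
      where
      0ᵛ = replicate (suc n) 0
      at-last : RaisedBy (fromℕ n) 0ᵛ
      at-last x = sym (begin
        e (0ᵛ ⁺ last {n}) x + ξ (eAt x) (last {n}) 0ᵛ  ≈⟨ +-cong (reflexive (≡.cong (eAt x) (≡.sym Φ-0))) ξ≈0 ⟩
        e (Φ 0ᵛ) x + 0#  ≈⟨ trans (+-identityʳ _) (e-Φ 0ᵛ x) ⟩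
        x (last {n}) * e 0ᵛ (rotatePoint x)  ≈⟨ *-congˡ (trans (e-0 (rotatePoint x)) (sym (e-0 x))) ⟩
        x (last {n}) * e 0ᵛ x ∎)
        where
        exchange≈0 : ∀ p → exchange (eAt x) (last {n}) p 0ᵛ ≈ 0#
        exchange≈0 p = begin
          exchange (eAt x) (last {n}) p 0ᵛ  ≡⟨ ≡.cong (λ b → P (suc (lookup 0ᵛ (last {n}))) - P (cutoff b (lookup 0ᵛ p))) (dec-false (last {n} Fin.<? p) (ℕP.≤⇒≯ (FinP.≤fromℕ p))) ⟩
          P (suc (lookup 0ᵛ (last {n}))) - P (suc (lookup 0ᵛ p))  ≡⟨ ≡.cong₂ (λ a b → P (suc a) - P (suc b)) (VP.lookup-replicate (last {n}) 0) (VP.lookup-replicate p 0) ⟩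
          P 1 - P 1  ≈⟨ -‿inverseʳ _ ⟩
          0# ∎
          where P = partial (along (eAt x) (last {n}) p 0ᵛ)
        ξ≈0 : ξ (eAt x) (last {n}) 0ᵛ ≈ 0#
        ξ≈0 = trans (+-cong (trans (*-congʳ (trans (reflexive (≡.cong ι (VP.lookup-replicate (last {n}) 0))) ι-zero)) (zeroˡ (e 0ᵛ x)))
          (trans (*-congˡ (trans (sum-cong-≋ exchange≈0) (sum-replicate-zero (suc n)))) (zeroʳ r))) (+-identityˡ 0#)
      step : ∀ k → RaisedBy (suc k) 0ᵛ → RaisedBy (inject₁ k) 0ᵛ
      step k h = subst (RaisedBy (inject₁ k)) swap-0 (raised-swap adj (inject₁ k) 0ᵛ (subst (λ p → RaisedBy p 0ᵛ) (≡.sym (transpose-i (inject₁ k) (suc k))) h))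
        where
        adj : toℕ (suc k) ≡ suc (toℕ (inject₁ k))
        adj = ≡.cong suc (≡.sym (FinP.toℕ-inject₁ k))
        swap-0 : swap (inject₁ k) (suc k) 0ᵛ ≡ 0ᵛ
        swap-0 = ∣ζ∣≡0 _ (≡.trans (∣swap∣ (inject₁ k) (suc k) 0ᵛ) (∣0∣ n))

    -- The index k is quantified inside the induction because every generator permutes it.
    raising : ∀ ζ k → RaisedBy k ζ
    raising = swap-Φ-induction (λ ζ → ∀ k → RaisedBy k ζ) raised-0
      (λ i j adj ζ h k → raised-swap adj k ζ (h (Perm.transpose i j ⟨$⟩ʳ k)))
      (λ ζ h k → raised-Φ k ζ (h (rotation ⟨$⟩ʳ k)))

-- The combinatorics of η* and P[η]

module Predecessors where
  open import Data.Nat using (_+_; _∸_; _⊔_; _≤_; _<_)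
  open import Relation.Binary.PropositionalEquality using (refl; sym; trans; cong; cong₂)
  open ℕSum using (sum; ∑-distrib-+; sum-cong-≗)
  open Relabelling
  open Ranks using (indicator; countF-sum; [≡]; sum-[≡]; sum-1)

  ≤-max : ∀ {n} (η : Vec ℕ n) i → lookup η i ≤ maxη η
  ≤-max (x ∷ η) zero = ℕP.m≤m⊔n x (maxη η)
  ≤-max (x ∷ η) (suc i) = ℕP.≤-trans (≤-max η i) (ℕP.m≤n⊔m x (maxη η))

  max-attained : ∀ {n} (η : Vec ℕ (suc n)) → Σ[ i ∈ Fin (suc n) ] lookup η i ≡ maxη η
  max-attained (x ∷ []) = zero , sym (ℕP.⊔-identityʳ x)
  max-attained (x ∷ η@(_ ∷ _)) with ℕP.⊔-sel x (maxη η) | max-attained η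
  ... | inj₁ e | _     = zero , sym e
  ... | inj₂ e | i , f = suc i , trans f (sym e)

  firstWhere-tabulate : ∀ {m N} (b : Fin N → Bool) (f : Fin m → Fin N) d → Σ[ i ∈ Fin m ] b (f i) ≡ true
    → Σ[ i ∈ Fin m ] firstWhere b (L.tabulate f) d ≡ f i × b (f i) ≡ true × (∀ j → j Fin.< i → b (f j) ≡ false)
  firstWhere-tabulate {suc m} b f d (i , bi) with b (f zero) in b₀
  firstWhere-tabulate {suc m} b f d (i , bi) | true = zero , refl , b₀ , λ j ()
  firstWhere-tabulate {suc m} b f d (zero , bi) | false = contradiction (trans (sym bi) b₀) λ ()
  firstWhere-tabulate {suc m} b f d (suc i , bi) | false with firstWhere-tabulate b (f ∘ suc) d (i , bi)
  ... | i₀ , e , bi₀ , before = suc i₀ , e , bi₀ , λ { zero _ → b₀ ; (suc j) (s≤s j<i₀) → before j j<i₀ }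

  -- In this form the library results on membership and repetition in products apply.
  box-product : ∀ m n → box m (suc n) ≡ L.cartesianProductWith V._∷_ (upTo (suc m)) (box m n)
  box-product m n = concatMap-map (upTo (suc m))
    where
    concatMap-map : ∀ xs → concatMap (λ a → map (a V.∷_) (box m n)) xs ≡ L.cartesianProductWith V._∷_ xs (box m n)
    concatMap-map [] = refl
    concatMap-map (x ∷ xs) = cong (map (x V.∷_) (box m n) ++_) (concatMap-map xs)

  box-complete : ∀ m {n} (γ : Vec ℕ n) → (∀ i → lookup γ i ≤ m) → γ ∈ box m n
  box-complete m [] le = here refl
  box-complete m {suc n} (x ∷ γ) le = subst (_ ∈_) (sym (box-product m n))
    (∈-cartesianProductWith⁺ V._∷_ (∈-upTo⁺ (s≤s (le zero))) (box-complete m γ (le ∘ suc)))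

  box-unique : ∀ m n → Unique (box m n)
  box-unique m zero = [] ∷ []
  box-unique m (suc n) = subst Unique (sym (box-product m n))
    (UniqueP.cartesianProductWith⁺ V._∷_ VP.∷-injective (UniqueP.upTo⁺ (suc m)) (box-unique m n))

  module _ {n} (η : Vec ℕ (suc n)) (η≢0 : η ≢ replicate (suc n) 0) where
    k : Fin (suc n)
    k = kη η

    a : ℕ
    a = maxη η ∸ 1

    ζ : Vec ℕ (suc n)
    ζ = ηstar η

    private
      isMax : Fin (suc n) → Bool
      isMax i = does (lookup η i ℕ.≟ maxη η)

      k-spec : lookup η k ≡ maxη η × (∀ j → j Fin.< k → lookup η j ≢ maxη η)
      k-spec with firstWhere-tabulate isMax (λ i → i) zero (proj₁ (max-attained η) , dec-true (_ ℕ.≟ _) (proj₂ (max-attained η)))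
      ... | i , e , bi , before = ≡.subst (λ k → lookup η k ≡ maxη η × (∀ j → j Fin.< k → lookup η j ≢ maxη η)) (sym e)
        ( decide bi , λ j j<i ηj≡m → contradiction (trans (sym (before j j<i)) (dec-true (lookup η j ℕ.≟ maxη η) ηj≡m)) λ ())
        where
        decide : isMax i ≡ true → lookup η i ≡ maxη η
        decide b with lookup η i ℕ.≟ maxη η
        ... | yes e = e
        ... | no ¬e = contradiction (trans (sym b) (dec-false (lookup η i ℕ.≟ maxη η) ¬e)) λ ()

    max>0 : 0 < maxη η
    max>0 = ℕP.n≢0⇒n>0 λ m≡0 → η≢0 (vec-ext λ i → trans (ℕP.n≤0⇒n≡0 (subst (lookup η i ≤_) m≡0 (≤-max η i))) (sym (VP.lookup-replicate i 0)))

    max≡ : maxη η ≡ suc a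
    max≡ = sym (ℕP.suc-pred (maxη η) {{ℕ.>-nonZero max>0}})

    ζₖ : lookup ζ k ≡ a
    ζₖ = VP.lookup∘update k η a

    ζⱼ : ∀ {j} → j ≢ k → lookup ζ j ≡ lookup η j
    ζⱼ j≢k = VP.lookup∘update′ j≢k η a

    ζ⁺k : ζ ⁺ k ≡ η
    ζ⁺k = vec-ext at
      where
      at : ∀ p → lookup (ζ ⁺ k) p ≡ lookup η p
      at p with p Fin.≟ k
      ... | yes refl = trans (lookup-⁺-≡ ζ k) (trans (cong suc ζₖ) (trans (sym max≡) (sym (proj₁ k-spec))))
      ... | no p≢k = trans (lookup-⁺-≢ ζ p≢k) (ζⱼ p≢k)

    cut : Fin (suc n) → ℕ
    cut j = cutoff (does (k Fin.<? j)) (lookup ζ j)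

    cut? : ∀ j c → Dec (cut j ≤ c)
    cut? j c = cut j ℕ.≤? c

    -- Here the choice of k as the first maximum is used: entries left of it are at most `a`,
    -- entries right of it at most `suc a`. In both cases `cut j ≤ suc a`, so no quotient has
    -- negative terms.
    data Side (j : Fin (suc n)) : Set where
      left  : j Fin.< k → lookup η j ≤ a → cut j ≡ suc (lookup η j) → Side j
      right : k Fin.< j → lookup η j ≤ suc a → cut j ≡ lookup η j → Side j

    side : ∀ {j} → j ≢ k → Side j
    side {j} j≢k with FinP.<-cmp j k
    ... | tri≈ _ e _ = contradiction e j≢k
    ... | tri< l _ ¬g = left l (s≤s⁻¹ (subst (lookup η j <_) max≡ (ℕP.≤∧≢⇒< (≤-max η j) (proj₂ k-spec j l))))
            (cong₂ cutoff (dec-false (k Fin.<? j) ¬g) (ζⱼ j≢k))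
    ... | tri> _ _ g = right g (subst (lookup η j ≤_) max≡ (≤-max η j)) (cong₂ cutoff (dec-true (k Fin.<? j) g) (ζⱼ j≢k))

    cut≤ : ∀ {j} → j ≢ k → cut j ≤ suc a
    cut≤ j≢k with side j≢k
    ... | left _ l e = subst (_≤ suc a) (sym e) (s≤s l)
    ... | right _ l e = subst (_≤ suc a) (sym e) l

    ηⱼ≤cut : ∀ {j} → j ≢ k → lookup η j ≤ cut j
    ηⱼ≤cut j≢k with side j≢k
    ... | left _ _ e = ℕP.≤-trans (ℕP.n≤1+n _) (ℕP.≤-reflexive (sym e))
    ... | right _ _ e = ℕP.≤-reflexive (sym e)

    shifted : Fin (suc n) → ℕ → Vec ℕ (suc n)
    shifted j c = place k j ζ c (lookup ζ k + lookup ζ j ∸ c)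

    -- The new entry at k is c, so l = a - c. The value c = a would return η* and is left out;
    -- `downFrom` follows the recursion of `partial`.
    shiftedBy : ∀ j → Dec (j ≡ k) → List (Vec ℕ (suc n))
    shiftedBy j (yes _) = []
    shiftedBy j (no _)  = map (shifted j) (filter (cut? j) (downFrom a))

    family : Fin (suc n) → List (Vec ℕ (suc n))
    family j = shiftedBy j (j Fin.≟ k)

    predecessors : List (Vec ℕ (suc n))
    predecessors = concat (L.tabulate family)

    IsShifted : Fin (suc n) → Vec ℕ (suc n) → Set
    IsShifted j γ = j ≢ k × Σ[ c ∈ ℕ ] cut j ≤ c × c < a × γ ≡ shifted j c

    ∈-shiftedBy⁻ : ∀ {j γ} d → γ ∈ shiftedBy j d → IsShifted j γ
    ∈-shiftedBy⁻ {j} (no j≢k) γ∈ with ∈-map∘filter⁻ (shifted j) (cut? j) γ∈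
    ... | c , c∈ , e , u≤c = j≢k , c , u≤c , ∈-downFrom⁻ c∈ , e

    ∈-shiftedBy⁺ : ∀ {j γ} d → IsShifted j γ → γ ∈ shiftedBy j d
    ∈-shiftedBy⁺ (yes j≡k) (j≢k , _) = contradiction j≡k j≢k
    ∈-shiftedBy⁺ {j} (no _) (_ , c , u≤c , c<a , e) = ∈-map∘filter⁺ (shifted j) (cut? j) (c , ∈-downFrom⁺ c<a , e , u≤c)

    lookup-shifted-j : ∀ {j} → j ≢ k → ∀ {c} → c < a → lookup (shifted j c) j ≡ lookup η j + (a ∸ c)
    lookup-shifted-j {j} j≢k {c} c<a = begin
      lookup (shifted j c) j  ≡⟨ lookup-place-j k j ζ c _ ⟩
      lookup ζ k + lookup ζ j ∸ c  ≡⟨ cong₂ (λ x y → x + y ∸ c) ζₖ (ζⱼ j≢k) ⟩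
      a + lookup η j ∸ c  ≡⟨ cong (_∸ c) (ℕP.+-comm a (lookup η j)) ⟩
      lookup η j + a ∸ c  ≡⟨ ℕP.+-∸-assoc (lookup η j) (ℕP.<⇒≤ c<a) ⟩
      lookup η j + (a ∸ c) ∎
      where open ≡.≡-Reasoning

    lookup-shifted-k : ∀ {j} → j ≢ k → ∀ {c} → lookup (shifted j c) k ≡ c
    lookup-shifted-k {j} j≢k {c} = lookup-place-k k j ζ c _ j≢k

    lookup-shifted-else : ∀ {j p c} → p ≢ j → p ≢ k → lookup (shifted j c) p ≡ lookup η p
    lookup-shifted-else p≢j p≢k = trans (lookup-place-else ζ _ _ p≢j p≢k) (ζⱼ p≢k)

    -- With l = a - c, the conditions ε > 0 for j < k and ε ≥ 0 for j > k are both the inequality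
    -- `cut j ≤ c`.
    IsShifted⇒InP : ∀ {j γ} → IsShifted j γ → InP η γ
    IsShifted⇒InP {j} (j≢k , c , u≤c , c<a , refl) = j , fromℕ< l<m , j≢k
      , subst (0 <_) (sym toℕ-l) l>0
      , trans (lookup-shifted-j j≢k c<a) (cong (lookup η j +_) (sym toℕ-l))
      , trans (cong₂ _+_ (lookup-shifted-k j≢k) toℕ-l) (ℕP.m+[n∸m]≡n (ℕP.<⇒≤ c<a))
      , (λ i i≢j i≢k → lookup-shifted-else i≢j i≢k)
      , (λ j<k → subst (λ l → lookup η j + l < a) (sym toℕ-l) (gap-left j<k))
      , (λ k<j → subst (λ l → lookup η j + l ≤ a) (sym toℕ-l) (gap-right k<j))
      -- Entry j has grown by l > 0, whereas η* keeps it.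
      , λ e → ℕP.<-irrefl (sym (trans (sym (lookup-shifted-j j≢k c<a)) (trans (cong (λ γ → lookup γ j) e) (ζⱼ j≢k))))
          (ℕP.m<m+n (lookup η j) l>0)
      where
      l>0 : 0 < a ∸ c
      l>0 = ℕP.m<n⇒0<n∸m c<a
      l<m : a ∸ c < maxη η
      l<m = subst (a ∸ c <_) (sym max≡) (s≤s (ℕP.m∸n≤m a c))
      toℕ-l : toℕ (fromℕ< l<m) ≡ a ∸ c
      toℕ-l = FinP.toℕ-fromℕ< l<m
      gap : ∀ b → b ≤ c → b + (a ∸ c) ≤ a
      gap b b≤c = ℕP.≤-trans (ℕP.+-monoˡ-≤ (a ∸ c) b≤c) (ℕP.≤-reflexive (ℕP.m+[n∸m]≡n (ℕP.<⇒≤ c<a)))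
      gap-left : j Fin.< k → lookup η j + (a ∸ c) < a
      gap-left j<k with side j≢k
      ... | left _ _ e = gap (suc (lookup η j)) (subst (_≤ c) e u≤c)
      ... | right k<j _ _ = contradiction j<k (ℕP.<⇒≯ k<j)
      gap-right : k Fin.< j → lookup η j + (a ∸ c) ≤ a
      gap-right k<j = gap (lookup η j) (ℕP.≤-trans (ηⱼ≤cut j≢k) u≤c)

    InP⇒IsShifted : ∀ {γ} → InP η γ → Σ[ j ∈ Fin (suc n) ] IsShifted j γ
    InP⇒IsShifted {γ} (j , l , j≢k , l>0 , γⱼ , γₖ , elsewhere , gap-left , gap-right , _) = j , j≢k , c , u≤c , c<a
      , place-unique j≢k refl (trans γⱼ (sym (trans (cong₂ (λ x y → x + y ∸ c) (trans ζₖ (sym γₖ)) (ζⱼ j≢k))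
            (trans (cong (_∸ c) (ℕP.+-assoc c (toℕ l) (lookup η j))) (trans (ℕP.m+n∸m≡n c (toℕ l + lookup η j)) (ℕP.+-comm (toℕ l) (lookup η j)))))))
          (λ p p≢j p≢k → trans (elsewhere p p≢j p≢k) (sym (ζⱼ p≢k)))
      where
      c = lookup γ k
      c<a : c < a
      c<a = subst (c <_) γₖ (ℕP.m<m+n c l>0)
      cancel : ∀ {b} → b + toℕ l ≤ a → b ≤ c
      cancel {b} le = ℕP.+-cancelʳ-≤ (toℕ l) b c (ℕP.≤-trans le (ℕP.≤-reflexive (sym γₖ)))
      u≤c : cut j ≤ c
      u≤c with side j≢k
      ... | left j<k _ e = subst (_≤ c) (sym e) (cancel (gap-left j<k))
      ... | right k<j _ e = subst (_≤ c) (sym e) (cancel (gap-right k<j))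

    shifted≤max : ∀ {j γ} → IsShifted j γ → ∀ i → lookup γ i ≤ maxη η
    shifted≤max {j} {γ} s@(j≢k , c , u≤c , c<a , refl) i with i Fin.≟ j
    ... | yes refl = ℕP.≤-trans (ℕP.≤-reflexive (lookup-shifted-j j≢k c<a)) (ℕP.≤-trans
            (ℕP.+-monoˡ-≤ (a ∸ c) (ℕP.≤-trans (ηⱼ≤cut j≢k) u≤c)) (ℕP.≤-trans (ℕP.≤-reflexive (ℕP.m+[n∸m]≡n (ℕP.<⇒≤ c<a))) (ℕP.m∸n≤m (maxη η) 1)))
    ... | no i≢j with i Fin.≟ k
    ...   | yes refl = ℕP.≤-trans (ℕP.≤-reflexive (lookup-shifted-k j≢k)) (ℕP.≤-trans (ℕP.<⇒≤ c<a) (ℕP.m∸n≤m (maxη η) 1))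
    ...   | no i≢k = ℕP.≤-trans (ℕP.≤-reflexive (lookup-shifted-else i≢j i≢k)) (≤-max η i)

    ∣shifted∣ : ∀ {j γ} → IsShifted j γ → ∣ γ ∣ ≡ ∣ ζ ∣
    ∣shifted∣ {j} (j≢k , c , u≤c , c<a , refl) = ℕP.+-cancelʳ-≡ (lookup ζ k + lookup ζ j) _ _ (trans (∣place∣ ζ c _ j≢k)
      (cong (∣ ζ ∣ +_) (ℕP.m+[n∸m]≡n (ℕP.≤-trans (ℕP.<⇒≤ c<a) (ℕP.≤-trans (ℕP.≤-reflexive (sym ζₖ)) (ℕP.m≤m+n _ _))))))

    -- Within a family the entry at k tells members apart. Between families, place i grows in family
    -- i and is kept in family j.
    predecessors-unique : Unique predecessors
    predecessors-unique = UniqueP.concat⁺ (AllP.tabulate⁺ λ j → each j (j Fin.≟ k))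
      (AllPairsP.tabulate⁺ λ {i} {j} i≢j (γ∈i , γ∈j) → disjoint i≢j (∈-shiftedBy⁻ (i Fin.≟ k) γ∈i) (∈-shiftedBy⁻ (j Fin.≟ k) γ∈j))
      where
      each : ∀ j d → Unique (shiftedBy j d)
      each j (yes _) = []
      each j (no j≢k) = UniqueP.map⁺ (λ {c} {c′} e → trans (sym (lookup-shifted-k j≢k)) (trans (cong (λ γ → lookup γ k) e) (lookup-shifted-k j≢k)))
        (UniqueP.filter⁺ (cut? j) (UniqueP.downFrom⁺ a))
      disjoint : ∀ {i j γ} → i ≢ j → IsShifted i γ → IsShifted j γ → _
      disjoint {i} {j} i≢j (i≢k , c , u≤c , c<a , refl) (j≢k , c′ , _ , _ , e) = ℕP.<-irrefl
        (sym (trans (sym (lookup-shifted-j i≢k c<a)) (trans (cong (λ γ → lookup γ i) e) (lookup-shifted-else i≢j i≢k))))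
        (ℕP.m<m+n (lookup η i) (ℕP.m<n⇒0<n∸m c<a))

    ∈-predecessors⇒IsShifted : ∀ {γ} → γ ∈ predecessors → Σ[ j ∈ Fin (suc n) ] IsShifted j γ
    ∈-predecessors⇒IsShifted γ∈ with ∈-concat⁻′ (L.tabulate family) γ∈
    ... | _ , γ∈xs , xs∈ with ∈-tabulate⁻ {f = family} xs∈
    ...   | j , refl = j , ∈-shiftedBy⁻ (j Fin.≟ k) γ∈xs

    ∈-Pη⇒IsShifted : ∀ {γ} → γ ∈ Pη η → Σ[ j ∈ Fin (suc n) ] IsShifted j γ
    ∈-Pη⇒IsShifted γ∈ = InP⇒IsShifted (proj₂ (∈-filter⁻ (InP? η) {xs = box (maxη η) (suc n)} γ∈))

    Pη↭predecessors : Pη η ↭ predecessors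
    Pη↭predecessors = ∼bag⇒↭ (unique∧set⇒bag (UniqueP.filter⁺ (InP? η) (box-unique (maxη η) (suc n))) predecessors-unique
      (mk⇔ (λ γ∈ → let (j , s) = ∈-Pη⇒IsShifted γ∈ in ∈-concat⁺′ (∈-shiftedBy⁺ (j Fin.≟ k) s) (∈-tabulate⁺ {f = family} j))
           (λ γ∈ → let (j , s) = ∈-predecessors⇒IsShifted γ∈ in ∈-filter⁺ (InP? η) (box-complete (maxη η) _ (shifted≤max s)) (IsShifted⇒InP s))))

    -- The places whose interval reaches its largest possible exponent `a` and so contains η* once.
    contributes : Fin (suc n) → Bool
    contributes j = if does (j Fin.≟ k) then false else does (cut? j a)

    -- Apart from k, the places that do not contribute are those with `cut j = suc a`: a maximal
    -- entry right of k or an entry `a` left of it. These are the two counts in l[η].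
    count-contributes : sum (indicator ∘ contributes) ≡ suc n ∸ 1 ∸ lη η
    count-contributes = sym (trans (cong (_∸ lη η) n≡) (ℕP.m+n∸m≡n (lη η) (sum (indicator ∘ contributes))))
      where
      above below : Fin (suc n) → Bool
      above i = does (k Fin.<? i) ∧ does (lookup η i ℕ.≟ maxη η)
      below i = does (i Fin.<? k) ∧ does (lookup η i ℕ.≟ maxη η ∸ 1)
      pointwise : ∀ j → [≡] k j + ((indicator (above j) + indicator (below j)) + indicator (contributes j)) ≡ 1
      pointwise j = cases (j Fin.≟ k)
        where
        add : ∀ {x y z w} {b c d e : Bool} → b ≡ x → c ≡ y → d ≡ z → e ≡ w
          → indicator b + ((indicator c + indicator d) + indicator e) ≡ indicator x + ((indicator y + indicator z) + indicator w)
        add refl refl refl refl = refl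
        contributes-≢ : j ≢ k → contributes j ≡ does (cut? j a)
        contributes-≢ j≢k = cong (λ b → if b then false else does (cut? j a)) (dec-false (j Fin.≟ k) j≢k)
        above? = (k Fin.<? j) ×-dec (lookup η j ℕ.≟ maxη η)
        below? = (j Fin.<? k) ×-dec (lookup η j ℕ.≟ a)
        cases : Dec (j ≡ k) → [≡] k j + ((indicator (above j) + indicator (below j)) + indicator (contributes j)) ≡ 1
        cases (yes refl) = add (dec-true (k Fin.≟ k) refl) (dec-false above? (ℕP.n≮n _ ∘ proj₁)) (dec-false below? (ℕP.n≮n _ ∘ proj₁))
          (cong (λ b → if b then false else does (cut? k a)) (dec-true (k Fin.≟ k) refl))
        cases (no j≢k) with side j≢k
        ... | right k<j le e with ℕP.m≤n⇒m<n∨m≡n le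
        ...   | inj₁ l = add (dec-false (j Fin.≟ k) j≢k) (dec-false above? λ (_ , ηj≡m) → ℕP.<-irrefl (trans ηj≡m max≡) l) (dec-false below? λ (j<k , _) → ℕP.<⇒≯ k<j j<k)
                           (trans (contributes-≢ j≢k) (dec-true (cut? j a) (subst (_≤ a) (sym e) (s≤s⁻¹ l))))
        ...   | inj₂ ηj≡sa = add (dec-false (j Fin.≟ k) j≢k) (dec-true above? (k<j , trans ηj≡sa (sym max≡))) (dec-false below? λ (j<k , _) → ℕP.<⇒≯ k<j j<k)
                           (trans (contributes-≢ j≢k) (dec-false (cut? j a) λ u≤a → ℕP.n≮n a (subst (_≤ a) (trans e ηj≡sa) u≤a)))
        cases (no j≢k) | left j<k le e with ℕP.m≤n⇒m<n∨m≡n le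
        ...   | inj₁ l = add (dec-false (j Fin.≟ k) j≢k) (dec-false above? λ (k<j , _) → ℕP.<⇒≯ k<j j<k) (dec-false below? λ (_ , ηj≡a) → ℕP.<-irrefl ηj≡a l)
                           (trans (contributes-≢ j≢k) (dec-true (cut? j a) (subst (_≤ a) (sym e) l)))
        ...   | inj₂ ηj≡a = add (dec-false (j Fin.≟ k) j≢k) (dec-false above? λ (k<j , _) → ℕP.<⇒≯ k<j j<k) (dec-true below? (j<k , ηj≡a))
                           (trans (contributes-≢ j≢k) (dec-false (cut? j a) λ u≤a → ℕP.n≮n a (subst (_≤ a) (trans e (cong suc ηj≡a)) u≤a)))
      n≡ : n ≡ lη η + sum (indicator ∘ contributes)
      n≡ = ℕP.suc-injective (sym (begin
        1 + (lη η + sum (indicator ∘ contributes))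
          ≡⟨ cong₂ _+_ (sym (sum-[≡] k)) (cong (_+ sum (indicator ∘ contributes)) (trans (cong₂ _+_ (countF-sum above) (countF-sum below)) (sym (∑-distrib-+ (indicator ∘ above) (indicator ∘ below))))) ⟩
        sum ([≡] k) + (sum (λ j → indicator (above j) + indicator (below j)) + sum (indicator ∘ contributes))
          ≡⟨ cong (sum ([≡] k) +_) (sym (∑-distrib-+ (λ j → indicator (above j) + indicator (below j)) (indicator ∘ contributes))) ⟩
        sum ([≡] k) + sum (λ j → (indicator (above j) + indicator (below j)) + indicator (contributes j))
          ≡⟨ sym (∑-distrib-+ ([≡] k) (λ j → (indicator (above j) + indicator (below j)) + indicator (contributes j))) ⟩
        sum (λ j → [≡] k j + ((indicator (above j) + indicator (below j)) + indicator (contributes j)))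
          ≡⟨ sum-cong-≗ pointwise ⟩
        sum {suc n} (λ _ → 1)
          ≡⟨ sum-1 (suc n) ⟩
        suc n ∎))
        where open ≡.≡-Reasoning

-- The action of Ξ on monomials

module Transport (T : TranscendentalParameter) where
  open TranscendentalParameter T
  open import Algebra.Properties.Group +-group using () renaming (x∙y⁻¹≈ε⇒x≈y to x-y≈0⇒x≈y)
  open import Algebra.Properties.Ring ring using (-1*x≈-x)
  open import Algebra.Properties.Semiring.Exp semiring using (_^_)
  open import Relation.Binary.Reasoning.Setoid setoid
  open IntegerSolver K
  open Relabelling
  open Polynomials K
  open Division K using (All-bind)
  open Nodes T
  open Interpolation T
  open Interpolates

  lin-difference : ∀ {A} (φ : A → Carrier) p q → lin φ (p ++ scale (- 1#) q) ≈ lin φ p - lin φ q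
  lin-difference φ p q = trans (lin-++ φ p _) (+-congˡ (trans (lin-scale φ (- 1#) q) (-1*x≈-x _)))

  difference~[]⇒~ : ∀ {A} (p q : Comb A) → p ++ scale (- 1#) q ~ [] → p ~ q
  difference~[]⇒~ p q h φ = x-y≈0⇒x≈y _ _ (trans (sym (lin-difference φ p q)) (h φ))

  coefficients-agree⇒~ : ∀ {n} (p q : Comb (Vec ℕ n)) → (∀ η → lin (δ η) p ≈ lin (δ η) q) → p ~ q
  coefficients-agree⇒~ p q h = difference~[]⇒~ p q (coefficients-determine (p ++ scale (- 1#) q) λ η →
    trans (lin-difference (δ η) p q) (trans (+-congʳ (h η)) (-‿inverseʳ _)))

  degree-bound : ∀ {n} (p : Comb (Vec ℕ n)) → Σ[ d ∈ ℕ ] Deg< d p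
  degree-bound [] = 0 , []
  degree-bound ((c , e) ∷ p) with degree-bound p
  ... | d , b = suc ∣ e ∣ ℕ.+ d , ℕP.m≤m+n (suc ∣ e ∣) d ∷ All.map (λ l → ℕP.≤-trans l (ℕP.m≤n+m d (suc ∣ e ∣))) b

  -- Every list of terms has some degree bound, and nodes of all degrees are at hand.
  values-agree⇒~ : ∀ {n} (p q : Comb (Vec ℕ n)) → (∀ v → ev p v ≈ ev q v) → p ~ q
  values-agree⇒~ p q h = difference~[]⇒~ p q (nodes-determine (proj₁ (degree-bound (p ++ scale (- 1#) q))) (p ++ scale (- 1#) q) (proj₂ (degree-bound (p ++ scale (- 1#) q)))
    λ μ _ → trans (lin-difference (mon (node μ)) p q) (trans (+-congʳ (h (node μ))) (-‿inverseʳ _)))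

  -- Filtering of terms transposed to functionals, so that an equality `~` can be projected to a
  -- homogeneous component.
  restrict : ∀ {A : Set} → (A → Bool) → (A → Carrier) → A → Carrier
  restrict b φ e = if b e then φ e else 0#

  lin-filter : ∀ {A : Set} {P : A → Set} (P? : ∀ e → Dec (P e)) φ p
    → lin φ (L.filter (P? ∘ proj₂) p) ≈ lin (restrict (does ∘ P?) φ) p
  lin-filter P? φ [] = refl
  lin-filter P? φ ((c , e) ∷ p) with P? e
  ... | yes _ = +-congˡ (lin-filter P? φ p)
  ... | no _  = trans (lin-filter P? φ p) (sym (trans (+-congʳ (zeroʳ c)) (+-identityˡ _)))

  restrict-true : ∀ {A : Set} {P : A → Set} (P? : ∀ e → Dec (P e)) φ e → P e → restrict (does ∘ P?) φ e ≈ φ e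
  restrict-true P? φ e p = reflexive (≡.cong (λ b → if b then φ e else 0#) (dec-true (P? e) p))

  restrict-false : ∀ {A : Set} {P : A → Set} (P? : ∀ e → Dec (P e)) φ e → ¬ P e → restrict (does ∘ P?) φ e ≈ 0#
  restrict-false P? φ e ¬p = reflexive (≡.cong (λ b → if b then φ e else 0#) (dec-false (P? e) ¬p))

  homogeneous : ∀ {n} → ℕ → Comb (Vec ℕ n) → Comb (Vec ℕ n)
  homogeneous d = L.filter λ ce → ∣ proj₂ ce ∣ ℕ.≟ d

  1≉0 : ¬ (1# ≈ 0#)
  1≉0 1≈0 = contradiction (proj₁ (r-transcendental {0} {0} {1} {0} (trivial _ _))) λ ()
    where
    trivial : ∀ x y → x ≈ y
    trivial x y = trans (sym (*-identityˡ x)) (trans (*-congʳ 1≈0) (trans (zeroˡ x) (sym (trans (sym (*-identityˡ y)) (trans (*-congʳ 1≈0) (zeroˡ y))))))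

  module Expansion {n : ℕ} (E : Vec ℕ (suc n) → Comb (Vec ℕ (suc n)))
    (E-degree : ∀ η γ → ∣ η ∣ ℕ.< ∣ γ ∣ → lin (δ γ) (E η) ≈ 0#)
    (E-leading : ∀ η → lin (δ η) (E η) ≈ 1#)
    (E-vanish : ∀ η γ → γ ≢ η → ∣ γ ∣ ℕ.≤ ∣ η ∣ → ev (E η) (node γ) ≈ 0#) where

    -- The degree of `E η` is bounded by its coefficients, while its list may hold higher terms that
    -- cancel. Dropping them gives the bound termwise, as `nodes-determine` demands.
    truncated : Vec ℕ (suc n) → Comb (Vec ℕ (suc n))
    truncated η = L.filter (λ ce → ∣ proj₂ ce ∣ ℕ.≤? ∣ η ∣) (E η)

    E~truncated : ∀ η → E η ~ truncated η
    E~truncated η = coefficients-agree⇒~ (E η) (truncated η) λ γ → sym (trans (lin-filter small? (δ γ) (E η)) (cases γ (small? γ)))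
      where
      small? : ∀ e → Dec (∣ e ∣ ℕ.≤ ∣ η ∣)
      small? e = ∣ e ∣ ℕ.≤? ∣ η ∣
      cases : ∀ γ → Dec (∣ γ ∣ ℕ.≤ ∣ η ∣) → lin (restrict (does ∘ small?) (δ γ)) (E η) ≈ lin (δ γ) (E η)
      cases γ (yes γ≤η) = lin-cong′ (λ e → at e (VP.≡-dec ℕ._≟_ e γ)) (E η)
        where
        at : ∀ e → Dec (e ≡ γ) → restrict (does ∘ small?) (δ γ) e ≈ δ γ e
        at e (yes ≡.refl) = restrict-true small? (δ γ) e γ≤η
        at e (no e≢γ) = either (does (small? e))
          where
          either : ∀ b → (if b then δ γ e else 0#) ≈ δ γ e
          either true  = refl
          either false = sym (δ-≢ e≢γ)
      cases γ (no γ≰η) = trans (lin-0 (λ e → at e (VP.≡-dec ℕ._≟_ e γ)) (E η)) (sym (E-degree η γ (ℕP.≰⇒> γ≰η)))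
        where
        at : ∀ e → Dec (e ≡ γ) → restrict (does ∘ small?) (δ γ) e ≈ 0#
        at e (yes ≡.refl) = restrict-false small? (δ γ) e γ≰η
        at e (no e≢γ) = either (does (small? e))
          where
          either : ∀ b → (if b then δ γ e else 0#) ≈ 0#
          either true  = δ-≢ e≢γ
          either false = refl

    truncated-degree : ∀ η → Deg< (suc ∣ η ∣) (truncated η)
    truncated-degree η = All.map s≤s (AllP.all-filter (λ ce → ∣ proj₂ ce ∣ ℕ.≤? ∣ η ∣) (E η))

    -- Otherwise `E γ` would vanish at every node of degree at most |γ| and be zero, against its
    -- leading coefficient 1.
    E-nonzero : ∀ γ → ¬ (ev (E γ) (node γ) ≈ 0#)
    E-nonzero γ e = 1≉0 (trans (sym (E-leading γ)) (trans (E~truncated γ (δ γ)) (nodes-determine (suc ∣ γ ∣) (truncated γ) (truncated-degree γ) vanishes (δ γ))))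
      where
      vanishes : ∀ μ → ∣ μ ∣ ℕ.< suc ∣ γ ∣ → ev (truncated γ) (node μ) ≈ 0#
      vanishes μ (s≤s l) with VP.≡-dec ℕ._≟_ μ γ
      ... | yes ≡.refl = trans (sym (E~truncated γ (mon (node γ)))) e
      ... | no μ≢γ = trans (sym (E~truncated γ (mon (node μ)))) (E-vanish γ μ μ≢γ l)

    combine : Comb (Vec ℕ (suc n)) → Point (suc n) → Carrier
    combine c v = lin (λ γ → ev (E γ) v) c

    -- Among the nodes of degree d, `E ν` is nonzero at ν alone, so the system for the weights is
    -- diagonal.
    interpolate : (F : Point (suc n) → Carrier) (d : ℕ) (ns : List (Vec ℕ (suc n))) → All (λ ν → ∣ ν ∣ ≡ d) ns
      → Σ[ c ∈ Comb (Vec ℕ (suc n)) ] All (λ ce → ∣ proj₂ ce ∣ ≡ d) c × All (λ ν → F (node ν) ≈ combine c (node ν)) ns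
    interpolate F d [] [] = [] , [] , []
    interpolate F d (ν ∷ ns) (∣ν∣≡d ∷ deg) with interpolate F d ns deg | 0-or-unit (ev (E ν) (node ν))
    ... | _ | inj₁ E≈0 = contradiction E≈0 (E-nonzero ν)
    ... | c , cdeg , agree | inj₂ (E⁻¹ , EE⁻¹≈1) = (x , ν) ∷ c , ∣ν∣≡d ∷ cdeg , at-ν ∷ All.zipWith (λ (f , e) → elsewhere f e) (deg , agree)
      where
      -- Subtracting the value already reached accounts for a repetition of ν in `ns`.
      x = (F (node ν) - combine c (node ν)) * E⁻¹
      at-ν : F (node ν) ≈ x * ev (E ν) (node ν) + combine c (node ν)
      at-ν = sym (begin
        (F (node ν) - combine c (node ν)) * E⁻¹ * ev (E ν) (node ν) + combine c (node ν)
          ≈⟨ +-congʳ (trans (*-assoc _ _ _) (*-congˡ (trans (*-comm _ _) EE⁻¹≈1))) ⟩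
        (F (node ν) - combine c (node ν)) * 1# + combine c (node ν)
          ≈⟨ solve 2 (λ f g → (f :- g) :* con 1ℤ :+ g := f) refl (F (node ν)) (combine c (node ν)) ⟩
        F (node ν) ∎)
      elsewhere : ∀ {ν′} → ∣ ν′ ∣ ≡ d → F (node ν′) ≈ combine c (node ν′) → F (node ν′) ≈ x * ev (E ν) (node ν′) + combine c (node ν′)
      elsewhere {ν′} ∣ν′∣≡d f with VP.≡-dec ℕ._≟_ ν′ ν
      ... | yes ≡.refl = at-ν
      ... | no ν′≢ν = trans f (sym (trans (+-congʳ (trans (*-congˡ (E-vanish ν ν′ ν′≢ν (ℕP.≤-reflexive (≡.trans ∣ν′∣≡d (≡.sym ∣ν∣≡d))))) (zeroʳ x))) (+-identityˡ _)))

    compositions : ℕ → List (Vec ℕ (suc n))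
    compositions d = L.filter (λ ν → ∣ ν ∣ ℕ.≟ d) (box d (suc n))

    ∈-compositions : ∀ ν → ν ∈ compositions ∣ ν ∣
    ∈-compositions ν = ∈-filter⁺ (λ μ → ∣ μ ∣ ℕ.≟ ∣ ν ∣) (Predecessors.box-complete ∣ ν ∣ ν (entry≤sum ν)) ≡.refl
      where
      entry≤sum : ∀ {n} (ν : Vec ℕ n) i → lookup ν i ℕ.≤ ∣ ν ∣
      entry≤sum (x ∷ ν) zero = ℕP.m≤m+n x ∣ ν ∣
      entry≤sum (x ∷ ν) (suc i) = ℕP.≤-trans (entry≤sum ν i) (ℕP.m≤n+m ∣ ν ∣ x)

    module _ (ζ : Vec ℕ (suc n)) where
      low : Comb (Vec ℕ (suc n))
      low = proj₁ (lower (e-interpolates ζ))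

      low-degree : Deg< ∣ ζ ∣ low
      low-degree = proj₁ (proj₂ (lower (e-interpolates ζ)))

      eList : Comb (Vec ℕ (suc n))
      eList = (1# , ζ) ∷ low

      ev-eList : ∀ v → ev eList v ≈ e ζ v
      ev-eList v = trans (+-congʳ (*-identityˡ _)) (sym (expand (e-interpolates ζ) v))

      private
        interpolated = interpolate (e ζ) ∣ ζ ∣ (compositions ∣ ζ ∣) (AllP.all-filter (λ ν → ∣ ν ∣ ℕ.≟ ∣ ζ ∣) (box ∣ ζ ∣ (suc n)))

      weights : Comb (Vec ℕ (suc n))
      weights = proj₁ interpolated

      weights-degree : All (λ ce → ∣ proj₂ ce ∣ ≡ ∣ ζ ∣) weights
      weights-degree = proj₁ (proj₂ interpolated)

      -- Both sides have degree at most |ζ|. They agree at nodes of degree |ζ| by the choice of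
      -- weights and vanish at all lower ones.
      eList~combination : eList ~ bind weights E
      eList~combination φ = begin
        lin φ eList  ≈⟨ difference~[]⇒~ eList (bind weights truncated) vanishing φ ⟩
        lin φ (bind weights truncated)  ≈⟨ lin-bind φ weights truncated ⟩
        lin (λ γ → lin φ (truncated γ)) weights ≈⟨ lin-cong′ (λ γ → sym (E~truncated γ φ)) weights ⟩
        lin (λ γ → lin φ (E γ)) weights  ≈⟨ sym (lin-bind φ weights E) ⟩
        lin φ (bind weights E) ∎
        where
        at-node : ∀ μ → ∣ μ ∣ ℕ.< suc ∣ ζ ∣ → e ζ (node μ) ≈ combine weights (node μ)
        at-node μ (s≤s l) with ℕP.m≤n⇒m<n∨m≡n l
        ... | inj₁ μ<ζ = trans (vanish (e-interpolates ζ) μ μ<ζ) (sym (trans (lin-cong weights (All.map (λ {ce} eq → E-vanish (proj₂ ce) μ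
                (λ { ≡.refl → ℕP.<-irrefl eq μ<ζ }) (ℕP.≤-trans l (ℕP.≤-reflexive (≡.sym eq)))) weights-degree)) (lin-0 (λ _ → refl) weights)))
        ... | inj₂ μ≡ζ = All.lookup (proj₂ (proj₂ interpolated)) (subst (λ d → μ ∈ compositions d) μ≡ζ (∈-compositions μ))
        vanishing : eList ++ scale (- 1#) (bind weights truncated) ~ []
        vanishing = nodes-determine (suc ∣ ζ ∣) (eList ++ scale (- 1#) (bind weights truncated))
          (AllP.++⁺ (ℕP.≤-refl ∷ All.map ℕP.m≤n⇒m≤1+n low-degree) (AllP.map⁺ (All-bind weights truncated
            (All.map (λ {ce} eq → subst (λ d → Deg< (suc d) (truncated (proj₂ ce))) eq (truncated-degree (proj₂ ce))) weights-degree))))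
          λ μ l → begin
            ev (eList ++ scale (- 1#) (bind weights truncated)) (node μ)  ≈⟨ lin-difference (mon (node μ)) eList _ ⟩
            ev eList (node μ) - ev (bind weights truncated) (node μ)  ≈⟨ +-cong (trans (ev-eList (node μ)) (at-node μ l)) (-‿cong (trans (lin-bind (mon (node μ)) weights truncated) (lin-cong′ (λ γ → sym (E~truncated γ (mon (node μ)))) weights))) ⟩
            combine weights (node μ) - combine weights (node μ)  ≈⟨ -‿inverseʳ _ ⟩
            0# ∎

      -- The component of degree |ζ| of the preceding identity; the lower part of e_ζ drops out.
      monomial~combination : (1# , ζ) ∷ [] ~ bind weights (λ γ → homogeneous ∣ γ ∣ (E γ))
      monomial~combination φ = begin
        lin φ ((1# , ζ) ∷ [])  ≈⟨ +-cong (*-congˡ (sym (restrict-true top? φ ζ ≡.refl))) (sym low≈0) ⟩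
        lin (restrict (does ∘ top?) φ) eList  ≈⟨ eList~combination (restrict (does ∘ top?) φ) ⟩
        lin (restrict (does ∘ top?) φ) (bind weights E)  ≈⟨ lin-bind (restrict (does ∘ top?) φ) weights E ⟩
        lin (λ γ → lin (restrict (does ∘ top?) φ) (E γ)) weights ≈⟨ lin-cong weights (All.map (λ {ce} eq → trans (sym (lin-filter top? φ (E (proj₂ ce))))
                                                                      (reflexive (≡.cong (λ d → lin φ (homogeneous d (E (proj₂ ce)))) (≡.sym eq)))) weights-degree) ⟩
        lin (λ γ → lin φ (homogeneous ∣ γ ∣ (E γ))) weights  ≈⟨ sym (lin-bind φ weights (λ γ → homogeneous ∣ γ ∣ (E γ))) ⟩
        lin φ (bind weights (λ γ → homogeneous ∣ γ ∣ (E γ))) ∎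
        where
        top? : ∀ e → Dec (∣ e ∣ ≡ ∣ ζ ∣)
        top? e = ∣ e ∣ ℕ.≟ ∣ ζ ∣
        low≈0 : lin (restrict (does ∘ top?) φ) low ≈ 0#
        low≈0 = trans (lin-cong low (All.map (λ {ce} l → restrict-false top? φ (proj₂ ce) (λ eq → ℕP.<-irrefl eq l)) low-degree)) (lin-0 (λ _ → refl) low)

    -- The substitution of ω x for x, by `mon-scale`; for ω = -1 it is `negx`.
    negated : Carrier → Comb (Vec ℕ (suc n)) → Comb (Vec ℕ (suc n))
    negated ω = L.map λ ce → (ω ^ ∣ proj₂ ce ∣ * proj₁ ce , proj₂ ce)

    lin-negated : ∀ ω φ p → lin φ (negated ω p) ≈ lin (λ e → ω ^ ∣ e ∣ * φ e) p
    lin-negated ω φ [] = refl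
    lin-negated ω φ ((c , e) ∷ p) = +-cong (solve 3 (λ w c x → w :* c :* x := c :* (w :* x)) refl (ω ^ ∣ e ∣) c (φ e)) (lin-negated ω φ p)

    module _ (ω : Carrier) (d : Vec ℕ (suc n) → Carrier) (d-unit : ∀ γ → Σ[ y ∈ Carrier ] d γ * y ≈ 1#)
      (Ξ : Comb (Vec ℕ (suc n)) → Comb (Vec ℕ (suc n)))
      (Ξ-resp : ∀ p q → p ~ q → Ξ p ~ Ξ q)
      (Ξ-++ : ∀ p q → Ξ (p ++ q) ~ Ξ p ++ Ξ q)
      (Ξ-scale : ∀ c p → Ξ (scale c p) ~ scale c (Ξ p))
      (Ξ-E : ∀ γ → Ξ (scale (d γ) (homogeneous ∣ γ ∣ (E γ))) ~ scale (ω ^ ∣ γ ∣ * d γ) (negated ω (E γ))) where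

      Ξ-bind : ∀ φ (c : Comb (Vec ℕ (suc n))) (f : Vec ℕ (suc n) → Comb (Vec ℕ (suc n))) → lin φ (Ξ (bind c f)) ≈ lin (λ γ → lin φ (Ξ (f γ))) c
      -- `scale 0# []` is `[]`, so homogeneity gives Ξ [] = 0 · Ξ [].
      Ξ-bind φ [] f = trans (Ξ-scale 0# [] φ) (trans (lin-scale φ 0# (Ξ [])) (zeroˡ _))
      Ξ-bind φ ((x , γ) ∷ c) f = trans (Ξ-++ (scale x (f γ)) (bind c f) φ) (trans (lin-++ φ (Ξ (scale x (f γ))) _)
        (+-cong (trans (Ξ-scale x (f γ) φ) (lin-scale φ x (Ξ (f γ)))) (Ξ-bind φ c f)))

      -- The normalisation `d γ` occurs on both sides of `Ξ-E` and is cancelled by its inverse.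
      Ξ-homogeneous : ∀ φ γ → lin φ (Ξ (homogeneous ∣ γ ∣ (E γ))) ≈ ω ^ ∣ γ ∣ * lin φ (negated ω (E γ))
      Ξ-homogeneous φ γ = begin
        lin φ (Ξ component)  ≈⟨ sym (trans (*-congʳ dy≈1) (*-identityˡ _)) ⟩
        (d γ * y) * lin φ (Ξ component)  ≈⟨ solve 3 (λ d y x → (d :* y) :* x := y :* (d :* x)) refl (d γ) y (lin φ (Ξ component)) ⟩
        y * (d γ * lin φ (Ξ component))  ≈⟨ *-congˡ (sym (trans (Ξ-scale (d γ) component φ) (lin-scale φ (d γ) (Ξ component)))) ⟩
        y * lin φ (Ξ (scale (d γ) component))  ≈⟨ *-congˡ (trans (Ξ-E γ φ) (lin-scale φ _ (negated ω (E γ)))) ⟩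
        y * ((ω ^ ∣ γ ∣ * d γ) * lin φ (negated ω (E γ))) ≈⟨ solve 4 (λ y w d x → y :* ((w :* d) :* x) := (d :* y) :* (w :* x)) refl y (ω ^ ∣ γ ∣) (d γ) (lin φ (negated ω (E γ))) ⟩
        (d γ * y) * (ω ^ ∣ γ ∣ * lin φ (negated ω (E γ))) ≈⟨ trans (*-congʳ dy≈1) (*-identityˡ _) ⟩
        ω ^ ∣ γ ∣ * lin φ (negated ω (E γ)) ∎
        where
        component = homogeneous ∣ γ ∣ (E γ)
        y = proj₁ (d-unit γ)
        dy≈1 = proj₂ (d-unit γ)

      -- All weights sit in degree |ζ|, so the sign ω^|γ| is common to all terms and the combination
      -- folds back into e_ζ.
      Ξ-monomial : ∀ ζ v → ev (Ξ ((1# , ζ) ∷ [])) v ≈ ω ^ ∣ ζ ∣ * e ζ (λ i → ω * v i)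
      Ξ-monomial ζ v = begin
        ev (Ξ ((1# , ζ) ∷ [])) v  ≈⟨ Ξ-resp ((1# , ζ) ∷ []) (bind c (λ γ → homogeneous ∣ γ ∣ (E γ))) (monomial~combination ζ) (mon v) ⟩
        ev (Ξ (bind c (λ γ → homogeneous ∣ γ ∣ (E γ)))) v  ≈⟨ Ξ-bind (mon v) c (λ γ → homogeneous ∣ γ ∣ (E γ)) ⟩
        lin (λ γ → ev (Ξ (homogeneous ∣ γ ∣ (E γ))) v) c  ≈⟨ lin-cong c (All.map (λ {ce} eq → trans (Ξ-homogeneous (mon v) (proj₂ ce))
                                                                             (*-cong (reflexive (≡.cong (ω ^_) eq)) (trans (lin-negated ω (mon v) (E (proj₂ ce)))
                                                                                (lin-cong′ (λ e → sym (mon-scale v ω e)) (E (proj₂ ce)))))) (weights-degree ζ)) ⟩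
        lin (λ γ → ω ^ ∣ ζ ∣ * ev (E γ) ωv) c  ≈⟨ lin-* (ω ^ ∣ ζ ∣) (λ γ → ev (E γ) ωv) c ⟩
        ω ^ ∣ ζ ∣ * lin (λ γ → ev (E γ) ωv) c  ≈⟨ *-congˡ (sym (trans (eList~combination ζ (mon ωv)) (lin-bind (mon ωv) c E))) ⟩
        ω ^ ∣ ζ ∣ * ev (eList ζ) ωv  ≈⟨ *-congˡ (ev-eList ζ ωv) ⟩
        ω ^ ∣ ζ ∣ * e ζ ωv ∎
        where
        c = weights ζ
        ωv : Point (suc n)
        ωv i = ω * v i

-- Sums over lists

module ListSums (K : CommutativeRing 0ℓ 0ℓ) where
  open CommutativeRing K hiding (zero)
  open IntegerSolver K

  total : ∀ {A : Set} → (A → Carrier) → List A → Carrier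
  total φ xs = L.foldr _+_ 0# (L.map φ xs)

  total-++ : ∀ {A : Set} (φ : A → Carrier) xs ys → total φ (xs ++ ys) ≈ total φ xs + total φ ys
  total-++ φ [] ys = sym (+-identityˡ _)
  total-++ φ (x ∷ xs) ys = trans (+-congˡ (total-++ φ xs ys)) (sym (+-assoc _ _ _))

  total-↭ : ∀ {A : Set} (φ : A → Carrier) {xs ys} → xs ↭ ys → total φ xs ≈ total φ ys
  total-↭ φ ↭.refl = refl
  total-↭ φ (↭.prep x p) = +-congˡ (total-↭ φ p)
  total-↭ φ {_ ∷ _ ∷ xs} {_ ∷ _ ∷ ys} (↭.swap x y p) = trans (+-congˡ (+-congˡ (total-↭ φ p)))
    (solve 3 (λ a b c → a :+ (b :+ c) := b :+ (a :+ c)) refl (φ x) (φ y) (total φ ys))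
  total-↭ φ (↭.trans p q) = trans (total-↭ φ p) (total-↭ φ q)

  total-scaled : ∀ {A : Set} c {φ ψ : A → Carrier} xs → (∀ {x} → x ∈ xs → φ x ≈ c * ψ x) → total φ xs ≈ c * total ψ xs
  total-scaled c [] h = sym (zeroʳ c)
  total-scaled c (x ∷ xs) h = trans (+-cong (h (here ≡.refl)) (total-scaled c xs (h ∘ there))) (sym (distribˡ c _ _))

-- The Cherednik operator on η* as a sum over P[η]

module PredecessorSum (T : TranscendentalParameter) where
  open TranscendentalParameter T
  open import Algebra.Properties.CommutativeMonoid.Sum +-commutativeMonoid using (sum; sum-cong-≋; ∑-distrib-+)
  open import Relation.Binary.Reasoning.Setoid setoid
  open IntegerSolver K
  open Relabelling
  open Ranks using (indicator)
  open Cherednik T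
  open ListSums K

  sum-if : ∀ {m} (b : Fin m → Bool) x → sum (λ j → if b j then x else 0#) ≈ ι (ℕSum.sum (indicator ∘ b)) * x
  sum-if {zero} b x = sym (trans (*-congʳ ι-zero) (zeroˡ x))
  sum-if {suc m} b x with b zero
  ... | true  = trans (+-congˡ (sum-if (b ∘ suc) x)) (sym (trans (*-congʳ (ι-suc _))
                  (solve 2 (λ c x → (con 1ℤ :+ c) :* x := x :+ c :* x) refl (ι (ℕSum.sum (indicator ∘ b ∘ suc))) x)))
  ... | false = trans (+-identityˡ _) (sum-if (b ∘ suc) x)

  total-concat : ∀ {A : Set} (φ : A → Carrier) {m} (f : Fin m → List A) → total φ (L.concat (L.tabulate f)) ≈ sum (λ j → total φ (f j))
  total-concat φ {zero} f = refl
  total-concat φ {suc m} f = trans (total-++ φ (f zero) _) (+-congˡ (total-concat φ (f ∘ suc)))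

  -- For u ≤ N the difference is an honest sum over u ≤ c < N; `cut≤` supplies this inequality.
  partial-difference : ∀ h {u} (P? : ∀ c → Dec (u ℕ.≤ c)) N → u ℕ.≤ N → partial h N - partial h u ≈ total h (L.filter P? (downFrom N))
  partial-difference h P? zero z≤n = -‿inverseʳ 0#
  partial-difference h {u} P? (suc N) u≤sN with P? N
  ... | yes u≤N = trans (solve 3 (λ x y z → (x :+ y) :- z := y :+ (x :- z)) refl (partial h N) (h N) (partial h u)) (+-congˡ (partial-difference h P? N u≤N))
  ... | no u≰N = trans (trans (+-congˡ (-‿cong (reflexive (≡.cong (partial h) (ℕP.≤-antisym u≤sN (ℕP.≰⇒> u≰N)))))) (-‿inverseʳ _))
                   (reflexive (≡.cong (total h) (≡.sym (none-left N (ℕP.<⇒≤ (ℕP.≰⇒> u≰N))))))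
    where
    none-left : ∀ M → M ℕ.≤ u → L.filter P? (downFrom M) ≡ []
    none-left zero _ = ≡.refl
    none-left (suc M) M<u = ≡.trans (LP.filter-reject P? (ℕP.<⇒≱ M<u)) (none-left M (ℕP.<⇒≤ M<u))

  module _ {n} (η : Vec ℕ (suc n)) (η≢0 : η ≢ replicate (suc n) 0) (φ : Vec ℕ (suc n) → Carrier) where
    open Predecessors using (k; a; ζ; ζₖ; cut; cut?; cut≤; shifted; shiftedBy; family; Pη↭predecessors; contributes; count-contributes)
    private
      κ : Fin (suc n)
      κ = k η η≢0
      α : ℕ
      α = a η η≢0
      ζ′ : Vec ℕ (suc n)
      ζ′ = ζ η η≢0

    unshifted : ∀ {j} → j ≢ κ → shifted η η≢0 j α ≡ ζ′
    unshifted {j} j≢k = ≡.trans (≡.cong₂ (place κ j ζ′) (≡.sym (ζₖ η η≢0))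
      (≡.trans (≡.cong (λ x → x ℕ.+ lookup ζ′ j ℕ.∸ α) (ζₖ η η≢0)) (ℕP.m+n∸m≡n α (lookup ζ′ j)))) (≡.sym (place-self ζ′ j≢k))

    -- The interval of place j runs from `cut j` to α. Its top term, if present, is η* itself and is
    -- split off; the rest is the family of j.
    exchange-predecessors : ∀ j → exchange φ κ j ζ′ ≈ (if contributes η η≢0 j then φ ζ′ else 0#) + total φ (family η η≢0 j)
    exchange-predecessors j = cases (j Fin.≟ κ)
      where
      -- Both `contributes` and `family` branch on `j Fin.≟ κ`; abstracting the decision lets them
      -- reduce together.
      cases : ∀ d → exchange φ κ j ζ′ ≈ (if (if does d then false else does (cut? η η≢0 j α)) then φ ζ′ else 0#) + total φ (shiftedBy η η≢0 j d)
      cases (yes ≡.refl) = trans (exchange-self φ κ ζ′) (sym (+-identityʳ 0#))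
      cases (no j≢k) = begin
        exchange φ κ j ζ′
          ≡⟨ ≡.cong (λ x → partial H (suc x) - partial H (cut η η≢0 j)) (ζₖ η η≢0) ⟩
        partial H (suc α) - partial H (cut η η≢0 j)
          ≈⟨ partial-difference H (cut? η η≢0 j) (suc α) (cut≤ η η≢0 j≢k) ⟩
        total H (L.filter (cut? η η≢0 j) (downFrom (suc α)))
          ≈⟨ top-term (cut? η η≢0 j α) ⟩
        (if does (cut? η η≢0 j α) then φ ζ′ else 0#) + total H (L.filter (cut? η η≢0 j) (downFrom α))
          ≡⟨ ≡.cong (λ xs → (if does (cut? η η≢0 j α) then φ ζ′ else 0#) + L.foldr _+_ 0# xs) (LP.map-∘ (L.filter (cut? η η≢0 j) (downFrom α))) ⟩
        (if does (cut? η η≢0 j α) then φ ζ′ else 0#) + total φ (shiftedBy η η≢0 j (no j≢k)) ∎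
        where
        H : ℕ → Carrier
        H c = φ (shifted η η≢0 j c)
        top-term : ∀ d → total H (L.filter (cut? η η≢0 j) (downFrom (suc α)))
          ≈ (if does d then φ ζ′ else 0#) + total H (L.filter (cut? η η≢0 j) (downFrom α))
        top-term (yes u≤a) = trans (reflexive (≡.cong (total H) (LP.filter-accept (cut? η η≢0 j) u≤a))) (+-congʳ (reflexive (≡.cong φ (unshifted j≢k))))
        top-term (no u≰a) = trans (reflexive (≡.cong (total H) (LP.filter-reject (cut? η η≢0 j) u≰a))) (sym (+-identityˡ _))

    -- The coefficient of η* is w_η without its variable: the diagonal part of ξ gives m - 1, and
    -- each contributing place gives r.
    ξ-predecessors : ξ φ κ ζ′ ≈ (ι (maxη η ℕ.∸ 1) + r * ι (suc n ℕ.∸ 1 ℕ.∸ lη η)) * φ ζ′ + r * total φ (Pη η)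
    ξ-predecessors = begin
      ι (lookup ζ′ κ) * φ ζ′ + r * sum (λ j → exchange φ κ j ζ′)
        ≈⟨ +-cong (*-congʳ (reflexive (≡.cong ι (ζₖ η η≢0)))) (*-congˡ (trans (sum-cong-≋ exchange-predecessors)
             (∑-distrib-+ (λ j → if contributes η η≢0 j then φ ζ′ else 0#) (λ j → total φ (family η η≢0 j))))) ⟩
      ι α * φ ζ′ + r * (sum (λ j → if contributes η η≢0 j then φ ζ′ else 0#) + sum (λ j → total φ (family η η≢0 j)))
        ≈⟨ +-congˡ (*-congˡ (+-cong (trans (sum-if (contributes η η≢0) (φ ζ′)) (*-congʳ (reflexive (≡.cong ι (count-contributes η η≢0)))))
             (trans (sym (total-concat φ (family η η≢0))) (sym (total-↭ φ (Pη↭predecessors η η≢0)))))) ⟩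
      ι α * φ ζ′ + r * (ι (suc n ℕ.∸ 1 ℕ.∸ lη η) * φ ζ′ + total φ (Pη η))
        ≈⟨ solve 5 (λ x y r c t → x :* y :+ r :* (c :* y :+ t) := (x :+ r :* c) :* y :+ r :* t) refl (ι α) (φ ζ′) r (ι (suc n ℕ.∸ 1 ℕ.∸ lη η)) (total φ (Pη η)) ⟩
      (ι α + r * ι (suc n ℕ.∸ 1 ℕ.∸ lη η)) * φ ζ′ + r * total φ (Pη η) ∎

-- Powers and coefficients are abstract here so that Defs._^F_ and Defs.coeff can be substituted for them.
record Notation (T : TranscendentalParameter) : Set where
  open TranscendentalParameter T
  field
    pow             : Carrier → ℕ → Carrier
    pow-zero        : ∀ x → pow x 0 ≡ 1#
    pow-suc         : ∀ x k → pow x (suc k) ≡ x * pow x k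
    coefficient     : ∀ {n} → List (Carrier × Vec ℕ n) → Vec ℕ n → Carrier
    coefficient-[]  : ∀ {n} (η : Vec ℕ n) → coefficient [] η ≡ 0#
    coefficient-∷   : ∀ {n} c e (p : List (Carrier × Vec ℕ n)) η
      → coefficient ((c , e) ∷ p) η ≡ (if does (VP.≡-dec ℕ._≟_ e η) then c + coefficient p η else coefficient p η)

-- The recursion over an abstract field

module Main (T : TranscendentalParameter) (𝒩 : Notation T) where
  open TranscendentalParameter T
  open Notation 𝒩
  open import Algebra.Properties.Semiring.Exp semiring using (_^_)
  open import Algebra.Properties.Group +-group using () renaming (x∙y⁻¹≈ε⇒x≈y to x-y≈0⇒x≈y)
  open import Relation.Binary.Reasoning.Setoid setoid
  open IntegerSolver K
  open Relabelling
  open Ranks using (corank-spec)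
  open ListSums K
  open Polynomials K
  open Nodes T
  open Transport T
  open Interpolation T
  open Raising T
  open PredecessorSum T

  infix 4 _≐_
  _≐_ : ∀ {n} → Comb (Vec ℕ n) → Comb (Vec ℕ n) → Set
  p ≐ q = ∀ η → coefficient p η ≈ coefficient q η

  coefficient-lin : ∀ {n} (p : Comb (Vec ℕ n)) η → coefficient p η ≈ lin (δ η) p
  coefficient-lin [] η = reflexive (coefficient-[] η)
  coefficient-lin ((c , e) ∷ p) η = trans (reflexive (coefficient-∷ c e p η)) (cases (does (VP.≡-dec ℕ._≟_ e η)))
    where
    cases : ∀ b → (if b then c + coefficient p η else coefficient p η) ≈ c * (if b then 1# else 0#) + lin (δ η) p
    cases true  = +-cong (sym (*-identityʳ c)) (coefficient-lin p η)
    cases false = trans (coefficient-lin p η) (sym (trans (+-congʳ (zeroʳ c)) (+-identityˡ _)))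

  ≐⇒~ : ∀ {n} (p q : Comb (Vec ℕ n)) → p ≐ q → p ~ q
  ≐⇒~ p q h = coefficients-agree⇒~ p q λ η → trans (sym (coefficient-lin p η)) (trans (h η) (coefficient-lin q η))

  ~⇒≐ : ∀ {n} (p q : Comb (Vec ℕ n)) → p ~ q → p ≐ q
  ~⇒≐ p q h η = trans (coefficient-lin p η) (trans (h (δ η)) (sym (coefficient-lin q η)))

  pow≡^ : ∀ x k → pow x k ≡ x ^ k
  pow≡^ x zero    = pow-zero x
  pow≡^ x (suc k) = ≡.trans (pow-suc x k) (≡.cong (x *_) (pow≡^ x k))

  monomialAt : ∀ {n} → Vec Carrier n → Vec ℕ n → Carrier
  monomialAt v e = L.foldr _*_ 1# (V.toList (V.zipWith pow v e))

  monomialAt-mon : ∀ {n} (v : Vec Carrier n) e → monomialAt v e ≈ mon (lookup v) e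
  monomialAt-mon [] [] = refl
  monomialAt-mon (x ∷ v) (k ∷ e) = *-cong (reflexive (pow≡^ x k)) (monomialAt-mon v e)

  barNode : ∀ {n} → Vec ℕ n → Vec Carrier n
  barNode {n} γ = V.tabulate λ i → ι (lookup γ i) + r * ι (n ℕ.∸ 1 ℕ.∸ rank γ i)

  barNode-node : ∀ {n} (γ : Vec ℕ n) i → lookup (barNode γ) i ≈ node γ i
  barNode-node γ i = reflexive (≡.trans (VP.lookup∘tabulate _ i) (≡.cong (λ k → ι (lookup γ i) + r * ι k) (corank-spec γ i)))

  IsUnit : Carrier → Set
  IsUnit x = Σ[ y ∈ Carrier ] x * y ≈ 1#

  product-unit : ∀ xs → All IsUnit xs → IsUnit (L.foldr _*_ 1# xs)
  product-unit [] [] = 1# , *-identityˡ 1#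
  product-unit (x ∷ xs) ((y , xy≈1) ∷ us) with product-unit xs us
  ... | z , pz≈1 = y * z , trans (solve 4 (λ x p y z → (x :* p) :* (y :* z) := (x :* y) :* (p :* z)) refl x (L.foldr _*_ 1# xs) y z)
                      (trans (*-cong xy≈1 pz≈1) (*-identityˡ 1#))

  -- r (α a + l) = a + r l, which is nonzero as r is transcendental.
  hook-unit : ∀ {α} → r * α ≈ 1# → ∀ a l → IsUnit (α * ι (a ℕ.+ 1) + ι (l ℕ.+ 1))
  hook-unit {α} rα≈1 a l with 0-or-unit (α * ι (a ℕ.+ 1) + ι (l ℕ.+ 1))
  ... | inj₂ u = u
  ... | inj₁ z = contradiction (≡.trans (≡.sym (ℕP.+-comm a 1)) (proj₁ (r-transcendental {a ℕ.+ 1} {l ℕ.+ 1} {0} {0} (begin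
    ι (a ℕ.+ 1) + r * ι (l ℕ.+ 1)  ≈⟨ +-congʳ (sym (trans (*-congʳ rα≈1) (*-identityˡ _))) ⟩
    r * α * ι (a ℕ.+ 1) + r * ι (l ℕ.+ 1)  ≈⟨ solve 4 (λ r α a l → r :* α :* a :+ r :* l := r :* (α :* a :+ l)) refl r α (ι (a ℕ.+ 1)) (ι (l ℕ.+ 1)) ⟩
    r * (α * ι (a ℕ.+ 1) + ι (l ℕ.+ 1))  ≈⟨ *-congˡ z ⟩
    r * 0#  ≈⟨ trans (zeroʳ r) (sym (trans (+-cong ι-zero (trans (*-congˡ ι-zero) (zeroʳ r))) (+-identityˡ 0#))) ⟩
    ι 0 + r * ι 0 ∎)))) λ ()

  -- Written like `_*P_`, as `sumOf` and `linearFactor` are like `sumP` and `wη`, so that they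
  -- coincide by computation once the field is filled in.
  product : ∀ {n} → Comb (Vec ℕ n) → Comb (Vec ℕ n) → Comb (Vec ℕ n)
  product p q = L.concatMap (λ ce → L.map (λ df → (proj₁ ce * proj₁ df , V.zipWith ℕ._+_ (proj₂ ce) (proj₂ df))) q) p

  sumOf : ∀ {n} → List (Comb (Vec ℕ n)) → Comb (Vec ℕ n)
  sumOf = L.foldr _++_ []

  linearFactor : ∀ {n} → Fin n → Carrier → Comb (Vec ℕ n)
  linearFactor {n} k c = ((1# , V.tabulate (λ i → if does (i Fin.≟ k) then 1 else 0)) ∷ []) ++ ((c , replicate n 0) ∷ [])

  ev-product : ∀ {n} (p q : Comb (Vec ℕ n)) v → ev (product p q) v ≈ ev p v * ev q v
  ev-product [] q v = sym (zeroˡ _)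
  ev-product ((c , d) ∷ p) q v = trans (lin-++ (mon v) (L.map (λ df → (c * proj₁ df , V.zipWith ℕ._+_ d (proj₂ df))) q) (product p q))
    (trans (+-cong (term q) (ev-product p q v)) (sym (distribʳ (ev q v) (c * mon v d) (ev p v))))
    where
    term : ∀ q → ev (L.map (λ df → (c * proj₁ df , V.zipWith ℕ._+_ d (proj₂ df))) q) v ≈ (c * mon v d) * ev q v
    term [] = sym (zeroʳ _)
    term ((x , e) ∷ q) = trans (+-cong (*-congˡ (mon-+ v d e)) (term q))
      (solve 5 (λ c x m m′ t → c :* x :* (m :* m′) :+ c :* m :* t := c :* m :* (x :* m′ :+ t)) refl c x (mon v d) (mon v e) (ev q v))

  ev-sumOf : ∀ {n} {A : Set} (f : A → Comb (Vec ℕ n)) xs v → ev (sumOf (map f xs)) v ≈ total (λ x → ev (f x) v) xs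
  ev-sumOf f [] v = refl
  ev-sumOf f (x ∷ xs) v = trans (lin-++ (mon v) (f x) (sumOf (map f xs))) (+-congˡ (ev-sumOf f xs v))

  ev-linearFactor : ∀ {n} (k : Fin n) c v → ev (linearFactor k c) v ≈ v k + c
  ev-linearFactor {n} k c v = +-cong
    (trans (*-identityˡ _) (trans (reflexive (≡.cong (mon v) unit)) (trans (mon-⁺ v (replicate n 0) k) (trans (*-congˡ (mon-0 v)) (*-identityʳ _)))))
    (trans (+-identityʳ _) (trans (*-congˡ (mon-0 v)) (*-identityʳ c)))
    where
    unit : V.tabulate (λ i → if does (i Fin.≟ k) then 1 else 0) ≡ replicate n 0 ⁺ k
    unit = vec-ext λ i → ≡.trans (VP.lookup∘tabulate _ i) (cases i (i Fin.≟ k))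
      where
      cases : ∀ i (d : Dec (i ≡ k)) → (if does d then 1 else 0) ≡ lookup (replicate n 0 ⁺ k) i
      cases i (yes ≡.refl) = ≡.sym (≡.trans (lookup-⁺-≡ (replicate n 0) k) (≡.cong suc (VP.lookup-replicate k 0)))
      cases i (no i≢k) = ≡.sym (≡.trans (lookup-⁺-≢ (replicate n 0) i≢k) (VP.lookup-replicate i 0))

  -- `IsInterp` and `IsXi` unfolded over the abstract field. The element ω stands for the constant
  -- -1 of `sgnF`, which is known here only through ω + 1 ≈ 0.
  module _ {n} (E : Vec ℕ (suc n) → Comb (Vec ℕ (suc n))) (Ξ : Comb (Vec ℕ (suc n)) → Comb (Vec ℕ (suc n)))
    (ω : Carrier) (ω+1≈0 : ω + 1# ≈ 0#) (d : Vec ℕ (suc n) → Carrier) (d-unit : ∀ γ → IsUnit (d γ))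
    (E-degree : ∀ η γ → ∣ η ∣ ℕ.< ∣ γ ∣ → coefficient (E η) γ ≈ 0#)
    (E-leading : ∀ η → coefficient (E η) η ≈ 1#)
    (E-vanish : ∀ η γ → γ ≢ η → ∣ γ ∣ ℕ.≤ ∣ η ∣ → lin (monomialAt (barNode γ)) (E η) ≈ 0#)
    (Ξ-resp : ∀ p q → p ≐ q → Ξ p ≐ Ξ q)
    (Ξ-++ : ∀ p q → Ξ (p ++ q) ≐ Ξ p ++ Ξ q)
    (Ξ-scale : ∀ c p → Ξ (scale c p) ≐ scale c (Ξ p))
    (Ξ-E : ∀ γ → Ξ (scale (d γ) (homogeneous ∣ γ ∣ (E γ)))
      ≐ scale (pow ω ∣ γ ∣ * d γ) (L.map (λ ce → (pow ω ∣ proj₂ ce ∣ * proj₁ ce , proj₂ ce)) (E γ))) where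

    open Expansion E
      (λ η γ l → trans (sym (coefficient-lin (E η) γ)) (E-degree η γ l))
      (λ η → trans (sym (coefficient-lin (E η) η)) (E-leading η))
      (λ η γ γ≢η l → trans (sym (trans (lin-cong′ (monomialAt-mon (barNode γ)) (E η)) (ev-cong (E η) (barNode-node γ)))) (E-vanish η γ γ≢η l))

    monomial : Vec ℕ (suc n) → Comb (Vec ℕ (suc n))
    monomial η = (1# , η) ∷ []

    Ξ-monomial′ : ∀ ζ v → ev (Ξ (monomial ζ)) v ≈ ω ^ ∣ ζ ∣ * e ζ (λ i → ω * v i)
    Ξ-monomial′ = Ξ-monomial ω d d-unit Ξ
      (λ p q h → ≐⇒~ (Ξ p) (Ξ q) (Ξ-resp p q (~⇒≐ p q h)))
      (λ p q → ≐⇒~ (Ξ (p ++ q)) (Ξ p ++ Ξ q) (Ξ-++ p q))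
      (λ c p → ≐⇒~ (Ξ (scale c p)) (scale c (Ξ p)) (Ξ-scale c p))
      (λ γ φ → trans (≐⇒~ (Ξ (scale (d γ) (homogeneous ∣ γ ∣ (E γ)))) _ (Ξ-E γ) φ)
        (reflexive (≡.cong₂ (λ c p → lin φ (scale (c * d γ) p)) (pow≡^ ω ∣ γ ∣)
          (LP.map-cong (λ ce → ≡.cong (λ c → c * proj₁ ce , proj₂ ce) (pow≡^ ω ∣ proj₂ ce ∣)) (E γ)))))

    ω≈-1 : ω ≈ - 1#
    ω≈-1 = x-y≈0⇒x≈y ω (- 1#) (trans (solve 1 (λ w → w :- :- con 1ℤ := w :+ con 1ℤ) refl ω) ω+1≈0)

    recursion : ∀ η → η ≢ replicate (suc n) 0
      → Ξ (monomial η) ≐ product (linearFactor (kη η) (ι (maxη η ℕ.∸ 1) + r * ι (suc n ℕ.∸ 1 ℕ.∸ lη η))) (Ξ (monomial (ηstar η)))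
          ++ scale r (sumOf (map (λ γ → Ξ (monomial γ)) (Pη η)))
    recursion η η≢0 = ~⇒≐ (Ξ (monomial η)) RHS (values-agree⇒~ (Ξ (monomial η)) RHS λ v → begin
      ev (Ξ (monomial η)) v
        ≈⟨ Ξ-monomial′ η v ⟩
      W ^ ∣ η ∣ * e η (x v)
        ≡⟨ ≡.cong (λ d → W ^ d * e η (x v)) (≡.trans (≡.cong ∣_∣ (≡.sym (ζ⁺k η η≢0))) (∣⁺∣ ζ k)) ⟩
      W * P * e η (x v)
        ≈⟨ *-congˡ (lowered v) ⟩
      W * P * (W * v k * e ζ (x v) - (c * e ζ (x v) + r * total (λ γ → e γ (x v)) (Pη η)))
        ≈⟨ *-cong (*-congʳ ω≈-1) (+-congʳ (*-congʳ (*-congʳ ω≈-1))) ⟩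
      -- One sign comes from |η| = |η*| + 1 and one from evaluating x_k at -v. They cancel in the
      -- product term, while the subtracted ξ-part becomes positive.
      - 1# * P * (- 1# * v k * e ζ (x v) - (c * e ζ (x v) + r * total (λ γ → e γ (x v)) (Pη η)))
        ≈⟨ solve 6 (λ p y a c r s → :- con 1ℤ :* p :* (:- con 1ℤ :* y :* a :- (c :* a :+ r :* s)) := (y :+ c) :* (p :* a) :+ r :* (p :* s)) refl
             P (v k) (e ζ (x v)) c r (total (λ γ → e γ (x v)) (Pη η)) ⟩
      (v k + c) * (P * e ζ (x v)) + r * (P * total (λ γ → e γ (x v)) (Pη η))
        ≈⟨ +-cong (*-cong (sym (ev-linearFactor k c v)) (sym (Ξ-monomial′ ζ v))) (*-congˡ (sym (total-scaled P (Pη η) (λ γ∈ → same-degree v γ∈)))) ⟩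
      ev w v * ev (Ξ (monomial ζ)) v + r * total (λ γ → ev (Ξ (monomial γ)) v) (Pη η)
        ≈⟨ sym (+-cong (ev-product w (Ξ (monomial ζ)) v) (trans (lin-scale (mon v) r sum) (*-congˡ (ev-sumOf (λ γ → Ξ (monomial γ)) (Pη η) v)))) ⟩
      ev (product w (Ξ (monomial ζ))) v + ev (scale r sum) v
        ≈⟨ sym (lin-++ (mon v) (product w (Ξ (monomial ζ))) (scale r sum)) ⟩
      ev RHS v ∎)
      where
      open Predecessors using (ζ⁺k; ∈-Pη⇒IsShifted; ∣shifted∣)
      W = ω
      k = kη η
      ζ = ηstar η
      c = ι (maxη η ℕ.∸ 1) + r * ι (suc n ℕ.∸ 1 ℕ.∸ lη η)
      w : Comb (Vec ℕ (suc n))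
      w = linearFactor k c
      P : Carrier
      P = W ^ ∣ ζ ∣
      sum RHS : Comb (Vec ℕ (suc n))
      sum = sumOf (map (λ γ → Ξ (monomial γ)) (Pη η))
      RHS = product w (Ξ (monomial ζ)) ++ scale r sum
      x : Point (suc n) → Point (suc n)
      x v i = W * v i
      lowered : ∀ v → e η (x v) ≈ W * v k * e ζ (x v) - (c * e ζ (x v) + r * total (λ γ → e γ (x v)) (Pη η))
      lowered v = begin
        e η (x v)  ≈⟨ solve 2 (λ a b → a := (a :+ b) :- b) refl (e η (x v)) X ⟩
        (e η (x v) + X) - X  ≈⟨ +-congʳ (+-cong (reflexive (≡.cong (λ μ → e μ (x v)) (≡.sym (ζ⁺k η η≢0)))) (sym (ξ-predecessors η η≢0 (λ μ → e μ (x v))))) ⟩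
        raised k ζ (x v) - X  ≈⟨ +-congʳ (sym (raising ζ k (x v))) ⟩
        W * v k * e ζ (x v) - X ∎
        where X = c * e ζ (x v) + r * total (λ γ → e γ (x v)) (Pη η)
      -- Moving l from place k to place j keeps the degree of η*, so the sign P serves the whole
      -- sum.
      same-degree : ∀ v {γ} → γ ∈ Pη η → ev (Ξ (monomial γ)) v ≈ P * e γ (x v)
      same-degree v {γ} γ∈ = trans (Ξ-monomial′ γ v) (*-congʳ (reflexive (≡.cong (W ^_) (∣shifted∣ η η≢0 (proj₂ (∈-Pη⇒IsShifted η η≢0 γ∈))))))

-- The recursion over the rational functions

theorem4p19 : (n : ℕ) (E : Vec ℕ (suc n) → Poly (suc n)) (Ξ : Poly (suc n) → Poly (suc n))
    → (∀ η → IsInterp η (E η)) → IsXi Ξ E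
    → (η : Vec ℕ (suc n)) → η ≢ replicate (suc n) 0
    → Ξ (mono η) ≈P wη η *P Ξ (mono (ηstar η)) +P rF • sumP (map (λ γ → Ξ (mono γ)) (Pη η))
theorem4p19 n E Ξ interp (Ξ-resp , Ξ-++ , Ξ-scale , Ξ-E) η η≢0 ν = ≋⇒≈F (coeff (Ξ (mono η)) ν)
  (coeff (wη η *P Ξ (mono (ηstar η)) +P rF • sumP (map (λ γ → Ξ (mono γ)) (Pη η))) ν)
  -- Each hypothesis is converted between `_≈F_` and its wrapped form `_≋_`; the polynomials on both
  -- sides already agree by computation.
  (recursion E Ξ (ℤF ℤ.-1ℤ) -1F-inverse dη dη-unit
    (λ η γ l → ≈F⇒≋ (coeff (E η) γ) 0F (proj₁ (interp η) γ l))
    (λ η → ≈F⇒≋ (coeff (E η) η) 1F (proj₁ (proj₂ (interp η))))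
    (λ η γ γ≢η l → ≈F⇒≋ (eval (E η) (bar γ)) 0F (proj₂ (proj₂ (interp η)) γ γ≢η l))
    (λ p q h ν → ≈F⇒≋ (coeff (Ξ p) ν) (coeff (Ξ q) ν) (Ξ-resp p q (λ μ → ≋⇒≈F (coeff p μ) (coeff q μ) (h μ)) ν))
    (λ p q ν → ≈F⇒≋ (coeff (Ξ (p +P q)) ν) (coeff (Ξ p +P Ξ q) ν) (Ξ-++ p q ν))
    (λ c p ν → ≈F⇒≋ (coeff (Ξ (c • p)) ν) (coeff (c • Ξ p) ν) (Ξ-scale c p ν))
    (λ γ ν → ≈F⇒≋ (coeff (Ξ (Fα E γ)) ν) (coeff (Frδ E γ) ν) (Ξ-E γ ν))
    η η≢0 ν)
  where
  open RationalFunctions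
  parameter : TranscendentalParameter
  parameter = record
    { K = 𝔽-ring ; 0-or-unit = zero-or-unit ; ι = ℕF ; ι-zero = F.refl ; ι-suc = ℕF-suc
    ; r = rF ; r-transcendental = r-transcendental }

  notation : Notation parameter
  notation = record
    { pow = _^F_ ; pow-zero = λ _ → ≡.refl ; pow-suc = λ _ _ → ≡.refl
    ; coefficient = coeff ; coefficient-[] = λ _ → ≡.refl ; coefficient-∷ = λ _ _ _ _ → ≡.refl }

  open Main parameter notation

  dη-unit : ∀ γ → IsUnit (dη γ)
  dη-unit γ = product-unit _ (AllP.concat⁺ (AllP.map⁺ (All.universal
    (λ i → AllP.map⁺ (All.universal (λ j → hook-unit {αF} αF-inverse (lookup γ i ℕ.∸ j) (legη γ i j)) (map suc (L.upTo (lookup γ i))))) (L.allFin (suc n)))))
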